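{- For every positive integer $r$ let $v_r=\lim_{n\to\infty}V_{n,r}$, where $V_{n,r}$ is the probability that a vertex chosen uniformly at random from the set of all vertices of all labeled non-plane 1-2 trees on vertex set $[n]$ is the root of a subtree of size exactly $r$ (these limits exist). Then \[\sum_{r=1}^\infty v_r=1.\]
   Context: A labeled non-plane 1-2 tree on vertex set $[n]=\{1,\dots,n\}$ is a rooted tree whose vertices are bijectively labeled by $[n]$, in which every vertex has at most two children, the label of each non-root vertex is less than the label of its parent, and the children of a vertex are unordered. The subtree of a vertex $v$ consists of $v$ and all its descendants; its size is its number of vertices. The random vertex is chosen uniformly among all pairs $(T,v)$ with $T$ such a tree on $[n]$ and $v$ a vertex of $T$. -}

module Defs where

open import Data.Nat using (ℕ; zero; suc; _+_; _*_; _∸_; _≡ᵇ_; _≤ᵇ_)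
open import Data.Bool using (Bool; true; false; _∧_; _∨_; if_then_else_)
open import Data.List using (List; []; _∷_; [_]; map; concatMap; upTo; length; filterᵇ)
open import Data.Nat.ListAction using (sum)
open import Data.Integer using (+_)
open import Data.Rational using (ℚ; 0ℚ; _/_) renaming (_+_ to _+ℚ_)

-- A labeled non-plane 1-2 tree on [n] (n ≥ 1) is determined by its parent
-- function: the root is n, and every k ∈ {1,…,n-1} has a parent p(k) with
-- k < p(k) ≤ n; the tree is a 1-2 tree iff every vertex has at most two
-- children.  Since children are unordered, distinct parent functions are
-- exactly distinct trees.  We encode a tree as the list [p(1), …, p(n-1)].

parentLists : ℕ → ℕ → ℕ → List (List ℕ)
parentLists n k zero    = [ [] ]
parentLists n k (suc m) =
  concatMap (λ p → map (p ∷_) (parentLists n (suc k) m))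
            (map (λ i → suc k + i) (upTo (n ∸ k)))

numChildren : List ℕ → ℕ → ℕ
numChildren ps v = length (filterᵇ (λ p → p ≡ᵇ v) ps)

vertices : ℕ → List ℕ
vertices n = map suc (upTo n)

allB : List ℕ → (ℕ → Bool) → Bool
allB []       f = true
allB (x ∷ xs) f = f x ∧ allB xs f

isOneTwo : ℕ → List ℕ → Bool
isOneTwo n ps = allB (vertices n) (λ v → numChildren ps v ≤ᵇ 2)

trees : ℕ → List (List ℕ)
trees n = filterᵇ (isOneTwo n) (parentLists n 1 (n ∸ 1))

-- parent of vertex k (k ≤ n-1); the list is indexed from 1
parentOf : List ℕ → ℕ → ℕ
parentOf []       k             = 0
parentOf (p ∷ ps) zero          = 0
parentOf (p ∷ ps) (suc zero)    = p
parentOf (p ∷ ps) (suc (suc k)) = parentOf ps (suc k)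

ancOrSelf : List ℕ → ℕ → ℕ → ℕ → Bool
ancOrSelf ps v k zero       = k ≡ᵇ v
ancOrSelf ps v k (suc fuel) = (k ≡ᵇ v) ∨ ancOrSelf ps v (parentOf ps k) fuel

subtreeSize : ℕ → List ℕ → ℕ → ℕ
subtreeSize n ps v = length (filterᵇ (λ k → ancOrSelf ps v k n) (vertices n))

countPairs : ℕ → ℕ → ℕ
countPairs n r =
  sum (map (λ ps → length (filterᵇ (λ v → subtreeSize n ps v ≡ᵇ r) (vertices n)))
           (trees n))

frac : ℕ → ℕ → ℚ
frac a zero    = 0ℚ
frac a (suc b) = (+ a) / suc b

-- V n r : probability that a uniformly random (T , v) has subtree size r
-- (set to 0 when there are no pairs, i.e. n = 0)
V : ℕ → ℕ → ℚ
V n r = frac (countPairs n r) (n * length (trees n))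

partialSum : ℕ → ℕ → ℚ
partialSum n zero    = 0ℚ
partialSum n (suc R) = partialSum n R +ℚ V n (suc R)

{-# OPTIONS --safe #-}

-- Inserting the labels n, n-1, …, 1 in turn as leaves grows every 1-2 tree exactly once, and the number of ways to
-- go on depends only on the numbers a of leaves and b of one-child vertices: it has the exponential generating
-- function φ^a ψ^b, where φ′ = φψ and ψ′ = φ, so that 2φ = 1 + ψ² (in fact ψ = sec + tan, and ψ counts the trees).
-- Let t_n be the number of trees and f_n = t_n/n!.  The pairs (T, v) on [n] with a subtree of size r number
-- t_r · n! [xⁿ] W_r, where W_r′ = ψ W_r + x^(r-1)/(r-1)!.  The relation 2φ = 1 + ψ² turns this into
-- n! [xⁿ] (W_r + W_{r-2}) = binom(n+1, r) t_{n+1-r} for n ≥ r, so n! [xⁿ] W_r / (n+1)! is an alternating sum of the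
-- f_{n+1-r+2i}/(r-2i)!, that is, the remainder of a truncated cosine or sine series; it is nonnegative because it
-- counts something.  The cosine identity expresses f_m/f_{m-2} through earlier ratios f_{k-2}/f_k with so small
-- coefficients that it contracts their oscillation, and the sine identity then makes f_m/f_{m-1} Cauchy; hence all
-- V_{n,r} are.
-- For the sum, Σ_r binom(r-1, k) t_{r-k} · n! [xⁿ] W_r = binom(n, k+1) t_{n-k}.  With e_n = t_{n+1}/n!, the ratio
-- e_n/e_{n-k} is eventually within a factor 2 of a constant, and comparing t_r with binom(r-1, k) t_{r-k} bounds the
-- proportion of vertices with a large subtree by 2/(k+1).

module Submission where

-- The ratio f_{m-1}/f_m tends to c = π/2, the first pole of ψ, and already v_1 = 1 - 2/π is
-- irrational. Inside ℚ a limit can therefore only appear as a Cauchy condition, and the value of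
-- the sum as a bound on 1 minus a partial sum at finite n. Convergence of the ratios has to be
-- extracted from the counts themselves. The two series are finite forms of cos c = 0 and sin c = 1,
-- with f_{m-k}/f_m in the place of c^k and a remainder at the end that lies between 0 and the next
-- term. Both series run over even k only, hence over products of the two-step ratio f_{m-2}/f_m.
-- The head of the cosine series is a function of that same ratio, so the identity closes up into a
-- recursion which can contract; the head of the sine series is the one-step ratio, which can then
-- be read off. No limit is ever exchanged with the sum over r: the bound on large subtrees is
-- proved for each fixed n.

open import Defs
open import Data.Nat using (ℕ; zero; suc; pred; _+_; _*_; _∸_; _⊔_; _!; _≤_; _<_; z≤n; s≤s; _≡ᵇ_; _≤ᵇ_)
open import Data.Product using (_×_; _,_; proj₁; proj₂; ∃-syntax)
open import Data.Rational using (ℚ; 0ℚ; 1ℚ; ½; ∣_∣; -_; _-_; positive) renaming (_≤_ to _≤ℚ_; _<_ to _<ℚ_; _+_ to _+ℚ_; _*_ to _*ℚ_)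
open import Function using (_∘_)
open import Relation.Binary.PropositionalEquality

-- Counting by insertion of leaves, and the identities between the counts.

module Growth where

  open import Data.Nat.Properties
  open import Data.Nat.Tactic.RingSolver using (solve-∀)

  -- One insertion step: below a leaf (its parent then has one child) or below a one-child vertex.
  grow : (ℕ → ℕ → ℕ) → ℕ → ℕ → ℕ
  grow f a b = a * f a (suc b) + b * f (suc a) (pred b)

  -- k! [x^k] of φ^a ψ^b x^j/j!: of k insertions, j are made in a separate part of the tree.
  P : ℕ → ℕ → ℕ → ℕ → ℕ
  P zero    zero    a b = 1
  P (suc j) zero    a b = 0
  P zero    (suc k) a b = grow (P zero k) a b
  P (suc j) (suc k) a b = grow (P (suc j) k) a b + P j k a b

  -- The state (0, 1) is the empty tree: its only slot takes the root, which leaves a single leaf,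
  -- state (1, 0). The values 1, 1, 1, 2, 5, 16, ... are Euler's zigzag numbers.
  t : ℕ → ℕ
  t n = P 0 n 0 1

  -- k! [x^k] of φ^a ψ^b W_{i+1}.
  W : ℕ → ℕ → ℕ → ℕ → ℕ
  W i zero    a b = 0
  W i (suc k) a b = grow (W i k) a b + W i k a (suc b) + P i k a b

  -- A subtree is attached to a vertex counted in a or b and then set aside: the other vertices are in the state at
  -- which f is evaluated.  On generating functions, φ^a ψ^b y becomes (φ^a ψ^b)′ y / φ.
  attach : (ℕ → ℕ → ℕ) → ℕ → ℕ → ℕ
  attach f a b = a * f (pred a) (suc b) + b * f a (pred b)

  -- Division by φ removes the term ψ W_{i+1}: since φ′ = φψ, the derivative of W_{i+1}/φ is x^i/(i!
  -- φ). What remains is the growth of the factor (φ^a ψ^b)′ and the source divided by φ.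
  attach-W : ∀ i k a b → attach (W i (suc k)) a b ≡ grow (attach (W i k)) a b + attach (P i k) a b
  attach-W i k zero zero = refl
  attach-W i k (suc a) zero = lem a (W i k a 2) (W i k (suc a) 0) (P i k a 1)
    where
    lem : ∀ a x y p → suc a * (a * x + (1 * y) + x + p) + 0 ≡ suc a * (suc a * x + (1 * y)) + 0 + (suc a * p + 0)
    lem = solve-∀
  attach-W i k zero (suc b) = lem b (W i k 0 (suc b)) (W i k 1 (pred b)) (P i k 0 b)
    where
    lem : ∀ b y z p → suc b * (b * z + y + p) ≡ suc b * (1 * y + b * z) + suc b * p
    lem = solve-∀
  attach-W i k (suc a) (suc b) = lem a b (W i k a (3 + b)) (W i k (suc a) (suc b)) (W i k (2 + a) (pred b)) (P i k a (2 + b)) (P i k (suc a) b)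
    where
    lem : ∀ a b x y z p q →
      suc a * (a * x + suc (suc b) * y + x + p) + suc b * (suc a * y + b * z + y + q)
      ≡ suc a * (suc a * x + suc (suc b) * y) + suc b * (suc (suc a) * y + b * z) + (suc a * p + suc b * q)
    lem = solve-∀

  -- 2φ = 1 + ψ² is preserved by differentiation.
  grow-double : ∀ f → (∀ a b → 2 * f (suc a) b ≡ f a b + f a (2 + b)) →
                ∀ a b → 2 * grow f (suc a) b ≡ grow f a b + grow f a (2 + b)
  grow-double f h a zero =
    trans (l₁ a (f (suc a) 1)) (trans (cong (λ w → a * w + 2 * f (suc a) 1) (h a 1)) (l₂ a (f (suc a) 1) (f a 1) (f a 3)))
    where
    l₁ : ∀ a x → 2 * (suc a * x + 0) ≡ a * (2 * x) + 2 * x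
    l₁ = solve-∀
    l₂ : ∀ a x y z → a * (y + z) + 2 * x ≡ a * y + 0 + (a * z + 2 * x)
    l₂ = solve-∀
  grow-double f h a (suc b) =
    trans (l₁ a b (f (suc a) (2 + b)) (f (2 + a) b))
    (trans (cong₂ (λ w w′ → a * w + 2 * f (suc a) (2 + b) + suc b * w′) (h a (2 + b)) (h (suc a) b))
           (l₂ a b (f (suc a) (2 + b)) (f a (2 + b)) (f a (4 + b)) (f (suc a) b)))
    where
    l₁ : ∀ a b x u → 2 * (suc a * x + suc b * u) ≡ a * (2 * x) + 2 * x + suc b * (2 * u)
    l₁ = solve-∀
    l₂ : ∀ a b x y z v → a * (y + z) + 2 * x + suc b * (v + x) ≡ a * y + suc b * v + (a * z + suc (suc (suc b)) * x)
    l₂ = solve-∀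

  P-double : ∀ j k a b → 2 * P j k (suc a) b ≡ P j k a b + P j k a (2 + b)
  P-double zero    zero    a b = refl
  P-double (suc j) zero    a b = refl
  P-double zero    (suc k) a b = grow-double (P 0 k) (P-double 0 k) a b
  P-double (suc j) (suc k) a b =
    trans (*-distribˡ-+ 2 (grow (P (suc j) k) (suc a) b) (P j k (suc a) b))
    (trans (cong₂ _+_ (grow-double (P (suc j) k) (P-double (suc j) k) a b) (P-double j k a b))
           (l (grow (P (suc j) k) a b) (grow (P (suc j) k) a (2 + b)) (P j k a b) (P j k a (2 + b))))
    where
    l : ∀ x y z w → x + y + (z + w) ≡ x + z + (y + w)
    l = solve-∀

  grow-cong : ∀ {f g} → (∀ a b → f a b ≡ g a b) → ∀ a b → grow f a b ≡ grow g a b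
  grow-cong h a b = cong₂ (λ x y → a * x + b * y) (h a (suc b)) (h (suc a) (pred b))

  grow-+ : ∀ f g a b → grow (λ a b → f a b + g a b) a b ≡ grow f a b + grow g a b
  grow-+ f g a b = l a b (f a (suc b)) (g a (suc b)) (f (suc a) (pred b)) (g (suc a) (pred b))
    where
    l : ∀ a b x y z w → a * (x + y) + b * (z + w) ≡ a * x + b * z + (a * y + b * w)
    l = solve-∀

  grow-sucˡ : ∀ f a b → grow f (suc a) b ≡ grow (λ a b → f (suc a) b) a b + f (suc a) (suc b)
  grow-sucˡ f a b = l a (f (suc a) (suc b)) (b * f (2 + a) (pred b))
    where
    l : ∀ a x y → suc a * x + y ≡ a * x + y + x
    l = solve-∀

  grow-sucʳ : ∀ f a b → grow f a (suc b) ≡ grow (λ a b → f a (suc b)) a b + f (suc a) b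
  grow-sucʳ f a zero = cong₂ _+_ (sym (+-identityʳ (a * f a 2))) (+-identityʳ (f (suc a) 0))
  grow-sucʳ f a (suc b) = l b (a * f a (3 + b)) (f (suc a) (suc b))
    where
    l : ∀ b x y → x + suc (suc b) * y ≡ x + suc b * y + y
    l = solve-∀

  Fun : Set
  Fun = ℕ → ℕ → ℕ

  -- The coefficients of φ p₃ + ψ p₂ + p₁; with p₃, p₂, p₁ the coefficients at φ^a ψ^b of successive derivatives of a power of x,
  -- this is the sum of two solutions of W′ = ψ W + x^i/i! whose indices i differ by two.
  three : Fun → Fun → Fun → Fun
  three p₃ p₂ p₁ a b = p₃ (suc a) b + p₂ a (suc b) + p₁ a b

  -- For y = φ p + ψ p′ + p″ the product rule gives y′ - ψ y = 2φ p′ - ψ² p′ + p‴, and 2φ = 1 + ψ²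
  -- reduces this to p′ + p‴. The arguments `p₃`, `p₂`, `p₁`, `p₀` stand for p, p′, p″, p‴.
  grow-three : ∀ (p₃ p₂ p₁ p₀ : Fun) → (∀ a b → 2 * p₂ (suc a) b ≡ p₂ a b + p₂ a (2 + b)) → ∀ a b →
    three (λ a b → grow p₃ a b + p₂ a b) (λ a b → grow p₂ a b + p₁ a b) (λ a b → grow p₁ a b + p₀ a b) a b
    ≡ grow (three p₃ p₂ p₁) a b + three p₃ p₂ p₁ a (suc b) + (p₂ a b + p₀ a b)
  grow-three p₃ p₂ p₁ p₀ double a b = begin
    grow p₃ (suc a) b + p₂ (suc a) b + (grow p₂ a (suc b) + p₁ a (suc b)) + (grow p₁ a b + p₀ a b)
      ≡⟨ cong₂ (λ x y → x + p₂ (suc a) b + (y + p₁ a (suc b)) + (grow p₁ a b + p₀ a b))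
           (grow-sucˡ p₃ a b) (grow-sucʳ p₂ a b) ⟩
    gx + p₃ (suc a) (suc b) + p₂ (suc a) b + (gy + p₂ (suc a) b + p₁ a (suc b)) + (grow p₁ a b + p₀ a b)
      ≡⟨ l₁ gx gy (grow p₁ a b) (p₀ a b) (p₁ a (suc b)) (p₂ (suc a) b) (p₃ (suc a) (suc b)) ⟩
    gx + gy + grow p₁ a b + (p₃ (suc a) (suc b) + 2 * p₂ (suc a) b + p₁ a (suc b) + p₀ a b)
      ≡⟨ cong₂ (λ g w → g + (p₃ (suc a) (suc b) + w + p₁ a (suc b) + p₀ a b)) (sym split) (double a b) ⟩
    grow (three p₃ p₂ p₁) a b + (p₃ (suc a) (suc b) + (p₂ a b + p₂ a (2 + b)) + p₁ a (suc b) + p₀ a b)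
      ≡⟨ l₂ (grow (three p₃ p₂ p₁) a b) (p₃ (suc a) (suc b)) (p₂ a b) (p₂ a (2 + b)) (p₁ a (suc b)) (p₀ a b) ⟩
    grow (three p₃ p₂ p₁) a b + three p₃ p₂ p₁ a (suc b) + (p₂ a b + p₀ a b) ∎
    where
    open ≡-Reasoning
    gx = grow (λ a b → p₃ (suc a) b) a b
    gy = grow (λ a b → p₂ a (suc b)) a b
    split : grow (three p₃ p₂ p₁) a b ≡ gx + gy + grow p₁ a b
    split = trans (grow-+ (λ a b → p₃ (suc a) b + p₂ a (suc b)) p₁ a b)
      (cong (_+ grow p₁ a b) (grow-+ (λ a b → p₃ (suc a) b) (λ a b → p₂ a (suc b)) a b))
    l₁ : ∀ x y z p q r s → x + s + r + (y + r + q) + (z + p) ≡ x + y + z + (s + 2 * r + q + p)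
    l₁ = solve-∀
    l₂ : ∀ g s u v q p → g + (s + (u + v) + q + p) ≡ g + (s + v + q) + (u + p)
    l₂ = solve-∀

  add-solutions : ∀ (f g h : Fun) → (∀ a b → f a b + g a b ≡ h a b) → ∀ p q a b →
    grow f a b + f a (suc b) + p + (grow g a b + g a (suc b) + q) ≡ grow h a b + h a (suc b) + (p + q)
  add-solutions f g h e p q a b =
    trans (l (grow f a b) (f a (suc b)) p (grow g a b) (g a (suc b)) q)
          (cong₂ (λ x y → x + y + (p + q)) (trans (sym (grow-+ f g a b)) (grow-cong e a b)) (e a (suc b)))
    where
    l : ∀ x y z x′ y′ z′ → x + y + z + (x′ + y′ + z′) ≡ x + x′ + (y + y′) + (z + z′)
    l = solve-∀

  -- Since φ′ = ψφ, φ solves the equation of W_{i+1} with source 0, spelled out as the final `+ 0`.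
  -- In `W-step₁` and `W-step₀` it replaces the partner that W_2 and W_1 lack, and supplies the
  -- initial value 1.
  P0-suc : ∀ k a b → P 0 (suc k) (suc a) b
    ≡ grow (λ a b → P 0 k (suc a) b) a b + P 0 k (suc a) (suc b) + 0
  P0-suc k a b = trans (grow-sucˡ (P 0 k) a b) (sym (+-identityʳ _))

  W-step : ∀ i k a b → W (2 + i) k a b + W i k a b ≡ three (P (3 + i) k) (P (2 + i) k) (P (suc i) k) a b
  W-step i zero a b = refl
  W-step i (suc k) a b = trans (add-solutions (W (2 + i) k) (W i k) (three (P (3 + i) k) (P (2 + i) k) (P (suc i) k)) (W-step i k) (P (2 + i) k a b) (P i k a b) a b)
    (sym (grow-three (P (3 + i) k) (P (2 + i) k) (P (suc i) k) (P i k) (P-double (2 + i) k) a b))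

  W-step₁ : ∀ k a b → W 1 k a b + P 0 k (suc a) b ≡ three (P 2 k) (P 1 k) (P 0 k) a b
  W-step₁ zero a b = refl
  W-step₁ (suc k) a b = trans (cong (W 1 (suc k) a b +_) (P0-suc k a b))
    (trans (add-solutions (W 1 k) (λ a b → P 0 k (suc a) b) (three (P 2 k) (P 1 k) (P 0 k)) (W-step₁ k) (P 1 k a b) 0 a b)
    (trans (sym (grow-three (P 2 k) (P 1 k) (P 0 k) (λ _ _ → 0) (P-double 1 k) a b))
           (cong (P 2 (suc k) (suc a) b + P 1 (suc k) a (suc b) +_) (+-identityʳ _))))

  W-step₀ : ∀ k a b → W 0 k a b + P 0 k (suc a) b ≡ P 1 k (suc a) b + P 0 k a (suc b)
  W-step₀ k a b = trans (go k a b) (+-identityʳ _)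
    where
    grow-0 : ∀ a b → grow (λ _ _ → 0) a b ≡ 0
    grow-0 a b = cong₂ _+_ (*-zeroʳ a) (*-zeroʳ b)
    go : ∀ k a b → W 0 k a b + P 0 k (suc a) b ≡ three (P 1 k) (P 0 k) (λ _ _ → 0) a b
    go zero a b = refl
    go (suc k) a b = trans (cong (W 0 (suc k) a b +_) (P0-suc k a b))
      (trans (add-solutions (W 0 k) (λ a b → P 0 k (suc a) b) (three (P 1 k) (P 0 k) (λ _ _ → 0)) (go k) (P 0 k a b) 0 a b)
      (trans (sym (grow-three (P 1 k) (P 0 k) (λ _ _ → 0) (λ _ _ → 0) (P-double 0 k) a b))
             (cong₂ (λ x y → P 1 (suc k) (suc a) b + x + y) (+-identityʳ _) (trans (+-identityʳ _) (grow-0 a b)))))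

  P-zero : ∀ j k a b → k < j → P j k a b ≡ 0
  P-zero (suc j) zero a b _ = refl
  P-zero (suc j) (suc k) a b (s≤s k<j) = trans
    (cong₂ _+_ (grow-cong {g = λ _ _ → 0} (λ a b → P-zero (suc j) k a b (m<n⇒m<1+n k<j)) a b) (P-zero j k a b k<j))
    (trans (+-identityʳ _) (cong₂ _+_ (*-zeroʳ a) (*-zeroʳ b)))

  -- Pascal's rule for choosing which `j` of the insertions fall in the separate part. The binomial
  -- coefficient is kept as factorials to avoid division.
  P-factorial : ∀ j i a b → P j (j + i) a b * (j ! * i !) ≡ (j + i) ! * P 0 i a b
  P-factorial zero i a b = trans (cong (P 0 i a b *_) (+-identityʳ (i !))) (*-comm (P 0 i a b) (i !))
  P-factorial (suc j) zero a b = begin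
    P (suc j) (suc (j + 0)) a b * (suc j ! * 1)
      ≡⟨ cong (λ w → (w + P j (j + 0) a b) * (suc j ! * 1)) grow≡0 ⟩
    P j (j + 0) a b * ((j ! + j * j !) * 1)
      ≡⟨ l₁ j (j !) (P j (j + 0) a b) ⟩
    suc j * (P j (j + 0) a b * (j ! * 1))
      ≡⟨ cong (suc j *_) (P-factorial j 0 a b) ⟩
    suc j * ((j + 0) ! * 1)
      ≡⟨ cong (λ w → w * ((j + 0) ! * 1)) (cong suc (sym (+-identityʳ j))) ⟩
    suc (j + 0) * ((j + 0) ! * 1)
      ≡⟨ sym (*-assoc (suc (j + 0)) ((j + 0) !) 1) ⟩
    suc (j + 0) ! * 1 ∎
    where
    open ≡-Reasoning
    l₁ : ∀ j f p → p * ((f + j * f) * 1) ≡ suc j * (p * (f * 1))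
    l₁ = solve-∀
    grow≡0 : grow (P (suc j) (j + 0)) a b ≡ 0
    grow≡0 = trans (grow-cong {g = λ _ _ → 0} (λ a b → P-zero (suc j) (j + 0) a b (s≤s (≤-reflexive (+-identityʳ j)))) a b)
                   (cong₂ _+_ (*-zeroʳ a) (*-zeroʳ b))
  P-factorial (suc j) (suc i) a b = begin
    (grow (P (suc j) (j + suc i)) a b + P j (j + suc i) a b) * (suc j ! * suc i !)
      ≡⟨ l₁ i (i !) (suc j !) (j !) j (grow (P (suc j) (j + suc i)) a b) (P j (j + suc i) a b) ⟩
    suc i * (grow (P (suc j) (j + suc i)) a b * (suc j ! * i !)) + suc j * (P j (j + suc i) a b * (j ! * suc i !))
      ≡⟨ cong₂ (λ x y → suc i * x + suc j * y) inner (P-factorial j (suc i) a b) ⟩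
    suc i * ((j + suc i) ! * P 0 (suc i) a b) + suc j * ((j + suc i) ! * P 0 (suc i) a b)
      ≡⟨ l₂ i j ((j + suc i) !) (P 0 (suc i) a b) ⟩
    suc (j + suc i) * (j + suc i) ! * P 0 (suc i) a b ∎
    where
    open ≡-Reasoning
    l₁ : ∀ i f g h j x y → (x + y) * ((h + j * h) * (f + i * f)) ≡ suc i * (x * ((h + j * h) * f)) + suc j * (y * (h * (f + i * f)))
    l₁ = solve-∀
    l₂ : ∀ i j f p → suc i * (f * p) + suc j * (f * p) ≡ suc (j + suc i) * f * p
    l₂ = solve-∀
    grow-* : ∀ f c → grow f a b * c ≡ grow (λ a b → f a b * c) a b
    grow-* f c = l a b c (f a (suc b)) (f (suc a) (pred b))
      where
      l : ∀ a b c x y → (a * x + b * y) * c ≡ a * (x * c) + b * (y * c)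
      l = solve-∀
    inner : grow (P (suc j) (j + suc i)) a b * (suc j ! * i !) ≡ (j + suc i) ! * P 0 (suc i) a b
    inner = begin
      grow (P (suc j) (j + suc i)) a b * (suc j ! * i !)
        ≡⟨ cong (λ n → grow (P (suc j) n) a b * (suc j ! * i !)) (+-suc j i) ⟩
      grow (P (suc j) (suc j + i)) a b * (suc j ! * i !)
        ≡⟨ grow-* (P (suc j) (suc j + i)) (suc j ! * i !) ⟩
      grow (λ a b → P (suc j) (suc j + i) a b * (suc j ! * i !)) a b
        ≡⟨ grow-cong (λ a b → trans (P-factorial (suc j) i a b) (*-comm ((suc j + i) !) _)) a b ⟩
      grow (λ a b → P 0 i a b * (suc j + i) !) a b
        ≡⟨ sym (grow-* (P 0 i) ((suc j + i) !)) ⟩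
      grow (P 0 i) a b * (suc j + i) !
        ≡⟨ *-comm (grow (P 0 i) a b) ((suc j + i) !) ⟩
      (suc j + i) ! * grow (P 0 i) a b
        ≡⟨ cong (λ n → n ! * grow (P 0 i) a b) (sym (+-suc j i)) ⟩
      (j + suc i) ! * P 0 (suc i) a b ∎

  P-leaf : ∀ j n → j < n → P j n 0 0 ≡ 0
  P-leaf zero (suc n) _ = refl
  P-leaf (suc j) (suc n) (s≤s j<n) = P-leaf j n j<n

  -- By ψ′ = φ the left side is the derivative of ψ x^(j+1)/(j+1)!. At the state (0, 0) it merges
  -- the first two terms of `three` into one coefficient, while `P-leaf` kills the third.
  P-1-0 : ∀ j n → P (suc j) n 1 0 + P j n 0 1 ≡ P (suc j) (suc n) 0 1
  P-1-0 j n = cong (_+ P j n 0 1) (sym (+-identityʳ (P (suc j) n 1 0)))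

  t-suc : ∀ n → P 0 n 1 0 ≡ t (suc n)
  t-suc n = sym (+-identityʳ (P 0 n 1 0))

  W-pair : ∀ i n → 2 + i ≤ n → W (2 + i) n 0 0 + W i n 0 0 ≡ P (3 + i) (suc n) 0 1
  W-pair i n i<n = trans (W-step i n 0 0)
    (trans (cong₂ _+_ (P-1-0 (2 + i) n) (P-leaf (suc i) n i<n)) (+-identityʳ _))

  W-pair₁ : ∀ n → 1 ≤ n → W 1 n 0 0 + t (suc n) ≡ P 2 (suc n) 0 1
  W-pair₁ n 0<n = trans (cong (W 1 n 0 0 +_) (sym (t-suc n))) (trans (W-step₁ n 0 0)
    (trans (cong₂ _+_ (P-1-0 1 n) (P-leaf 0 n 0<n)) (+-identityʳ _)))

  W-pair₀ : ∀ n → W 0 n 0 0 + t (suc n) ≡ P 1 (suc n) 0 1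
  W-pair₀ n = trans (cong (W 0 n 0 0 +_) (sym (t-suc n))) (trans (W-step₀ n 0 0) (P-1-0 0 n))

  -- Convolutions over the subtree size.

  ∑ : ℕ → (ℕ → ℕ) → ℕ
  ∑ zero    f = 0
  ∑ (suc n) f = f 0 + ∑ n (λ i → f (suc i))

  ∑-cong : ∀ n {f g} → (∀ i → f i ≡ g i) → ∑ n f ≡ ∑ n g
  ∑-cong zero h = refl
  ∑-cong (suc n) h = cong₂ _+_ (h 0) (∑-cong n (λ i → h (suc i)))

  ∑-+ : ∀ n f g → ∑ n (λ i → f i + g i) ≡ ∑ n f + ∑ n g
  ∑-+ zero f g = refl
  ∑-+ (suc n) f g = trans (cong (f 0 + g 0 +_) (∑-+ n (λ i → f (suc i)) (λ i → g (suc i)))) (l (f 0) (g 0) _ _)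
    where
    l : ∀ x y z w → x + y + (z + w) ≡ x + z + (y + w)
    l = solve-∀

  ∑-* : ∀ n c f → ∑ n (λ i → c * f i) ≡ c * ∑ n f
  ∑-* zero c f = sym (*-zeroʳ c)
  ∑-* (suc n) c f = trans (cong (c * f 0 +_) (∑-* n c (λ i → f (suc i)))) (sym (*-distribˡ-+ c (f 0) _))

  ∑-0 : ∀ n → ∑ n (λ _ → 0) ≡ 0
  ∑-0 zero = refl
  ∑-0 (suc n) = ∑-0 n

  ∑-grow : ∀ n (c : ℕ → ℕ) (f : ℕ → Fun) a b →
           ∑ n (λ i → c i * grow (f i) a b) ≡ grow (λ a b → ∑ n (λ i → c i * f i a b)) a b
  ∑-grow n c f a b = begin
    ∑ n (λ i → c i * grow (f i) a b)
      ≡⟨ ∑-cong n (λ i → l a b (c i) (f i a (suc b)) (f i (suc a) (pred b))) ⟩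
    ∑ n (λ i → a * (c i * f i a (suc b)) + b * (c i * f i (suc a) (pred b)))
      ≡⟨ ∑-+ n _ _ ⟩
    ∑ n (λ i → a * (c i * f i a (suc b))) + ∑ n (λ i → b * (c i * f i (suc a) (pred b)))
      ≡⟨ cong₂ _+_ (∑-* n a _) (∑-* n b _) ⟩
    grow (λ a b → ∑ n (λ i → c i * f i a b)) a b ∎
    where
    open ≡-Reasoning
    l : ∀ a b c x y → c * (a * x + b * y) ≡ a * (c * x) + b * (c * y)
    l = solve-∀

  -- The index is shifted down by one, with 0 below the range; this turns the two growth clauses of
  -- `P` into the single recursion `P-suc`.
  P⁻ : ℕ → ℕ → ℕ → ℕ → ℕ
  P⁻ zero    n a b = 0
  P⁻ (suc k) n a b = P k n a b

  P-suc : ∀ k n a b → P k (suc n) a b ≡ grow (P k n) a b + P⁻ k n a b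
  P-suc zero n a b = sym (+-identityʳ _)
  P-suc (suc k) n a b = refl

  -- The Leibniz rule for the product of φ^a ψ^b and φ^a′ ψ^b′.
  grow-split : ∀ f a b a′ b′ → grow f (a + a′) (b + b′)
    ≡ grow (λ a b → f (a + a′) (b + b′)) a b + grow (λ a′ b′ → f (a + a′) (b + b′)) a′ b′
  grow-split f a b a′ b′ = begin
    (a + a′) * f (a + a′) (suc (b + b′)) + (b + b′) * f (suc (a + a′)) (pred (b + b′))
      ≡⟨ cong₂ _+_ (*-distribʳ-+ (f (a + a′) (suc (b + b′))) a a′) (predsplit b b′ (f (suc (a + a′)))) ⟩
    a * f (a + a′) (suc (b + b′)) + a′ * f (a + a′) (suc (b + b′))
      + (b * f (suc (a + a′)) (pred b + b′) + b′ * f (suc (a + a′)) (b + pred b′))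
      ≡⟨ cong₂ (λ u v → a * f (a + a′) (suc (b + b′)) + a′ * f (a + a′) u
                 + (b * f (suc (a + a′)) (pred b + b′) + b′ * f v (b + pred b′))) (sym (+-suc b b′)) (sym (+-suc a a′)) ⟩
    a * f (a + a′) (suc (b + b′)) + a′ * f (a + a′) (b + suc b′)
      + (b * f (suc (a + a′)) (pred b + b′) + b′ * f (a + suc a′) (b + pred b′))
      ≡⟨ l (a * f (a + a′) (suc (b + b′))) (a′ * f (a + a′) (b + suc b′)) _ _ ⟩
    grow (λ a b → f (a + a′) (b + b′)) a b + grow (λ a′ b′ → f (a + a′) (b + b′)) a′ b′ ∎
    where
    open ≡-Reasoning
    l : ∀ x y z w → x + y + (z + w) ≡ x + z + (y + w)
    l = solve-∀
    predsplit : ∀ b b′ (g : ℕ → ℕ) → (b + b′) * g (pred (b + b′)) ≡ b * g (pred b + b′) + b′ * g (b + pred b′)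
    predsplit zero b′ g = refl
    predsplit (suc b) zero g = trans (cong (_* g (b + 0)) (+-identityʳ (suc b))) (sym (+-identityʳ _))
    predsplit (suc b) (suc b′) g = trans (*-distribʳ-+ (g (b + suc b′)) (suc b) (suc b′))
      (cong (λ w → suc b * g (b + suc b′) + suc b′ * g w) (+-suc b b′))

  -- φ^a ψ^b x^k/k! expanded along x^i/i!, the steps spent in a distinguished part of the tree.
  P-convolution : ∀ n B k a b a′ b′ → n < B →
    ∑ B (λ i → P k i a′ b′ * P i n a b) ≡ P k n (a + a′) (b + b′)
  P-convolution zero (suc B) k a b a′ b′ _ = trans (cong₂ _+_ (*-identityʳ (P k 0 a′ b′))
      (trans (∑-cong B (λ i → *-zeroʳ (P k (suc i) a′ b′))) (∑-0 B)))
    (trans (+-identityʳ _) (base k))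
    where
    base : ∀ k → P k 0 a′ b′ ≡ P k 0 (a + a′) (b + b′)
    base zero = refl
    base (suc k) = refl
  P-convolution (suc n) (suc B) k a b a′ b′ (s≤s n<B) = begin
    P k 0 a′ b′ * grow (P 0 n) a b + ∑ B (λ i → P k (suc i) a′ b′ * (grow (P (suc i) n) a b + P i n a b))
      ≡⟨ cong (P k 0 a′ b′ * grow (P 0 n) a b +_) (trans
           (∑-cong B (λ i → *-distribˡ-+ (P k (suc i) a′ b′) (grow (P (suc i) n) a b) (P i n a b))) (∑-+ B _ _)) ⟩
    P k 0 a′ b′ * grow (P 0 n) a b + (∑ B (λ i → P k (suc i) a′ b′ * grow (P (suc i) n) a b)
      + ∑ B (λ i → P k (suc i) a′ b′ * P i n a b))
      ≡⟨ sym (+-assoc (P k 0 a′ b′ * grow (P 0 n) a b) _ _) ⟩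
    ∑ (suc B) (λ i → P k i a′ b′ * grow (P i n) a b) + ∑ B (λ i → P k (suc i) a′ b′ * P i n a b)
      ≡⟨ cong₂ _+_ outer inner ⟩
    grow (λ a b → P k n (a + a′) (b + b′)) a b
      + (grow (λ a′ b′ → P k n (a + a′) (b + b′)) a′ b′ + P⁻ k n (a + a′) (b + b′))
      ≡⟨ sym (+-assoc (grow (λ a b → P k n (a + a′) (b + b′)) a b) _ _) ⟩
    grow (λ a b → P k n (a + a′) (b + b′)) a b
      + grow (λ a′ b′ → P k n (a + a′) (b + b′)) a′ b′ + P⁻ k n (a + a′) (b + b′)
      ≡⟨ cong (_+ P⁻ k n (a + a′) (b + b′)) (sym (grow-split (P k n) a b a′ b′)) ⟩
    grow (P k n) (a + a′) (b + b′) + P⁻ k n (a + a′) (b + b′)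
      ≡⟨ sym (P-suc k n (a + a′) (b + b′)) ⟩
    P k (suc n) (a + a′) (b + b′) ∎
    where
    open ≡-Reasoning
    outer : ∑ (suc B) (λ i → P k i a′ b′ * grow (P i n) a b) ≡ grow (λ a b → P k n (a + a′) (b + b′)) a b
    outer = trans (∑-grow (suc B) (λ i → P k i a′ b′) (λ i → P i n) a b)
      (grow-cong (λ a b → P-convolution n (suc B) k a b a′ b′ (m<n⇒m<1+n n<B)) a b)
    below : ∀ k → ∑ B (λ i → P⁻ k i a′ b′ * P i n a b) ≡ P⁻ k n (a + a′) (b + b′)
    below zero = ∑-0 B
    below (suc k) = P-convolution n B k a b a′ b′ n<B
    inner : ∑ B (λ i → P k (suc i) a′ b′ * P i n a b)
      ≡ grow (λ a′ b′ → P k n (a + a′) (b + b′)) a′ b′ + P⁻ k n (a + a′) (b + b′)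
    inner = begin
      ∑ B (λ i → P k (suc i) a′ b′ * P i n a b)
        ≡⟨ ∑-cong B (λ i → trans (cong (_* P i n a b) (P-suc k i a′ b′))
             (trans (*-distribʳ-+ (P i n a b) (grow (P k i) a′ b′) (P⁻ k i a′ b′))
                    (cong (_+ P⁻ k i a′ b′ * P i n a b) (*-comm (grow (P k i) a′ b′) (P i n a b))))) ⟩
      ∑ B (λ i → P i n a b * grow (P k i) a′ b′ + P⁻ k i a′ b′ * P i n a b)
        ≡⟨ ∑-+ B _ _ ⟩
      ∑ B (λ i → P i n a b * grow (P k i) a′ b′) + ∑ B (λ i → P⁻ k i a′ b′ * P i n a b)
        ≡⟨ cong₂ _+_ (trans (∑-grow B (λ i → P i n a b) (P k) a′ b′)
             (grow-cong (λ a′ b′ → trans (∑-cong B (λ i → *-comm (P i n a b) (P k i a′ b′)))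
                                         (P-convolution n B k a b a′ b′ n<B)) a′ b′)) (below k) ⟩
      grow (λ a′ b′ → P k n (a + a′) (b + b′)) a′ b′ + P⁻ k n (a + a′) (b + b′) ∎

  -- Linearity in the source: the sources x^i/i!, weighted by the coefficients of φ x^k/k!, add up
  -- to φ x^k/k!, and y = φ x^(k+1)/(k+1)! solves y′ = ψ y + φ x^k/k!. Cutting the sum off at `B`
  -- loses nothing, because `W i n` vanishes for `n ≤ i`.
  W-convolution : ∀ n B k a b → n ≤ B → ∑ B (λ i → P k i 1 0 * W i n a b) ≡ P (suc k) n (suc a) b
  W-convolution zero B k a b _ = trans (∑-cong B (λ i → *-zeroʳ (P k i 1 0))) (∑-0 B)
  W-convolution (suc n) B k a b n<B = begin
    ∑ B (λ i → P k i 1 0 * (grow (W i n) a b + W i n a (suc b) + P i n a b))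
      ≡⟨ ∑-cong B (λ i → l (P k i 1 0) (grow (W i n) a b) (W i n a (suc b)) (P i n a b)) ⟩
    ∑ B (λ i → P k i 1 0 * grow (W i n) a b + P k i 1 0 * W i n a (suc b) + P k i 1 0 * P i n a b)
      ≡⟨ trans (∑-+ B _ _) (cong (_+ ∑ B (λ i → P k i 1 0 * P i n a b)) (∑-+ B _ _)) ⟩
    ∑ B (λ i → P k i 1 0 * grow (W i n) a b) + ∑ B (λ i → P k i 1 0 * W i n a (suc b))
      + ∑ B (λ i → P k i 1 0 * P i n a b)
      ≡⟨ cong₂ _+_ (cong₂ _+_
           (trans (∑-grow B (λ i → P k i 1 0) (λ i → W i n) a b)
                  (grow-cong (λ a b → W-convolution n B k a b (<⇒≤ n<B)) a b))
           (W-convolution n B k a (suc b) (<⇒≤ n<B)))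
           (trans (P-convolution n B k a b 1 0 n<B) (cong₂ (P k n) (+-comm a 1) (+-identityʳ b))) ⟩
    grow (λ a b → P (suc k) n (suc a) b) a b + P (suc k) n (suc a) (suc b) + P k n (suc a) b
      ≡⟨ cong (_+ P k n (suc a) b) (sym (grow-sucˡ (P (suc k) n) a b)) ⟩
    P (suc k) (suc n) (suc a) b ∎
    where
    open ≡-Reasoning
    l : ∀ c x y z → c * (x + y + z) ≡ c * x + c * y + c * z
    l = solve-∀

  ∑-split : ∀ m n f → ∑ (m + n) f ≡ ∑ m f + ∑ n (λ i → f (m + i))
  ∑-split zero n f = refl
  ∑-split (suc m) n f = trans (cong (f 0 +_) (∑-split m n (λ i → f (suc i)))) (sym (+-assoc (f 0) _ _))

  ∑-last : ∀ n f → ∑ (suc n) f ≡ ∑ n f + f n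
  ∑-last zero f = +-identityʳ (f 0)
  ∑-last (suc n) f = trans (cong (f 0 +_) (∑-last n (λ i → f (suc i)))) (sym (+-assoc (f 0) _ _))

  -- The case k = 0 of `W-convolution`; it says that every vertex of every tree has exactly one
  -- subtree size.
  total-pairs : ∀ n → ∑ (suc n) (λ i → t (suc i) * W i (suc n) 0 0) ≡ suc n * t (suc n)
  total-pairs n = begin
    ∑ (suc n) (λ i → t (suc i) * W i (suc n) 0 0)
      ≡⟨ ∑-cong (suc n) (λ i → cong (_* W i (suc n) 0 0) (sym (t-suc i))) ⟩
    ∑ (suc n) (λ i → P 0 i 1 0 * W i (suc n) 0 0)
      ≡⟨ W-convolution (suc n) (suc n) 0 0 0 ≤-refl ⟩
    P 1 (suc n) 1 0
      ≡⟨ *-cancelʳ-≡ (P 1 (suc n) 1 0) (suc n * P 0 n 1 0) (n !) {{n !≢0}} scaled ⟩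
    suc n * P 0 n 1 0
      ≡⟨ cong (suc n *_) (t-suc n) ⟩
    suc n * t (suc n) ∎
    where
    open ≡-Reasoning
    r : ∀ a x p → (x + a * x) * p ≡ (1 + a) * p * x
    r = solve-∀
    scaled : P 1 (suc n) 1 0 * n ! ≡ suc n * P 0 n 1 0 * n !
    scaled = trans (cong (P 1 (suc n) 1 0 *_) (sym (+-identityʳ (n !)))) (trans (P-factorial 1 n 1 0) (r n (n !) (P 0 n 1 0)))

open Growth

-- From lists of parents to the insertion counts.

module Enumeration where

  open import Data.Bool using (Bool; true; false; _∧_; _∨_; not; if_then_else_)
  open import Data.Bool.Properties using (∧-identityʳ; ∨-zeroʳ)
  open import Data.List using (List; []; _∷_; map; concatMap; upTo; applyUpTo; length; filterᵇ)
  open import Data.List.Membership.Propositional using (_∈_)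
  open import Data.List.Membership.Propositional.Properties using (∈-map⁺; ∈-upTo⁺)
  open import Data.List.Properties using (map-++; map-∘; map-upTo)
  open import Data.List.Relation.Unary.Any using (here; there)
  open import Data.Nat.ListAction using (sum)
  open import Data.Nat.ListAction.Properties using (sum-++)
  open import Data.Nat.Properties
  open import Data.Nat.Tactic.RingSolver using (solve-∀)
  open import Relation.Nullary using (yes; no; contradiction)

  ind : Bool → ℕ
  ind true  = 1
  ind false = 0

  ≡ᵇ-true : ∀ m n → m ≡ n → (m ≡ᵇ n) ≡ true
  ≡ᵇ-true zero    .zero    refl = refl
  ≡ᵇ-true (suc m) .(suc m) refl = ≡ᵇ-true m m refl

  ≡ᵇ-false : ∀ m n → m ≢ n → (m ≡ᵇ n) ≡ false
  ≡ᵇ-false zero    zero    h = contradiction refl h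
  ≡ᵇ-false zero    (suc n) h = refl
  ≡ᵇ-false (suc m) zero    h = refl
  ≡ᵇ-false (suc m) (suc n) h = ≡ᵇ-false m n (h ∘ cong suc)

  length-filterᵇ : {A : Set} (f : A → Bool) (xs : List A) → length (filterᵇ f xs) ≡ sum (map (ind ∘ f) xs)
  length-filterᵇ f [] = refl
  length-filterᵇ f (x ∷ xs) with f x
  ... | true  = cong suc (length-filterᵇ f xs)
  ... | false = length-filterᵇ f xs

  sum-filterᵇ : {A : Set} (f : A → Bool) (g : A → ℕ) (xs : List A) →
                sum (map g (filterᵇ f xs)) ≡ sum (map (λ x → ind (f x) * g x) xs)
  sum-filterᵇ f g [] = refl
  sum-filterᵇ f g (x ∷ xs) with f x
  ... | true  = cong₂ _+_ (sym (+-identityʳ (g x))) (sum-filterᵇ f g xs)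
  ... | false = sum-filterᵇ f g xs

  rsum : ℕ → ℕ → (ℕ → ℕ) → ℕ
  rsum k zero    f = 0
  rsum k (suc l) f = f k + rsum (suc k) l f

  rsum-cong : ∀ k l {f g} → (∀ x → k ≤ x → x < k + l → f x ≡ g x) → rsum k l f ≡ rsum k l g
  rsum-cong k zero h = refl
  rsum-cong k (suc l) h = cong₂ _+_ (h k ≤-refl (m<m+n k (s≤s z≤n)))
    (rsum-cong (suc k) l (λ x k<x x< → h x (<⇒≤ k<x) (subst (x <_) (sym (+-suc k l)) x<)))

  rsum-+ : ∀ k l f g → rsum k l (λ x → f x + g x) ≡ rsum k l f + rsum k l g
  rsum-+ k zero f g = refl
  rsum-+ k (suc l) f g = trans (cong (f k + g k +_) (rsum-+ (suc k) l f g)) (r (f k) (g k) _ _)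
    where
    r : ∀ x y z w → x + y + (z + w) ≡ x + z + (y + w)
    r = solve-∀

  rsum-*ˡ : ∀ k l c f → rsum k l (λ x → c * f x) ≡ c * rsum k l f
  rsum-*ˡ k zero c f = sym (*-zeroʳ c)
  rsum-*ˡ k (suc l) c f = trans (cong (c * f k +_) (rsum-*ˡ (suc k) l c f)) (sym (*-distribˡ-+ c (f k) _))

  rsum-*ʳ : ∀ k l f c → rsum k l (λ x → f x * c) ≡ rsum k l f * c
  rsum-*ʳ k zero f c = refl
  rsum-*ʳ k (suc l) f c = trans (cong (f k * c +_) (rsum-*ʳ (suc k) l f c)) (sym (*-distribʳ-+ c (f k) _))

  rsum-0 : ∀ k l → rsum k l (λ _ → 0) ≡ 0
  rsum-0 k zero = refl
  rsum-0 k (suc l) = rsum-0 (suc k) l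

  rsum-swap : ∀ k l k′ l′ (f : ℕ → ℕ → ℕ) →
              rsum k l (λ x → rsum k′ l′ (f x)) ≡ rsum k′ l′ (λ y → rsum k l (λ x → f x y))
  rsum-swap k zero k′ l′ f = sym (rsum-0 k′ l′)
  rsum-swap k (suc l) k′ l′ f = trans (cong (rsum k′ l′ (f k) +_) (rsum-swap (suc k) l k′ l′ f))
    (sym (rsum-+ k′ l′ (f k) (λ y → rsum (suc k) l (λ x → f x y))))

  rsum-δ : ∀ k l p (g : ℕ → ℕ) → k ≤ p → p < k + l → rsum k l (λ x → ind (p ≡ᵇ x) * g x) ≡ g p
  rsum-δ k zero p g k≤p p<k = contradiction (subst (p <_) (+-identityʳ k) p<k) (≤⇒≯ k≤p)
  rsum-δ k (suc l) p g k≤p p< with p ≟ k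
  ... | yes refl = trans (cong₂ (λ b w → ind b * g p + w) (≡ᵇ-true p p refl)
      (trans (rsum-cong (suc p) l (λ x p<x _ → cong (λ b → ind b * g x) (≡ᵇ-false p x (<⇒≢ p<x)))) (rsum-0 (suc p) l)))
    (trans (+-identityʳ _) (+-identityʳ _))
  ... | no p≢k = cong₂ (λ b w → ind b * g k + w) (≡ᵇ-false p k p≢k)
    (rsum-δ (suc k) l p g (≤∧≢⇒< k≤p (p≢k ∘ sym)) (subst (p <_) (+-suc k l) p<))

  sum-applyUpTo : ∀ l k (f g : ℕ → ℕ) → (∀ i → g i ≡ k + i) → sum (map f (applyUpTo g l)) ≡ rsum k l f
  sum-applyUpTo zero k f g h = refl
  sum-applyUpTo (suc l) k f g h = cong₂ _+_ (cong f (trans (h 0) (+-identityʳ k)))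
    (sum-applyUpTo l (suc k) f (g ∘ suc) (λ i → trans (h (suc i)) (+-suc k i)))

  sum-range : ∀ k l (f : ℕ → ℕ) → sum (map f (map (λ i → k + i) (upTo l))) ≡ rsum k l f
  sum-range k l f = trans (cong (sum ∘ map f) (map-upTo (k +_) l)) (sum-applyUpTo l k f (k +_) (λ i → refl))

  sum-vertices : ∀ n (f : ℕ → ℕ) → sum (map f (vertices n)) ≡ rsum 1 n f
  sum-vertices n f = sum-range 1 n f

  sum-concatMap : {A B : Set} (f : B → ℕ) (g : A → List B) (xs : List A) →
                  sum (map f (concatMap g xs)) ≡ sum (map (λ x → sum (map f (g x))) xs)
  sum-concatMap f g [] = refl
  sum-concatMap f g (x ∷ xs) = trans (cong sum (map-++ f (g x) (concatMap g xs)))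
    (trans (sum-++ (map f (g x)) _) (cong (sum (map f (g x)) +_) (sum-concatMap f g xs)))

  sum-cong : {A : Set} {f g : A → ℕ} → (∀ x → f x ≡ g x) → ∀ xs → sum (map f xs) ≡ sum (map g xs)
  sum-cong h [] = refl
  sum-cong h (x ∷ xs) = cong₂ _+_ (h x) (sum-cong h xs)

  -- The smallest label is `k` and the root is `k + m`; the tail of a list is thus the tree without
  -- its smallest label, that is, before the last insertion.
  psum : ℕ → ℕ → (List ℕ → ℕ) → ℕ
  psum k zero    X = X []
  psum k (suc m) X = rsum (suc k) (suc m) (λ p → psum (suc k) m (λ ps → X (p ∷ ps)))

  sum-parentLists : ∀ m k n X → k + m ≡ n → sum (map X (parentLists n k m)) ≡ psum k m X
  sum-parentLists zero k n X e = +-identityʳ (X [])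
  sum-parentLists (suc m) k n X refl = begin
    sum (map X (concatMap (λ p → map (p ∷_) (parentLists n (suc k) m)) (map (λ i → suc k + i) (upTo (n ∸ k)))))
      ≡⟨ sum-concatMap X (λ p → map (p ∷_) (parentLists n (suc k) m)) (map (λ i → suc k + i) (upTo (n ∸ k))) ⟩
    sum (map (λ p → sum (map X (map (p ∷_) (parentLists n (suc k) m)))) (map (λ i → suc k + i) (upTo (n ∸ k))))
      ≡⟨ sum-cong (λ p → trans (cong sum (sym (map-∘ {g = X} {f = p ∷_} (parentLists n (suc k) m))))
                               (sum-parentLists m (suc k) n (λ ps → X (p ∷ ps)) (sym (+-suc k m))))
           (map (λ i → suc k + i) (upTo (n ∸ k))) ⟩
    sum (map (λ p → psum (suc k) m (λ ps → X (p ∷ ps))) (map (λ i → suc k + i) (upTo (n ∸ k))))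
      ≡⟨ cong (λ l → sum (map (λ p → psum (suc k) m (λ ps → X (p ∷ ps))) (map (λ i → suc k + i) (upTo l)))) (m+n∸m≡n k (suc m)) ⟩
    sum (map (λ p → psum (suc k) m (λ ps → X (p ∷ ps))) (map (λ i → suc k + i) (upTo (suc m))))
      ≡⟨ sum-range (suc k) (suc m) (λ p → psum (suc k) m (λ ps → X (p ∷ ps))) ⟩
    psum k (suc m) X ∎
    where
    open ≡-Reasoning

  data Parents : ℕ → List ℕ → Set where
    []  : ∀ {k} → Parents k []
    _∷_ : ∀ {k p ps} → k < p × p < suc k + suc (length ps) → Parents (suc k) ps → Parents k (p ∷ ps)

  psum-cong : ∀ k m {X Y} → (∀ ps → length ps ≡ m → Parents k ps → X ps ≡ Y ps) → psum k m X ≡ psum k m Y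
  psum-cong k zero h = h [] refl []
  psum-cong k (suc m) h = rsum-cong (suc k) (suc m) λ p k<p p< → psum-cong (suc k) m λ { ps refl gd →
    h (p ∷ ps) refl ((k<p , p<) ∷ gd) }

  rsum-psum : ∀ k l k′ m (X : ℕ → List ℕ → ℕ) → rsum k l (λ x → psum k′ m (X x)) ≡ psum k′ m (λ ps → rsum k l (λ x → X x ps))
  rsum-psum k l k′ zero X = refl
  rsum-psum k l k′ (suc m) X = trans (rsum-swap k l (suc k′) (suc m) _)
    (rsum-cong (suc k′) (suc m) (λ p _ _ → rsum-psum k l (suc k′) m (λ x ps → X x (p ∷ ps))))

  -- Each label is tested once, on arrival: its parent may have at most one child among the labels
  -- already present. This form of `isOneTwo` is a product along the insertions.
  valid : List ℕ → ℕ
  valid []       = 1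
  valid (p ∷ ps) = valid ps * ind (numChildren ps p ≤ᵇ 1)

  -- Summing X over the trees on k, …, n: inserting the labels n, n-1, …, k one at a time as leaves,
  -- X j is the potential of a partial tree into which j labels remain to be inserted.
  potential : ∀ (X : ℕ → List ℕ → ℕ) →
    (∀ j ps → Parents (2 + j) ps → rsum (2 + j) (suc (length ps)) (λ p → ind (numChildren ps p ≤ᵇ 1) * X j (p ∷ ps)) ≡ X (suc j) ps) →
    ∀ m j → psum (suc j) m (λ ps → valid ps * X j ps) ≡ X (m + j) []
  potential X step zero j = *-identityˡ _
  potential X step (suc m) j = begin
    rsum (2 + j) (suc m) (λ p → psum (2 + j) m (λ ps → valid (p ∷ ps) * X j (p ∷ ps)))
      -- The head of the list is the parent of the label inserted last, so its sum is moved inside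
      -- and evaluated first, with the smaller tree fixed.
      ≡⟨ rsum-psum (2 + j) (suc m) (2 + j) m _ ⟩
    psum (2 + j) m (λ ps → rsum (2 + j) (suc m) (λ p → valid (p ∷ ps) * X j (p ∷ ps)))
      ≡⟨ psum-cong (2 + j) m (λ { ps refl gd → trans
           (rsum-cong (2 + j) (suc m) (λ p _ _ → *-assoc (valid ps) (ind (numChildren ps p ≤ᵇ 1)) (X j (p ∷ ps))))
           (trans (rsum-*ˡ (2 + j) (suc m) (valid ps) _) (cong (valid ps *_) (step j ps gd))) }) ⟩
    psum (2 + j) m (λ ps → valid ps * X (suc j) ps)
      ≡⟨ potential X step m (suc j) ⟩
    X (m + suc j) []
      ≡⟨ cong (λ i → X i []) (+-suc m j) ⟩
    X (suc m + j) [] ∎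
    where open ≡-Reasoning

  numChildren-∷ : ∀ p ps v → numChildren (p ∷ ps) v ≡ ind (p ≡ᵇ v) + numChildren ps v
  numChildren-∷ p ps v with p ≡ᵇ v
  ... | true  = refl
  ... | false = refl

  numChildren-new : ∀ {k ps} v → v ≤ k → Parents k ps → numChildren ps v ≡ 0
  numChildren-new v v≤k [] = refl
  numChildren-new {k} {p ∷ ps} v v≤k ((k<p , _) ∷ gd) = trans (numChildren-∷ p ps v)
    (cong₂ (λ b w → ind b + w) (≡ᵇ-false p v (>⇒≢ (≤-<-trans v≤k k<p))) (numChildren-new v (m≤n⇒m≤1+n v≤k) gd))

  allB-cong : ∀ xs {f g : ℕ → Bool} → (∀ x → f x ≡ g x) → allB xs f ≡ allB xs g
  allB-cong [] h = refl
  allB-cong (x ∷ xs) h = cong₂ _∧_ (h x) (allB-cong xs h)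

  allB-∧ : ∀ xs (f g : ℕ → Bool) → allB xs (λ x → f x ∧ g x) ≡ allB xs f ∧ allB xs g
  allB-∧ [] f g = refl
  allB-∧ (x ∷ xs) f g with f x | g x
  ... | false | _     = refl
  ... | true  | true  = allB-∧ xs f g
  ... | true  | false with allB xs f
  ...   | true  = refl
  ...   | false = refl

  allB-true : ∀ xs (f : ℕ → Bool) → (∀ x → f x ≡ true) → allB xs f ≡ true
  allB-true [] f h = refl
  allB-true (x ∷ xs) f h rewrite h x = allB-true xs f h

  allB-δ : ∀ xs p c → p ∈ xs → allB xs (λ v → not (p ≡ᵇ v) ∨ c) ≡ c
  allB-δ xs p true p∈ = allB-true xs _ (λ x → ∨-zeroʳ (not (p ≡ᵇ x)))
  allB-δ (x ∷ xs) .x false (here refl) rewrite ≡ᵇ-true x x refl = refl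
  allB-δ (x ∷ xs) p false (there p∈) rewrite allB-δ xs p false p∈ with not (p ≡ᵇ x) ∨ false
  ... | true  = refl
  ... | false = refl

  children-≤2 : ∀ p ps v → (numChildren (p ∷ ps) v ≤ᵇ 2)
    ≡ (numChildren ps v ≤ᵇ 2) ∧ (not (p ≡ᵇ v) ∨ (numChildren ps p ≤ᵇ 1))
  children-≤2 p ps v rewrite numChildren-∷ p ps v with p ≟ v
  ... | no p≢v rewrite ≡ᵇ-false p v p≢v = sym (∧-identityʳ _)
  ... | yes refl rewrite ≡ᵇ-true p p refl = go (numChildren ps p)
    where
    go : ∀ c → (suc c ≤ᵇ 2) ≡ (c ≤ᵇ 2) ∧ (c ≤ᵇ 1)
    go 0 = refl
    go 1 = refl
    go 2 = refl
    go (suc (suc (suc c))) = refl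

  ∈-vertices : ∀ n p → 0 < p → p ≤ n → p ∈ vertices n
  ∈-vertices n (suc p) _ p≤n = ∈-map⁺ suc (∈-upTo⁺ p≤n)

  ind-∧ : ∀ a b → ind (a ∧ b) ≡ ind a * ind b
  ind-∧ true  b = sym (+-identityʳ (ind b))
  ind-∧ false b = refl

  isOneTwo-valid : ∀ {k ps} n → Parents k ps → 1 ≤ k → k + length ps ≡ n → ind (isOneTwo n ps) ≡ valid ps
  isOneTwo-valid n [] 1≤k e = cong ind (allB-true (vertices n) _ (λ _ → refl))
  isOneTwo-valid {k} {p ∷ ps} n ((k<p , p<) ∷ gd) 1≤k e = begin
    ind (isOneTwo n (p ∷ ps))
      ≡⟨ cong ind (trans (allB-cong (vertices n) (children-≤2 p ps)) (allB-∧ (vertices n) _ _)) ⟩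
    ind (isOneTwo n ps ∧ allB (vertices n) (λ v → not (p ≡ᵇ v) ∨ (numChildren ps p ≤ᵇ 1)))
      ≡⟨ cong (λ b → ind (isOneTwo n ps ∧ b)) (allB-δ (vertices n) p _ (∈-vertices n p (≤-<-trans z≤n k<p)
           (subst (p ≤_) e (≤-pred p<)))) ⟩
    ind (isOneTwo n ps ∧ (numChildren ps p ≤ᵇ 1))
      ≡⟨ ind-∧ (isOneTwo n ps) _ ⟩
    ind (isOneTwo n ps) * ind (numChildren ps p ≤ᵇ 1)
      ≡⟨ cong (_* ind (numChildren ps p ≤ᵇ 1)) (isOneTwo-valid n gd (m≤n⇒m≤1+n 1≤k) (trans (sym (+-suc k (length ps))) e)) ⟩
    valid ps * ind (numChildren ps p ≤ᵇ 1) ∎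
    where open ≡-Reasoning

  sum-trees : ∀ n (X : List ℕ → ℕ) → sum (map X (trees (suc n))) ≡ psum 1 n (λ ps → valid ps * X ps)
  sum-trees n X = trans (sum-filterᵇ (isOneTwo (suc n)) X (parentLists (suc n) 1 n))
    (trans (sum-parentLists n 1 (suc n) (λ ps → ind (isOneTwo (suc n) ps) * X ps) refl)
           (psum-cong 1 n (λ { ps refl gd → cong (_* X ps) (isOneTwo-valid (suc n) gd ≤-refl refl) })))

  -- Vertex states and subtree sizes along the insertions.

  leaf one : ℕ → ℕ
  leaf c = ind (c ≡ᵇ 0)
  one  c = ind (c ≡ᵇ 1)

  -- Number of vertices of colour d with z-many children (z = leaf or one) in the tree on k, …, k + length ps.
  census : (ℕ → ℕ) → (ℕ → ℕ) → ℕ → List ℕ → ℕ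
  census z d k ps = rsum k (suc (length ps)) (λ x → d x * z (numChildren ps x))

  extends : (ℕ → ℕ) → ℕ → List ℕ → (ℕ → ℕ) → Set
  extends d k ps d′ = ∀ x → suc k ≤ x → x < suc k + suc (length ps) → d′ x ≡ d x

  rsum-extract : ∀ k l p (f g : ℕ → ℕ) → k ≤ p → p < k + l →
                 rsum k l f + g p ≡ rsum k l (λ x → f x + ind (p ≡ᵇ x) * g x)
  rsum-extract k l p f g k≤p p< = trans (cong (rsum k l f +_) (sym (rsum-δ k l p g k≤p p<))) (sym (rsum-+ k l f _))

  module _ {k p : ℕ} {ps : List ℕ} (k<p : k < p) (p< : p < suc k + suc (length ps)) (gd : Parents (suc k) ps) where
    -- The new label `k` arrives as a leaf, and its parent `p` ceases to be one if it was. The loss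
    -- is added on the left to avoid truncated subtraction.
    leaves-∷ : ∀ d d′ → extends d k ps d′ →
      census leaf d′ k (p ∷ ps) + d p * leaf (numChildren ps p) ≡ d′ k + census leaf d (suc k) ps
    leaves-∷ d d′ ext = begin
      d′ k * leaf (numChildren (p ∷ ps) k) + S + d p * leaf (numChildren ps p)
        ≡⟨ cong (λ c → d′ k * leaf c + S + d p * leaf (numChildren ps p)) (numChildren-new k ≤-refl ((k<p , p<) ∷ gd)) ⟩
      d′ k * 1 + S + d p * leaf (numChildren ps p)
        ≡⟨ trans (cong (λ w → w + S + d p * leaf (numChildren ps p)) (*-identityʳ (d′ k))) (+-assoc (d′ k) S _) ⟩
      d′ k + (S + d p * leaf (numChildren ps p))
        ≡⟨ cong (d′ k +_) (rsum-extract (suc k) (suc (length ps)) p _ (λ x → d x * leaf (numChildren ps x)) k<p p<) ⟩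
      d′ k + rsum (suc k) (suc (length ps)) (λ x → d′ x * leaf (numChildren (p ∷ ps) x) + ind (p ≡ᵇ x) * (d x * leaf (numChildren ps x)))
        ≡⟨ cong (d′ k +_) (rsum-cong (suc k) (suc (length ps)) (λ x k<x x< →
             trans (cong₂ (λ e c → e * leaf c + ind (p ≡ᵇ x) * (d x * leaf (numChildren ps x))) (ext x k<x x<) (numChildren-∷ p ps x))
                   (pointwise (d x) (p ≡ᵇ x) (numChildren ps x)))) ⟩
      d′ k + census leaf d (suc k) ps ∎
      where
      open ≡-Reasoning
      S = rsum (suc k) (suc (length ps)) (λ x → d′ x * leaf (numChildren (p ∷ ps) x))
      pointwise : ∀ e b c → e * leaf (ind b + c) + ind b * (e * leaf c) ≡ e * leaf c
      pointwise e true  c = trans (cong (_+ 1 * (e * leaf c)) (*-zeroʳ e)) (*-identityˡ _)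
      pointwise e false c = +-identityʳ _

    ones-∷ : ∀ d d′ → extends d k ps d′ →
      census one d′ k (p ∷ ps) + d p * one (numChildren ps p) ≡ census one d (suc k) ps + d p * leaf (numChildren ps p)
    ones-∷ d d′ ext = begin
      d′ k * one (numChildren (p ∷ ps) k) + S + d p * one (numChildren ps p)
        ≡⟨ cong (λ c → d′ k * one c + S + d p * one (numChildren ps p)) (numChildren-new k ≤-refl ((k<p , p<) ∷ gd)) ⟩
      d′ k * 0 + S + d p * one (numChildren ps p)
        ≡⟨ cong (λ w → w + S + d p * one (numChildren ps p)) (*-zeroʳ (d′ k)) ⟩
      S + d p * one (numChildren ps p)
        ≡⟨ rsum-extract (suc k) (suc (length ps)) p _ (λ x → d x * one (numChildren ps x)) k<p p< ⟩
      rsum (suc k) (suc (length ps)) (λ x → d′ x * one (numChildren (p ∷ ps) x) + ind (p ≡ᵇ x) * (d x * one (numChildren ps x)))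
        ≡⟨ rsum-cong (suc k) (suc (length ps)) (λ x k<x x< →
             trans (cong₂ (λ e c → e * one c + ind (p ≡ᵇ x) * (d x * one (numChildren ps x))) (ext x k<x x<) (numChildren-∷ p ps x))
                   (pointwise (d x) (p ≡ᵇ x) (numChildren ps x))) ⟩
      rsum (suc k) (suc (length ps)) (λ x → d x * one (numChildren ps x) + ind (p ≡ᵇ x) * (d x * leaf (numChildren ps x)))
        ≡⟨ sym (rsum-extract (suc k) (suc (length ps)) p _ (λ x → d x * leaf (numChildren ps x)) k<p p<) ⟩
      census one d (suc k) ps + d p * leaf (numChildren ps p) ∎
      where
      open ≡-Reasoning
      S = rsum (suc k) (suc (length ps)) (λ x → d′ x * one (numChildren (p ∷ ps) x))
      pointwise : ∀ e b c → e * one (ind b + c) + ind b * (e * one c) ≡ e * one c + ind b * (e * leaf c)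
      pointwise e true  c = trans (+-comm (e * leaf c) (1 * (e * one c)))
        (cong₂ _+_ (*-identityˡ (e * one c)) (sym (*-identityˡ (e * leaf c))))
      pointwise e false c = refl

  -- Number of ways to make j insertions of which exactly r - σ fall in a distinguished part in state (a′, b′).
  hit : ℕ → ℕ → ℕ → ℕ → ℕ → ℕ → ℕ → ℕ
  hit zero    r       j a′ b′ a b = P 0 r a′ b′ * P r j a b
  hit (suc σ) zero    j a′ b′ a b = 0
  hit (suc σ) (suc r) j a′ b′ a b = hit σ r j a′ b′ a b

  hit-suc : ∀ σ r j a′ b′ a b → hit σ r (suc j) a′ b′ a b ≡
    a′ * hit (suc σ) r j a′ (suc b′) a b + b′ * hit (suc σ) r j (suc a′) (pred b′) a b
    + grow (hit σ r j a′ b′) a b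
  hit-suc zero zero j a′ b′ a b = trans (*-identityˡ (grow (P 0 j) a b))
    (cong₂ _+_ (sym (cong₂ _+_ (*-zeroʳ a′) (*-zeroʳ b′)))
      (grow-cong (λ a b → sym (*-identityˡ (P 0 j a b))) a b))
  hit-suc zero (suc r) j a′ b′ a b = l a′ b′ a b (P 0 r a′ (suc b′)) (P 0 r (suc a′) (pred b′)) (P (suc r) j a (suc b)) (P (suc r) j (suc a) (pred b)) (P r j a b)
    where
    l : ∀ a′ b′ a b x y u v w → (a′ * x + b′ * y) * (a * u + b * v + w)
      ≡ a′ * (x * w) + b′ * (y * w) + (a * ((a′ * x + b′ * y) * u) + b * ((a′ * x + b′ * y) * v))
    l = solve-∀
  hit-suc (suc σ) zero j a′ b′ a b = sym (cong₂ _+_ (cong₂ _+_ (*-zeroʳ a′) (*-zeroʳ b′)) (cong₂ _+_ (*-zeroʳ a) (*-zeroʳ b)))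
  hit-suc (suc σ) (suc r) j a′ b′ a b = hit-suc σ r j a′ b′ a b

  hit-end : ∀ σ r a′ b′ a b → hit σ r 0 a′ b′ a b ≡ ind (σ ≡ᵇ r)
  hit-end zero zero a′ b′ a b = refl
  hit-end zero (suc r) a′ b′ a b = *-zeroʳ (P 0 (suc r) a′ b′)
  hit-end (suc σ) zero a′ b′ a b = refl
  hit-end (suc σ) (suc r) a′ b′ a b = hit-end σ r a′ b′ a b

  +1-cancel : ∀ {x y} → x + 1 ≡ suc y → x ≡ y
  +1-cancel {x} e = suc-injective (trans (+-comm 1 x) e)

  +0-cancel : ∀ {x y} → x + 0 ≡ y → x ≡ y
  +0-cancel {x} e = trans (sym (+-identityʳ x)) e

  +1-pred : ∀ {x y} → x + 1 ≡ y → x ≡ pred y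
  +1-pred {x} {y} e = cong pred (trans (+-comm 1 x) e)

  -- The hypotheses are `leaves-∷` and `ones-∷` for the colours inside and outside; `b` tells
  -- whether the parent lies inside, and `c` counts its children. When the parent already has two
  -- children, both sides vanish. With `H` arbitrary, `total-step` can use the same lemma with a
  -- single colour.
  insert-child : ∀ (H : ℕ → ℕ → ℕ → ℕ → ℕ → ℕ) σ {A A′ B B′ C C′ D D′} b c →
    A′ + ind b * leaf c ≡ ind b + A → B′ + ind b * one c ≡ B + ind b * leaf c →
    C′ + ind (not b) * leaf c ≡ ind (not b) + C → D′ + ind (not b) * one c ≡ D + ind (not b) * leaf c →
    ind (c ≤ᵇ 1) * H (ind b + σ) A′ B′ C′ D′ ≡
      ind b * leaf c * H (suc σ) A (suc B) C D + ind b * one c * H (suc σ) (suc A) (pred B) C D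
      + (ind (not b) * leaf c * H σ A B C (suc D) + ind (not b) * one c * H σ A B (suc C) (pred D))
  insert-child H σ {A} {A′} {B} {B′} {C} {C′} {D} {D′} true 0 eA eB eC eD
    rewrite +1-cancel {A′} eA | +0-cancel {B′} eB | +0-cancel {C′} eC | +0-cancel {D′} eD | +-comm B 1 | +-identityʳ D =
    cong (_+ 0) (sym (trans (+-identityʳ _) (+-identityʳ _)))
  insert-child H σ {A} {A′} {B} {B′} {C} {C′} {D} {D′} true 1 eA eB eC eD
    rewrite +0-cancel {A′} eA | +1-pred {B′} eB | +0-cancel {C′} eC | +0-cancel {D′} eD | +-identityʳ B | +-identityʳ D = sym (+-identityʳ _)
  insert-child H σ {A} {A′} {B} {B′} {C} {C′} {D} {D′} false 0 eA eB eC eD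
    rewrite +0-cancel {A′} eA | +0-cancel {B′} eB | +1-cancel {C′} eC | +0-cancel {D′} eD | +-comm D 1 | +-identityʳ B = sym (+-identityʳ _)
  insert-child H σ {A} {A′} {B} {B′} {C} {C′} {D} {D′} false 1 eA eB eC eD
    rewrite +0-cancel {A′} eA | +0-cancel {B′} eB | +0-cancel {C′} eC | +1-pred {D′} eD | +-identityʳ B | +-identityʳ D = refl
  insert-child H σ true (suc (suc c)) _ _ _ _ = refl
  insert-child H σ false (suc (suc c)) _ _ _ _ = refl

  insert-new : ∀ (H : ℕ → ℕ → ℕ) {C C′ D D′} c → C′ + leaf c ≡ C → D′ + one c ≡ D + leaf c →
    ind (c ≤ᵇ 1) * H C′ D′ ≡ leaf c * H (pred C) (suc D) + one c * H C (pred D)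
  insert-new H {C} {C′} {D} {D′} 0 eC eD rewrite +1-pred {C′} eC | +0-cancel {D′} eD | +-comm D 1 = sym (+-identityʳ _)
  insert-new H {C} {C′} {D} {D′} 1 eC eD rewrite +0-cancel {C′} eC | +1-pred {D′} eD | +-identityʳ D = refl
  insert-new H (suc (suc c)) _ _ = refl

  -- A parent is a larger label and hence described in the tail, so the climb to the root is a
  -- structural recursion and needs no fuel as `ancOrSelf` does.
  inSubtree : ℕ → List ℕ → ℕ → ℕ → Bool
  inSubtree k []       v x = x ≡ᵇ v
  inSubtree k (p ∷ ps) v x =
    if x ≡ᵇ k then (k ≡ᵇ v) ∨ inSubtree (suc k) ps v p else inSubtree (suc k) ps v x

  inSubtree-new : ∀ {k p ps} v → k < v → inSubtree k (p ∷ ps) v k ≡ inSubtree (suc k) ps v p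
  inSubtree-new {k} v k<v rewrite ≡ᵇ-true k k refl | ≡ᵇ-false k v (<⇒≢ k<v) = refl

  inSubtree-self : ∀ {k p ps} → inSubtree k (p ∷ ps) k k ≡ true
  inSubtree-self {k} rewrite ≡ᵇ-true k k refl = refl

  inSubtree-old : ∀ {k p ps} v x → k < x → inSubtree k (p ∷ ps) v x ≡ inSubtree (suc k) ps v x
  inSubtree-old {k} v x k<x rewrite ≡ᵇ-false x k (>⇒≢ k<x) = refl

  inSubtree-below : ∀ {k ps} v x → v < k → k ≤ x → Parents k ps → inSubtree k ps v x ≡ false
  inSubtree-below v x v<k k≤x [] = ≡ᵇ-false x v (>⇒≢ (<-≤-trans v<k k≤x))
  inSubtree-below {k} {p ∷ ps} v x v<k k≤x ((k<p , _) ∷ gd) with x ≟ k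
  ... | yes refl rewrite ≡ᵇ-true x x refl | ≡ᵇ-false x v (>⇒≢ v<k) = inSubtree-below v p (m<n⇒m<1+n v<k) k<p gd
  ... | no x≢k rewrite ≡ᵇ-false x k x≢k = inSubtree-below v x (m<n⇒m<1+n v<k) (≤∧≢⇒< k≤x (x≢k ∘ sym)) gd

  inside outside : ℕ → List ℕ → ℕ → ℕ → ℕ
  inside  k ps v x = ind (inSubtree k ps v x)
  outside k ps v x = ind (not (inSubtree k ps v x))

  size : ℕ → List ℕ → ℕ → ℕ
  size k ps v = rsum k (suc (length ps)) (inside k ps v)

  total : ℕ → ℕ
  total _ = 1

  -- Number of ways to insert j more labels as leaves so that the subtree of v ends up with r vertices.
  final : ℕ → ℕ → ℕ → List ℕ → ℕ → ℕ
  final r j k ps v = hit (size k ps v) r j (census leaf (inside k ps v) k ps) (census one (inside k ps v) k ps)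
    (census leaf (outside k ps v) k ps) (census one (outside k ps v) k ps)

  split-census : ∀ k l (d e z₁ z₀ : ℕ → ℕ) h₁ h₂ h₃ h₄ →
    rsum k l (λ p → d p * z₀ p * h₁ + d p * z₁ p * h₂ + (e p * z₀ p * h₃ + e p * z₁ p * h₄)) ≡
    rsum k l (λ p → d p * z₀ p) * h₁ + rsum k l (λ p → d p * z₁ p) * h₂
    + (rsum k l (λ p → e p * z₀ p) * h₃ + rsum k l (λ p → e p * z₁ p) * h₄)
  split-census k l d e z₁ z₀ h₁ h₂ h₃ h₄ = trans (rsum-+ k l _ _) (cong₂ _+_
    (trans (rsum-+ k l _ _) (cong₂ _+_ (rsum-*ʳ k l _ h₁) (rsum-*ʳ k l _ h₂)))
    (trans (rsum-+ k l _ _) (cong₂ _+_ (rsum-*ʳ k l _ h₃) (rsum-*ʳ k l _ h₄))))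

  module _ {k : ℕ} {ps : List ℕ} (gd : Parents (suc k) ps) where
    private
      l = suc (length ps)

    final-old : ∀ r j v → suc k ≤ v → rsum (suc k) l (λ p → ind (numChildren ps p ≤ᵇ 1) * final r j k (p ∷ ps) v)
      ≡ final r (suc j) (suc k) ps v
    final-old r j v k<v = begin
      rsum (suc k) l (λ p → ind (numChildren ps p ≤ᵇ 1) * final r j k (p ∷ ps) v)
        ≡⟨ rsum-cong (suc k) l step ⟩
      rsum (suc k) l (λ p → inside (suc k) ps v p * leaf (numChildren ps p) * h₁ + inside (suc k) ps v p * one (numChildren ps p) * h₂
        + (outside (suc k) ps v p * leaf (numChildren ps p) * h₃ + outside (suc k) ps v p * one (numChildren ps p) * h₄))
        ≡⟨ split-census (suc k) l (inside (suc k) ps v) (outside (suc k) ps v) (one ∘ numChildren ps) (leaf ∘ numChildren ps) h₁ h₂ h₃ h₄ ⟩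
      A * h₁ + B * h₂ + (C * h₃ + D * h₄)
        ≡⟨ sym (hit-suc (size (suc k) ps v) r j A B C D) ⟩
      final r (suc j) (suc k) ps v ∎
      where
      open ≡-Reasoning
      A = census leaf (inside (suc k) ps v) (suc k) ps
      B = census one (inside (suc k) ps v) (suc k) ps
      C = census leaf (outside (suc k) ps v) (suc k) ps
      D = census one (outside (suc k) ps v) (suc k) ps
      H : ℕ → ℕ → ℕ → ℕ → ℕ → ℕ
      H σ = hit σ r j
      h₁ = H (suc (size (suc k) ps v)) A (suc B) C D
      h₂ = H (suc (size (suc k) ps v)) (suc A) (pred B) C D
      h₃ = H (size (suc k) ps v) A B C (suc D)
      h₄ = H (size (suc k) ps v) A B (suc C) (pred D)
      step : ∀ p → suc k ≤ p → p < suc k + l → ind (numChildren ps p ≤ᵇ 1) * final r j k (p ∷ ps) v ≡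
        inside (suc k) ps v p * leaf (numChildren ps p) * h₁ + inside (suc k) ps v p * one (numChildren ps p) * h₂
        + (outside (suc k) ps v p * leaf (numChildren ps p) * h₃ + outside (suc k) ps v p * one (numChildren ps p) * h₄)
      step p k<p p< = trans
        (cong (λ s → ind (numChildren ps p ≤ᵇ 1) * H s A′ B′ C′ D′) size-∷)
        (insert-child H (size (suc k) ps v) (inSubtree (suc k) ps v p) (numChildren ps p)
          (trans (leaves-∷ k<p p< gd (inside (suc k) ps v) (inside k (p ∷ ps) v) ext-in) (cong (λ b → ind b + A) new))
          (ones-∷ k<p p< gd (inside (suc k) ps v) (inside k (p ∷ ps) v) ext-in)
          (trans (leaves-∷ k<p p< gd (outside (suc k) ps v) (outside k (p ∷ ps) v) ext-out) (cong (λ b → ind (not b) + C) new))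
          (ones-∷ k<p p< gd (outside (suc k) ps v) (outside k (p ∷ ps) v) ext-out))
        where
        A′ = census leaf (inside k (p ∷ ps) v) k (p ∷ ps)
        B′ = census one (inside k (p ∷ ps) v) k (p ∷ ps)
        C′ = census leaf (outside k (p ∷ ps) v) k (p ∷ ps)
        D′ = census one (outside k (p ∷ ps) v) k (p ∷ ps)
        new = inSubtree-new {k} {p} {ps} v k<v
        ext-in : extends (inside (suc k) ps v) k ps (inside k (p ∷ ps) v)
        ext-in x k<x _ = cong ind (inSubtree-old {k} {p} {ps} v x k<x)
        ext-out : extends (outside (suc k) ps v) k ps (outside k (p ∷ ps) v)
        ext-out x k<x _ = cong (ind ∘ not) (inSubtree-old {k} {p} {ps} v x k<x)
        size-∷ : size k (p ∷ ps) v ≡ ind (inSubtree (suc k) ps v p) + size (suc k) ps v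
        size-∷ = cong₂ (λ b w → ind b + w) new (rsum-cong (suc k) l ext-in)

    -- The subtree of the new label starts as a single leaf, inner state (1, 0), so `i` more
    -- insertions must fall inside. Outside, the new label is not counted, and the only change is
    -- that its parent has one more child: this is the state at which `attach` evaluates.
    final-new : ∀ i j → rsum (suc k) l (λ p → ind (numChildren ps p ≤ᵇ 1) * final (suc i) j k (p ∷ ps) k)
      ≡ P 0 i 1 0 * attach (P i j) (census leaf total (suc k) ps) (census one total (suc k) ps)
    final-new i j = begin
      rsum (suc k) l (λ p → ind (numChildren ps p ≤ᵇ 1) * final (suc i) j k (p ∷ ps) k)
        ≡⟨ rsum-cong (suc k) l step ⟩
      rsum (suc k) l (λ p → leaf (numChildren ps p) * h₁ + one (numChildren ps p) * h₂)
        ≡⟨ trans (rsum-+ (suc k) l (λ p → leaf (numChildren ps p) * h₁) (λ p → one (numChildren ps p) * h₂))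
             (cong₂ _+_ (rsum-*ʳ (suc k) l (leaf ∘ numChildren ps) h₁) (rsum-*ʳ (suc k) l (one ∘ numChildren ps) h₂)) ⟩
      rsum (suc k) l (λ p → leaf (numChildren ps p)) * h₁ + rsum (suc k) l (λ p → one (numChildren ps p)) * h₂
        ≡⟨ cong₂ (λ x y → x * h₁ + y * h₂) (rsum-cong (suc k) l (λ p _ _ → sym (*-identityˡ (leaf (numChildren ps p)))))
                                           (rsum-cong (suc k) l (λ p _ _ → sym (*-identityˡ (one (numChildren ps p))))) ⟩
      C * h₁ + D * h₂
        ≡⟨ r (P 0 i 1 0) C D _ _ ⟩
      P 0 i 1 0 * attach (P i j) C D ∎
      where
      open ≡-Reasoning
      r : ∀ t c d x y → c * (t * x) + d * (t * y) ≡ t * (c * x + d * y)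
      r = solve-∀
      C = census leaf total (suc k) ps
      D = census one total (suc k) ps
      H = hit 1 (suc i) j 1 0
      h₁ = H (pred C) (suc D)
      h₂ = H C (pred D)
      step : ∀ p → suc k ≤ p → p < suc k + l → ind (numChildren ps p ≤ᵇ 1) * final (suc i) j k (p ∷ ps) k
        ≡ leaf (numChildren ps p) * h₁ + one (numChildren ps p) * h₂
      step p k<p p< = begin
        ind (numChildren ps p ≤ᵇ 1) * hit (size k (p ∷ ps) k) (suc i) j A′ B′ C′ D′
          ≡⟨ cong (ind (numChildren ps p ≤ᵇ 1) *_) (cong₂ (λ s a → hit s (suc i) j a B′ C′ D′) size≡ A≡) ⟩
        ind (numChildren ps p ≤ᵇ 1) * hit 1 (suc i) j 1 B′ C′ D′
          ≡⟨ cong (λ b → ind (numChildren ps p ≤ᵇ 1) * hit 1 (suc i) j 1 b C′ D′) B≡ ⟩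
        ind (numChildren ps p ≤ᵇ 1) * H C′ D′
          ≡⟨ insert-new H (numChildren ps p) C≡ D≡ ⟩
        leaf (numChildren ps p) * h₁ + one (numChildren ps p) * h₂ ∎
        where
        A′ = census leaf (inside k (p ∷ ps) k) k (p ∷ ps)
        B′ = census one (inside k (p ∷ ps) k) k (p ∷ ps)
        C′ = census leaf (outside k (p ∷ ps) k) k (p ∷ ps)
        D′ = census one (outside k (p ∷ ps) k) k (p ∷ ps)
        old : ∀ x → suc k ≤ x → inSubtree k (p ∷ ps) k x ≡ false
        old x k<x = trans (inSubtree-old {k} {p} {ps} k x k<x) (inSubtree-below k x ≤-refl k<x gd)
        ext-in : extends (λ _ → 0) k ps (inside k (p ∷ ps) k)
        ext-in x k<x _ = cong ind (old x k<x)
        ext-out : extends total k ps (outside k (p ∷ ps) k)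
        ext-out x k<x _ = cong (ind ∘ not) (old x k<x)
        self = inSubtree-self {k} {p} {ps}
        size≡ : size k (p ∷ ps) k ≡ 1
        size≡ = cong₂ (λ b w → ind b + w) self (trans (rsum-cong (suc k) l ext-in) (rsum-0 (suc k) l))
        A≡ : A′ ≡ 1
        A≡ = trans (+0-cancel (leaves-∷ k<p p< gd (λ _ → 0) (inside k (p ∷ ps) k) ext-in))
          (cong₂ (λ b w → ind b + w) self (rsum-0 (suc k) l))
        B≡ : B′ ≡ 0
        B≡ = trans (+0-cancel (ones-∷ k<p p< gd (λ _ → 0) (inside k (p ∷ ps) k) ext-in)) (trans (+-identityʳ _) (rsum-0 (suc k) l))
        C≡ : C′ + leaf (numChildren ps p) ≡ C
        C≡ = trans (cong (C′ +_) (sym (*-identityˡ (leaf (numChildren ps p)))))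
          (trans (leaves-∷ k<p p< gd total (outside k (p ∷ ps) k) ext-out) (cong (λ b → ind (not b) + C) self))
        D≡ : D′ + one (numChildren ps p) ≡ D + leaf (numChildren ps p)
        D≡ = trans (cong (D′ +_) (sym (*-identityˡ (one (numChildren ps p)))))
          (trans (ones-∷ k<p p< gd total (outside k (p ∷ ps) k) ext-out) (cong (D +_) (*-identityˡ (leaf (numChildren ps p)))))

    total-step : ∀ (X : ℕ → ℕ → ℕ) →
      rsum (suc k) l (λ p → ind (numChildren ps p ≤ᵇ 1) * X (census leaf total k (p ∷ ps)) (census one total k (p ∷ ps)))
      ≡ grow X (census leaf total (suc k) ps) (census one total (suc k) ps)
    total-step X = begin
      rsum (suc k) l (λ p → ind (numChildren ps p ≤ᵇ 1) * X (census leaf total k (p ∷ ps)) (census one total k (p ∷ ps)))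
        ≡⟨ rsum-cong (suc k) l (λ p k<p p< → insert-child (λ _ a b _ _ → X a b) 0 {C = 0} {C′ = 0} {D = 0} {D′ = 0} true (numChildren ps p)
             (leaves-∷ k<p p< gd total total (λ _ _ _ → refl)) (ones-∷ k<p p< gd total total (λ _ _ _ → refl)) refl refl) ⟩
      rsum (suc k) l (λ p → 1 * leaf (numChildren ps p) * h₁ + 1 * one (numChildren ps p) * h₂ + 0)
        ≡⟨ split-census (suc k) l total (λ _ → 0) (one ∘ numChildren ps) (leaf ∘ numChildren ps) h₁ h₂ 0 0 ⟩
      A * h₁ + B * h₂ + (rsum (suc k) l (λ _ → 0) * 0 + rsum (suc k) l (λ _ → 0) * 0)
        ≡⟨ cong (λ z → A * h₁ + B * h₂ + (z * 0 + z * 0)) (rsum-0 (suc k) l) ⟩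
      A * h₁ + B * h₂ + 0
        ≡⟨ +-identityʳ _ ⟩
      grow X A B ∎
      where
      open ≡-Reasoning
      A = census leaf total (suc k) ps
      B = census one total (suc k) ps
      h₁ = X A (suc B)
      h₂ = X (suc A) (pred B)

  -- Number of continuations with a marked subtree of final size i+1, whose root is yet to come or already present.
  pairs : ℕ → ℕ → List ℕ → ℕ
  pairs i j ps = P 0 i 1 0 * attach (W i j) (census leaf total (suc j) ps) (census one total (suc j) ps)
    + rsum (suc j) (suc (length ps)) (final (suc i) j (suc j) ps)

  -- The root of the marked subtree is still to come, is the label inserted now, or is already
  -- present. By `attach-W` the first two cases add up to the first summand of `pairs i (suc j)`.
  pairs-step : ∀ i j ps → Parents (2 + j) ps →
    rsum (2 + j) (suc (length ps)) (λ p → ind (numChildren ps p ≤ᵇ 1) * pairs i j (p ∷ ps)) ≡ pairs i (suc j) ps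
  pairs-step i j ps gd = begin
    rsum k l (λ p → c p * (tr * F (p ∷ ps) + (new p + rsum k l (old p))))
      ≡⟨ rsum-cong k l (λ p _ _ → trans (r (c p) tr (F (p ∷ ps)) (new p) (rsum k l (old p)))
           (cong (tr * (c p * F (p ∷ ps)) + c p * new p +_) (sym (rsum-*ˡ k l (c p) (old p))))) ⟩
    rsum k l (λ p → tr * (c p * F (p ∷ ps)) + c p * new p + rsum k l (λ v → c p * old p v))
      ≡⟨ trans (rsum-+ k l (λ p → tr * (c p * F (p ∷ ps)) + c p * new p) (λ p → rsum k l (λ v → c p * old p v)))
           (cong₂ _+_ (rsum-+ k l (λ p → tr * (c p * F (p ∷ ps))) (λ p → c p * new p))
                      (rsum-swap k l k l (λ p v → c p * old p v))) ⟩
    rsum k l (λ p → tr * (c p * F (p ∷ ps))) + rsum k l (λ p → c p * new p) + rsum k l (λ v → rsum k l (λ p → c p * old p v))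
      ≡⟨ cong₂ _+_ (cong₂ _+_ (trans (rsum-*ˡ k l tr (λ p → c p * F (p ∷ ps))) (cong (tr *_) (total-step gd (attach (W i j)))))
                              (final-new gd i j))
                   (rsum-cong k l (λ v k≤v _ → final-old gd (suc i) j v k≤v)) ⟩
    tr * grow (attach (W i j)) A B + tr * attach (P i j) A B + S
      ≡⟨ cong (_+ S) (trans (sym (*-distribˡ-+ tr (grow (attach (W i j)) A B) (attach (P i j) A B)))
                            (cong (tr *_) (sym (attach-W i j A B)))) ⟩
    pairs i (suc j) ps ∎
    where
    open ≡-Reasoning
    k = 2 + j
    l = suc (length ps)
    tr = P 0 i 1 0
    c : ℕ → ℕ
    c p = ind (numChildren ps p ≤ᵇ 1)
    F : List ℕ → ℕ
    F qs = attach (W i j) (census leaf total (suc j) qs) (census one total (suc j) qs)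
    new : ℕ → ℕ
    new p = final (suc i) j (suc j) (p ∷ ps) (suc j)
    old : ℕ → ℕ → ℕ
    old p = final (suc i) j (suc j) (p ∷ ps)
    A = census leaf total k ps
    B = census one total k ps
    S = rsum k l (final (suc i) (suc j) k ps)
    r : ∀ c t f n o → c * (t * f + (n + o)) ≡ t * (c * f) + c * n + c * o
    r = solve-∀

  parentOf-0 : ∀ L → parentOf L 0 ≡ 0
  parentOf-0 []      = refl
  parentOf-0 (_ ∷ _) = refl

  -- The climb leaves the root through the default parent 0 and stays there. As 0 is not a label,
  -- surplus fuel creates no false ancestor.
  ancOrSelf-0 : ∀ L v fuel → 0 < v → ancOrSelf L v 0 fuel ≡ false
  ancOrSelf-0 L (suc v) zero       _   = refl
  ancOrSelf-0 L (suc v) (suc fuel) 0<v rewrite parentOf-0 L = ancOrSelf-0 L (suc v) fuel 0<v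

  -- Each step up raises the label by at least one, so fuel that covers the distance from `x` to the
  -- label of the root suffices. `L` is the whole list, and `ps` is what is left of it from label
  -- `k` on.
  ancOrSelf-inSubtree : ∀ L {k ps} v x fuel → Parents k ps → (∀ i → parentOf L (k + i) ≡ parentOf ps (suc i)) →
    0 < v → k ≤ x → x ≤ k + length ps → k + length ps ≤ x + fuel → ancOrSelf L v x fuel ≡ inSubtree k ps v x
  ancOrSelf-inSubtree L {k} v x fuel [] h 0<v k≤x x≤ enough
    with refl ← ≤-antisym k≤x (subst (x ≤_) (+-identityʳ k) x≤) = go fuel
    where
    go : ∀ fuel → ancOrSelf L v k fuel ≡ (k ≡ᵇ v)
    go zero = refl
    go (suc fuel) rewrite trans (cong (parentOf L) (sym (+-identityʳ k))) (h 0) | ancOrSelf-0 L v fuel 0<v with k ≡ᵇ v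
    ... | true  = refl
    ... | false = refl
  ancOrSelf-inSubtree L {k} {p ∷ ps} v x fuel ((k<p , p<) ∷ gd) h 0<v k≤x x≤ enough with x ≟ k
  ... | no x≢k = trans (ancOrSelf-inSubtree L v x fuel gd h′ 0<v k<x (subst (x ≤_) (+-suc k (length ps)) x≤)
                         (subst (_≤ x + fuel) (+-suc k (length ps)) enough))
                       (sym (inSubtree-old {k} {p} {ps} v x k<x))
    where
    k<x : k < x
    k<x = ≤∧≢⇒< k≤x (x≢k ∘ sym)
    h′ : ∀ i → parentOf L (suc k + i) ≡ parentOf ps (suc i)
    h′ i = trans (cong (parentOf L) (sym (+-suc k i))) (h (suc i))
  ... | yes refl = go fuel enough
    where
    h′ : ∀ i → parentOf L (suc k + i) ≡ parentOf ps (suc i)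
    h′ i = trans (cong (parentOf L) (sym (+-suc k i))) (h (suc i))
    go : ∀ fuel → k + suc (length ps) ≤ k + fuel → ancOrSelf L v k fuel ≡ inSubtree k (p ∷ ps) v k
    go zero e = contradiction (+-cancelˡ-≤ k (suc (length ps)) 0 e) λ ()
    go (suc fuel) e rewrite ≡ᵇ-true k k refl | trans (cong (parentOf L) (sym (+-identityʳ k))) (h 0) =
      cong ((k ≡ᵇ v) ∨_) (ancOrSelf-inSubtree L v p fuel gd h′ 0<v k<p (subst (p ≤_) (+-suc k (length ps)) (≤-pred p<))
        (≤-trans (s≤s (+-monoʳ-≤ k (≤-pred (+-cancelˡ-≤ k (suc (length ps)) (suc fuel) e)))) (+-monoˡ-≤ fuel k<p)))

  subtreeSize-size : ∀ ps v → Parents 1 ps → 0 < v → subtreeSize (suc (length ps)) ps v ≡ size 1 ps v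
  subtreeSize-size ps v gd 0<v = begin
    length (filterᵇ (λ x → ancOrSelf ps v x n) (vertices n))
      ≡⟨ length-filterᵇ (λ x → ancOrSelf ps v x n) (vertices n) ⟩
    sum (map (λ x → ind (ancOrSelf ps v x n)) (vertices n))
      ≡⟨ sum-vertices n (λ x → ind (ancOrSelf ps v x n)) ⟩
    rsum 1 n (λ x → ind (ancOrSelf ps v x n))
      ≡⟨ rsum-cong 1 n (λ x 1≤x x< → cong ind (ancOrSelf-inSubtree ps v x n gd (λ _ → refl) 0<v 1≤x (≤-pred x<) (m≤n+m n x))) ⟩
    size 1 ps v ∎
    where
    open ≡-Reasoning
    n = suc (length ps)

  count-trees : ∀ n → length (trees (suc n)) ≡ t (suc n)
  count-trees n = begin
    length (trees (suc n))
      ≡⟨ trans (sym (*-identityʳ _)) (length-sum (trees (suc n))) ⟩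
    sum (map (λ _ → 1) (trees (suc n)))
      ≡⟨ sum-trees n (λ _ → 1) ⟩
    psum 1 n (λ ps → valid ps * X 0 ps)
      ≡⟨ potential X (λ j ps gd → total-step gd (P 0 j)) n 0 ⟩
    X (n + 0) []
      ≡⟨ cong (λ m → P 0 m 1 0) (+-identityʳ n) ⟩
    P 0 n 1 0
      ≡⟨ t-suc n ⟩
    t (suc n) ∎
    where
    open ≡-Reasoning
    X : ℕ → List ℕ → ℕ
    X j ps = P 0 j (census leaf total (suc j) ps) (census one total (suc j) ps)
    length-sum : ∀ xss → length {A = List ℕ} xss * 1 ≡ sum (map (λ _ → 1) xss)
    length-sum [] = refl
    length-sum (_ ∷ xss) = cong suc (length-sum xss)

  count-pairs : ∀ n i → countPairs (suc n) (suc i) ≡ t (suc i) * W i (suc n) 0 0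
  count-pairs n i = begin
    countPairs (suc n) (suc i)
      ≡⟨ sum-trees n (λ ps → length (filterᵇ (λ v → subtreeSize (suc n) ps v ≡ᵇ suc i) (vertices (suc n)))) ⟩
    psum 1 n (λ ps → valid ps * length (filterᵇ (λ v → subtreeSize (suc n) ps v ≡ᵇ suc i) (vertices (suc n))))
      ≡⟨ psum-cong 1 n (λ { ps refl gd → cong (valid ps *_) (finished ps gd) }) ⟩
    psum 1 n (λ ps → valid ps * pairs i 0 ps)
      ≡⟨ potential (pairs i) (pairs-step i) n 0 ⟩
    pairs i (n + 0) []
      ≡⟨ cong (λ m → pairs i m []) (+-identityʳ n) ⟩
    pairs i n []
      ≡⟨ start ⟩
    P 0 i 1 0 * W i (suc n) 0 0
      ≡⟨ cong (_* W i (suc n) 0 0) (t-suc i) ⟩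
    t (suc i) * W i (suc n) 0 0 ∎
    where
    open ≡-Reasoning
    finished : ∀ ps → Parents 1 ps →
      length (filterᵇ (λ v → subtreeSize (suc (length ps)) ps v ≡ᵇ suc i) (vertices (suc (length ps)))) ≡ pairs i 0 ps
    finished ps gd = begin
      length (filterᵇ (λ v → subtreeSize (suc (length ps)) ps v ≡ᵇ suc i) (vertices (suc (length ps))))
        ≡⟨ trans (length-filterᵇ (λ v → subtreeSize (suc (length ps)) ps v ≡ᵇ suc i) (vertices (suc (length ps))))
                 (sum-vertices (suc (length ps)) (λ v → ind (subtreeSize (suc (length ps)) ps v ≡ᵇ suc i))) ⟩
      rsum 1 (suc (length ps)) (λ v → ind (subtreeSize (suc (length ps)) ps v ≡ᵇ suc i))
        ≡⟨ rsum-cong 1 (suc (length ps)) (λ v 1≤v _ → trans (cong (λ s → ind (s ≡ᵇ suc i)) (subtreeSize-size ps v gd 1≤v))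
             (sym (hit-end (size 1 ps v) (suc i) _ _ _ _))) ⟩
      rsum 1 (suc (length ps)) (final (suc i) 0 1 ps)
        ≡⟨ cong (_+ rsum 1 (suc (length ps)) (final (suc i) 0 1 ps))
             (sym (trans (cong (P 0 i 1 0 *_) (cong₂ _+_ (*-zeroʳ (census leaf total 1 ps)) (*-zeroʳ (census one total 1 ps)))) (*-zeroʳ (P 0 i 1 0)))) ⟩
      pairs i 0 ps ∎
    -- At the start only the root is present: either it is the marked vertex itself, which gives
    -- `P i n 0 0`, or the marked subtree is attached later, which gives `W i n 0 1`.
    start : pairs i n [] ≡ P 0 i 1 0 * W i (suc n) 0 0
    start rewrite ≡ᵇ-true n n refl = r (P 0 i 1 0) (W i n 0 1) (P i n 0 0)
      where
      r : ∀ t w p → t * (w + 0 + 0) + (t * p + 0) ≡ t * (w + p)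
      r = solve-∀

open Enumeration

-- Ordered-field arithmetic in ℚ.

module Rationals where

  open import Data.Integer using (+_; -[1+_])
  import Data.Integer as ℤ
  import Data.Integer.Properties as ℤ
  open import Data.Maybe using (Maybe; just; nothing)
  open import Data.Rational using (mkℚ; _/_; toℚᵘ; nonNegative)
  open import Data.Rational.Unnormalised.Base using (mkℚᵘ; *≡*)
  import Data.Rational.Unnormalised.Properties as ℚᵘ
  open import Data.Sum using (inj₁; inj₂)
  open import Level using (0ℓ)
  open import Relation.Nullary using (yes; no)
  open import Tactic.RingSolver.Core.AlmostCommutativeRing using (AlmostCommutativeRing; fromCommutativeRing)
  open import Data.Rational.Properties
  open import Tactic.RingSolver using (solve-∀)
  import Data.Nat.Properties as ℕ

  ring : AlmostCommutativeRing 0ℓ 0ℓ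
  ring = fromCommutativeRing +-*-commutativeRing isZero
    where
    isZero : ∀ x → Maybe (0ℚ ≡ x)
    isZero x with 0ℚ ≟ x
    ... | yes e = just e
    ... | no  _ = nothing

  ≤-slack : ∀ {p q} d → 0ℚ ≤ℚ d → p +ℚ d ≡ q → p ≤ℚ q
  ≤-slack {p} d 0≤d e = subst₂ _≤ℚ_ (+-identityʳ p) e (+-monoʳ-≤ p 0≤d)

  0≤-diff : ∀ {p q} → p ≤ℚ q → 0ℚ ≤ℚ q - p
  0≤-diff {p} {q} p≤q = subst (_≤ℚ q - p) (+-inverseʳ p) (+-monoˡ-≤ (- p) p≤q)

  0≤+ : ∀ {p q} → 0ℚ ≤ℚ p → 0ℚ ≤ℚ q → 0ℚ ≤ℚ p +ℚ q
  0≤+ 0≤p 0≤q = +-mono-≤ 0≤p 0≤q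

  *-monoˡ : ∀ {r p q} → 0ℚ ≤ℚ r → p ≤ℚ q → r *ℚ p ≤ℚ r *ℚ q
  *-monoˡ {r} 0≤r = *-monoˡ-≤-nonNeg r {{nonNegative 0≤r}}

  *-monoʳ : ∀ {r p q} → 0ℚ ≤ℚ r → p ≤ℚ q → p *ℚ r ≤ℚ q *ℚ r
  *-monoʳ {r} 0≤r = *-monoʳ-≤-nonNeg r {{nonNegative 0≤r}}

  0≤* : ∀ {p q} → 0ℚ ≤ℚ p → 0ℚ ≤ℚ q → 0ℚ ≤ℚ p *ℚ q
  0≤* {p} {q} 0≤p 0≤q = subst (_≤ℚ p *ℚ q) (*-zeroʳ p) (*-monoˡ 0≤p 0≤q)

  *-mono : ∀ {p q r s} → 0ℚ ≤ℚ p → 0ℚ ≤ℚ s → p ≤ℚ q → r ≤ℚ s → p *ℚ r ≤ℚ q *ℚ s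
  *-mono 0≤p 0≤s p≤q r≤s = ≤-trans (*-monoˡ 0≤p r≤s) (*-monoʳ 0≤s p≤q)

  0<* : ∀ {p q} → 0ℚ <ℚ p → 0ℚ <ℚ q → 0ℚ <ℚ p *ℚ q
  0<* {p} {q} 0<p 0<q = subst (_<ℚ p *ℚ q) (*-zeroʳ p) (*-monoʳ-<-pos p {{positive 0<p}} 0<q)

  p-q≤p : ∀ {p q} → 0ℚ ≤ℚ q → p - q ≤ℚ p
  p-q≤p {p} {q} 0≤q = ≤-slack q 0≤q (l p q)
    where
    l : ∀ p q → p - q +ℚ q ≡ p
    l = solve-∀ ring

  ∣∣≤ : ∀ {p e} → p ≤ℚ e → - p ≤ℚ e → ∣ p ∣ ≤ℚ e
  ∣∣≤ {p} {e} p≤ -p≤ with ∣p∣≡p∨∣p∣≡-p p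
  ... | inj₁ eq = subst (_≤ℚ e) (sym eq) p≤
  ... | inj₂ eq = subst (_≤ℚ e) (sym eq) -p≤

  p≤∣p∣ : ∀ p → p ≤ℚ ∣ p ∣
  p≤∣p∣ p with ≤-total 0ℚ p
  ... | inj₁ 0≤p = ≤-reflexive (sym (0≤p⇒∣p∣≡p 0≤p))
  ... | inj₂ p≤0 = ≤-trans p≤0 (0≤∣p∣ p)

  ∣-∣-within : ∀ {p q e} → 0ℚ ≤ℚ p → 0ℚ ≤ℚ q → p ≤ℚ e → q ≤ℚ e → ∣ p - q ∣ ≤ℚ e
  ∣-∣-within {p} {q} 0≤p 0≤q p≤e q≤e = ∣∣≤ (≤-trans (p-q≤p 0≤q) p≤e) (≤-trans (≤-reflexive (l p q)) (≤-trans (p-q≤p 0≤p) q≤e))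
    where
    l : ∀ p q → - (p - q) ≡ q - p
    l = solve-∀ ring

  ∣*∣-nonNeg : ∀ {c} x → 0ℚ ≤ℚ c → ∣ c *ℚ x ∣ ≡ c *ℚ ∣ x ∣
  ∣*∣-nonNeg {c} x 0≤c = trans (∣p*q∣≡∣p∣*∣q∣ c x) (cong (_*ℚ ∣ x ∣) (0≤p⇒∣p∣≡p 0≤c))

  ∣-∣-* : ∀ p q p′ q′ → ∣ p *ℚ q - p′ *ℚ q′ ∣ ≤ℚ ∣ p ∣ *ℚ ∣ q - q′ ∣ +ℚ ∣ q′ ∣ *ℚ ∣ p - p′ ∣
  ∣-∣-* p q p′ q′ = subst₂ _≤ℚ_ (cong ∣_∣ (l p q p′ q′)) (cong₂ _+ℚ_ (∣p*q∣≡∣p∣*∣q∣ p (q - q′)) (∣p*q∣≡∣p∣*∣q∣ q′ (p - p′)))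
    (∣p+q∣≤∣p∣+∣q∣ (p *ℚ (q - q′)) (q′ *ℚ (p - p′)))
    where
    l : ∀ p q p′ q′ → p *ℚ (q - q′) +ℚ q′ *ℚ (p - p′) ≡ p *ℚ q - p′ *ℚ q′
    l = solve-∀ ring

  ∣-∣-+ : ∀ p q p′ q′ → ∣ (p +ℚ q) - (p′ +ℚ q′) ∣ ≤ℚ ∣ p - p′ ∣ +ℚ ∣ q - q′ ∣
  ∣-∣-+ p q p′ q′ = subst (_≤ℚ ∣ p - p′ ∣ +ℚ ∣ q - q′ ∣) (cong ∣_∣ (l p q p′ q′)) (∣p+q∣≤∣p∣+∣q∣ (p - p′) (q - q′))
    where
    l : ∀ p q p′ q′ → (p - p′) +ℚ (q - q′) ≡ (p +ℚ q) - (p′ +ℚ q′)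
    l = solve-∀ ring

  -- Recursive rather than `+ n / 1`, so that `ι (suc n)` unfolds to `1ℚ +ℚ ι n` and small constants
  -- compute inside ring equations.
  ι : ℕ → ℚ
  ι zero    = 0ℚ
  ι (suc n) = 1ℚ +ℚ ι n

  ι-+ : ∀ m n → ι (m + n) ≡ ι m +ℚ ι n
  ι-+ zero n = sym (+-identityˡ (ι n))
  ι-+ (suc m) n = trans (cong (1ℚ +ℚ_) (ι-+ m n)) (sym (+-assoc 1ℚ (ι m) (ι n)))

  ι-* : ∀ m n → ι (m * n) ≡ ι m *ℚ ι n
  ι-* zero n = sym (*-zeroˡ (ι n))
  ι-* (suc m) n = trans (ι-+ n (m * n)) (trans (cong (ι n +ℚ_) (ι-* m n)) (l (ι m) (ι n)))
    where
    l : ∀ x y → y +ℚ x *ℚ y ≡ (1ℚ +ℚ x) *ℚ y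
    l = solve-∀ ring

  0≤1 : 0ℚ ≤ℚ 1ℚ
  0≤1 = nonNegative⁻¹ 1ℚ

  0≤ι : ∀ n → 0ℚ ≤ℚ ι n
  0≤ι zero = ≤-refl
  0≤ι (suc n) = 0≤+ 0≤1 (0≤ι n)

  1≤ι : ∀ n → 1ℚ ≤ℚ ι (suc n)
  1≤ι n = ≤-slack (ι n) (0≤ι n) refl

  0<ι : ∀ n → 0ℚ <ℚ ι (suc n)
  0<ι n = <-≤-trans (positive⁻¹ 1ℚ) (1≤ι n)

  ι-mono : ∀ {m n} → m ≤ n → ι m ≤ℚ ι n
  ι-mono {n = n} z≤n = 0≤ι n
  ι-mono (s≤s m≤n) = +-monoʳ-≤ 1ℚ (ι-mono m≤n)

  ι≡/1 : ∀ n → ι n ≡ + n / 1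
  ι≡/1 zero = refl
  ι≡/1 (suc n) = trans (cong (1ℚ +ℚ_) (ι≡/1 n)) (toℚᵘ-injective (ℚᵘ.≃-trans (toℚᵘ-homo-+ 1ℚ (+ n / 1))
    (ℚᵘ.≃-trans (ℚᵘ.+-congʳ (toℚᵘ 1ℚ) (toℚᵘ-fromℚᵘ (mkℚᵘ (+ n) 0)))
    (ℚᵘ.≃-trans (*≡* (cong (ℤ._* + 1) (cong (λ x → + 1 ℤ.+ x) (ℤ.*-identityʳ (+ n))))) (ℚᵘ.≃-sym (toℚᵘ-fromℚᵘ (mkℚᵘ (+ suc n) 0)))))))

  frac-* : ∀ a b → (+ a / suc b) *ℚ ι (suc b) ≡ ι a
  frac-* a b = trans (cong ((+ a / suc b) *ℚ_) (ι≡/1 (suc b))) (trans (toℚᵘ-injective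
    (ℚᵘ.≃-trans (toℚᵘ-homo-* (+ a / suc b) (+ suc b / 1))
    (ℚᵘ.≃-trans (ℚᵘ.*-cong (toℚᵘ-fromℚᵘ (mkℚᵘ (+ a) b)) (toℚᵘ-fromℚᵘ (mkℚᵘ (+ suc b) 0)))
    (ℚᵘ.≃-trans (*≡* (trans (ℤ.*-identityʳ (+ a ℤ.* + suc b)) (cong (λ d → + a ℤ.* + d) (sym (ℕ.*-identityʳ (suc b)))))) (ℚᵘ.≃-sym (toℚᵘ-fromℚᵘ (mkℚᵘ (+ a) 0))))))) (sym (ι≡/1 a)))

  rec : ℕ → ℚ
  rec n = + 1 / suc n

  rec-ι : ∀ n → rec n *ℚ ι (suc n) ≡ 1ℚ
  rec-ι n = frac-* 1 n

  0<rec : ∀ n → 0ℚ <ℚ rec n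
  0<rec n = positive⁻¹ (rec n) {{normalize-pos 1 (suc n)}}

  0≤rec : ∀ n → 0ℚ ≤ℚ rec n
  0≤rec n = <⇒≤ (0<rec n)

  rec-antimono : ∀ {m n} → m ≤ n → rec n ≤ℚ rec m
  rec-antimono {m} {n} m≤n = subst₂ _≤ℚ_ e₁ e₂ (*-monoˡ (0≤* (0≤rec m) (0≤rec n)) (ι-mono (s≤s m≤n)))
    where
    l₁ : ∀ x y z → x *ℚ y *ℚ z ≡ y *ℚ (x *ℚ z)
    l₁ = solve-∀ ring
    l₂ : ∀ x y z → x *ℚ y *ℚ z ≡ x *ℚ (y *ℚ z)
    l₂ = solve-∀ ring
    e₁ : rec m *ℚ rec n *ℚ ι (suc m) ≡ rec n
    e₁ = trans (l₁ (rec m) (rec n) (ι (suc m))) (trans (cong (rec n *ℚ_) (rec-ι m)) (*-identityʳ (rec n)))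
    e₂ : rec m *ℚ rec n *ℚ ι (suc n) ≡ rec m
    e₂ = trans (l₂ (rec m) (rec n) (ι (suc n))) (trans (cong (rec m *ℚ_) (rec-ι n)) (*-identityʳ (rec m)))

  archimedean : ∀ ε → 0ℚ <ℚ ε → ∃[ N ] rec N ≤ℚ ε
  archimedean ε@(mkℚ (+ zero) d _) 0<ε with () ← ℤ.Positive.pos (positive 0<ε)
  archimedean ε@(mkℚ -[1+ a ] d _) 0<ε with () ← ℤ.Positive.pos (positive 0<ε)
  -- The denominator of ε is `suc d`, and a positive fraction is at least one over its denominator.
  archimedean ε@(mkℚ (+ suc a) d _) 0<ε = d , *-cancelʳ-≤-pos (ι (suc d)) {{positive (0<ι d)}}
    (subst₂ _≤ℚ_ (sym (rec-ι d)) (trans (sym (frac-* (suc a) d)) (cong (_*ℚ ι (suc d)) (↥p/↧p≡p ε))) (1≤ι a))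

open Rationals

-- Oscillation and Cauchy sequences of rationals.

module CauchySequences where

  open import Data.Rational using (1/_; Positive)
  open import Data.Rational.Properties
  open import Tactic.RingSolver using (solve-∀)
  import Data.Nat.Properties as ℕ

  record Osc (x : ℕ → ℚ) (ε : ℚ) : Set where
    constructor _,_
    field
      from  : ℕ
      close : ∀ m n → from ≤ m → from ≤ n → ∣ x m - x n ∣ ≤ℚ ε

  record Cauchy (x : ℕ → ℚ) : Set where
    field osc : ∀ ε → 0ℚ <ℚ ε → Osc x ε

  open Cauchy public

  divide : ∀ b ε → 0ℚ <ℚ b → 0ℚ <ℚ ε → ∃[ δ ] (0ℚ <ℚ δ × b *ℚ δ ≡ ε)
  divide b ε 0<b 0<ε = 1/ b *ℚ ε , 0<* (positive⁻¹ (1/ b) {{1/pos⇒pos b}}) 0<ε ,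
    trans (sym (*-assoc b (1/ b) ε)) (trans (cong (_*ℚ ε) (*-inverseʳ b)) (*-identityˡ ε))
    where instance
    b>0 : Positive b
    b>0 = positive 0<b
    b≢0 : _
    b≢0 = pos⇒nonZero b

  halves : ∀ ε → ½ *ℚ ε +ℚ ½ *ℚ ε ≡ ε
  halves = solve-∀ ring

  0<½* : ∀ {ε} → 0ℚ <ℚ ε → 0ℚ <ℚ ½ *ℚ ε
  0<½* 0<ε = 0<* (positive⁻¹ ½) 0<ε

  cauchy-const : ∀ c → Cauchy (λ _ → c)
  cauchy-const c .osc ε 0<ε = 0 , λ _ _ _ _ → subst (_≤ℚ ε) (sym (cong ∣_∣ (+-inverseʳ c))) (<⇒≤ 0<ε)

  cauchy-+ : ∀ {x y} → Cauchy x → Cauchy y → Cauchy (λ n → x n +ℚ y n)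
  cauchy-+ {x} {y} cx cy .osc ε 0<ε with osc cx (½ *ℚ ε) (0<½* 0<ε) | osc cy (½ *ℚ ε) (0<½* 0<ε)
  ... | M , hx | N , hy = M ⊔ N , λ m n m≥ n≥ → ≤-trans (∣-∣-+ (x m) (y m) (x n) (y n)) (≤-trans
    (+-mono-≤ (hx m n (ℕ.m⊔n≤o⇒m≤o M N m≥) (ℕ.m⊔n≤o⇒m≤o M N n≥)) (hy m n (ℕ.m⊔n≤o⇒n≤o M N m≥) (ℕ.m⊔n≤o⇒n≤o M N n≥)))
    (≤-reflexive (halves ε)))

  cauchy-bounded : ∀ {x} → Cauchy x → ∃[ B ] (0ℚ <ℚ B × ∃[ N ] (∀ n → N ≤ n → ∣ x n ∣ ≤ℚ B))
  cauchy-bounded {x} cx with osc cx 1ℚ (positive⁻¹ 1ℚ)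
  ... | N , h = 1ℚ +ℚ ∣ x N ∣ , <-≤-trans (positive⁻¹ 1ℚ) (≤-slack ∣ x N ∣ (0≤∣p∣ (x N)) refl) , N , λ n N≤n →
    ≤-trans (≤-reflexive (cong ∣_∣ (l (x n) (x N))))
    (≤-trans (∣p+q∣≤∣p∣+∣q∣ (x n - x N) (x N)) (+-monoˡ-≤ ∣ x N ∣ (h n N N≤n ℕ.≤-refl)))
    where
    l : ∀ p q → p ≡ (p - q) +ℚ q
    l = solve-∀ ring

  osc-* : ∀ {x y} B C δ η M N → 0ℚ ≤ℚ δ → 0ℚ ≤ℚ η →
    (∀ n → M ≤ n → ∣ x n ∣ ≤ℚ B) → (∀ n → N ≤ n → ∣ y n ∣ ≤ℚ C) → Osc y δ → Osc x η →
    Osc (λ n → x n *ℚ y n) (B *ℚ δ +ℚ C *ℚ η)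
  osc-* {x} {y} B C δ η M N 0≤δ 0≤η hB hC (N′ , hy) (M′ , hx) = K , λ m n m≥ n≥ →
    ≤-trans (∣-∣-* (x m) (y m) (x n) (y n)) (+-mono-≤
      (*-mono (0≤∣p∣ (x m)) 0≤δ (hB m (M≤ m≥)) (hy m n (N′≤ m≥) (N′≤ n≥)))
      (*-mono (0≤∣p∣ (y n)) 0≤η (hC n (N≤ n≥)) (hx m n (M′≤ m≥) (M′≤ n≥))))
    where
    K = (M ⊔ N) ⊔ (M′ ⊔ N′)
    M≤ : ∀ {k} → K ≤ k → M ≤ k
    M≤ h = ℕ.m⊔n≤o⇒m≤o M N (ℕ.m⊔n≤o⇒m≤o (M ⊔ N) (M′ ⊔ N′) h)
    N≤ : ∀ {k} → K ≤ k → N ≤ k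
    N≤ h = ℕ.m⊔n≤o⇒n≤o M N (ℕ.m⊔n≤o⇒m≤o (M ⊔ N) (M′ ⊔ N′) h)
    M′≤ : ∀ {k} → K ≤ k → M′ ≤ k
    M′≤ h = ℕ.m⊔n≤o⇒m≤o M′ N′ (ℕ.m⊔n≤o⇒n≤o (M ⊔ N) (M′ ⊔ N′) h)
    N′≤ : ∀ {k} → K ≤ k → N′ ≤ k
    N′≤ h = ℕ.m⊔n≤o⇒n≤o M′ N′ (ℕ.m⊔n≤o⇒n≤o (M ⊔ N) (M′ ⊔ N′) h)

  cauchy-* : ∀ {x y} → Cauchy x → Cauchy y → Cauchy (λ n → x n *ℚ y n)
  cauchy-* {x} {y} cx cy .osc ε 0<ε =
    let B , 0<B , M , hB = cauchy-bounded cx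
        C , 0<C , N , hC = cauchy-bounded cy
        δ , 0<δ , eδ = divide B (½ *ℚ ε) 0<B (0<½* 0<ε)
        η , 0<η , eη = divide C (½ *ℚ ε) 0<C (0<½* 0<ε)
    in subst (Osc (λ n → x n *ℚ y n)) (trans (cong₂ _+ℚ_ eδ eη) (halves ε))
         (osc-* {x} {y} B C δ η M N (<⇒≤ 0<δ) (<⇒≤ 0<η) hB hC (osc cy δ 0<δ) (osc cx η 0<η))

  cauchy-cong : ∀ {x y} N → (∀ n → N ≤ n → x n ≡ y n) → Cauchy x → Cauchy y
  cauchy-cong N e cx .osc ε 0<ε with osc cx ε 0<ε
  ... | M , h = M ⊔ N , λ m n m≥ n≥ → subst (_≤ℚ ε)
    (cong ∣_∣ (cong₂ _-_ (e m (ℕ.m⊔n≤o⇒n≤o M N m≥)) (e n (ℕ.m⊔n≤o⇒n≤o M N n≥))))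
    (h m n (ℕ.m⊔n≤o⇒m≤o M N m≥) (ℕ.m⊔n≤o⇒m≤o M N n≥))

  cauchy-minus : ∀ {x y} → Cauchy x → Cauchy y → Cauchy (λ n → x n - y n)
  cauchy-minus {x} {y} cx cy =
    cauchy-cong 0 (λ n _ → l (x n) (y n)) (cauchy-+ {x} {λ n → - 1ℚ *ℚ y n} cx (cauchy-* {λ _ → - 1ℚ} {y} (cauchy-const (- 1ℚ)) cy))
    where
    l : ∀ p q → p +ℚ (- 1ℚ) *ℚ q ≡ p - q
    l = solve-∀ ring

  cauchy-∸ : ∀ {x} k → Cauchy x → Cauchy (λ n → x (n ∸ k))
  cauchy-∸ k cx .osc ε 0<ε with osc cx ε 0<ε
  ... | N , h = N + k , λ m n m≥ n≥ → h (m ∸ k) (n ∸ k) (ℕ.m+n≤o⇒m≤o∸n N m≥) (ℕ.m+n≤o⇒m≤o∸n N n≥)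

  cauchy-suc : ∀ {x} → Cauchy x → Cauchy (λ n → x (suc n))
  cauchy-suc cx .osc ε 0<ε with osc cx ε 0<ε
  ... | N , h = N , λ m n m≥ n≥ → h (suc m) (suc n) (ℕ.m≤n⇒m≤1+n m≥) (ℕ.m≤n⇒m≤1+n n≥)

  cauchy-rec : Cauchy rec
  cauchy-rec .osc ε 0<ε =
    let N , h = archimedean ε 0<ε
    in N , λ m n m≥ n≥ → ≤-trans (∣-∣-within (0≤rec m) (0≤rec n) (rec-antimono m≥) (rec-antimono n≥)) h

  pow : ℚ → ℕ → ℚ
  pow c zero    = 1ℚ
  pow c (suc n) = c *ℚ pow c n

  0≤pow : ∀ {c} → 0ℚ ≤ℚ c → ∀ n → 0ℚ ≤ℚ pow c n
  0≤pow 0≤c zero    = 0≤1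
  0≤pow 0≤c (suc n) = 0≤* 0≤c (0≤pow 0≤c n)

  0<pow : ∀ {c} → 0ℚ <ℚ c → ∀ n → 0ℚ <ℚ pow c n
  0<pow 0<c zero    = positive⁻¹ 1ℚ
  0<pow 0<c (suc n) = 0<* 0<c (0<pow 0<c n)

  pow-mono : ∀ {c d} → 0ℚ ≤ℚ c → c ≤ℚ d → ∀ n → pow c n ≤ℚ pow d n
  pow-mono 0≤c c≤d zero = ≤-refl
  pow-mono 0≤c c≤d (suc n) = *-mono 0≤c (0≤pow (≤-trans 0≤c c≤d) n) c≤d (pow-mono 0≤c c≤d n)

  -- This is 3/4 + 1/8: one step shrinks the oscillation of the ratios `S` by 3/4, and 1/8 pays for
  -- cutting the series off.
  ⅞ : ℚ
  ⅞ = ι 7 *ℚ rec 7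

  -- Bernoulli's inequality as (7/8)^k ≤ 7/(7 + k): in the induction (7/8)(8 + k) falls short of 7 +
  -- k by k/8.
  ⅞^-bound : ∀ k → pow ⅞ k *ℚ (ι 7 +ℚ ι k) ≤ℚ ι 7
  ⅞^-bound zero = ≤-refl
  ⅞^-bound (suc k) = ≤-trans (≤-slack (½ *ℚ ½ *ℚ ½ *ℚ pow ⅞ k *ℚ ι k)
      (0≤* (0≤* (nonNegative⁻¹ (½ *ℚ ½ *ℚ ½)) (0≤pow (nonNegative⁻¹ ⅞) k)) (0≤ι k)) (l (pow ⅞ k) (ι k)))
    (⅞^-bound k)
    where
    l : ∀ p x → ⅞ *ℚ p *ℚ (ι 7 +ℚ (1ℚ +ℚ x)) +ℚ ½ *ℚ ½ *ℚ ½ *ℚ p *ℚ x ≡ p *ℚ (ι 7 +ℚ x)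
    l = solve-∀ ring

  ⅞^-small : ∀ ε → 0ℚ <ℚ ε → ∃[ k ] pow ⅞ k ≤ℚ ε
  ⅞^-small ε 0<ε =
    let δ , 0<δ , eδ = divide (ι 7) ε (0<ι 6) 0<ε
        k , h = archimedean δ 0<δ
    in suc k , bound δ k eδ h
    where
    l₁ : ∀ p x y → p *ℚ y +ℚ p *ℚ x ≡ p *ℚ (x +ℚ y)
    l₁ = solve-∀ ring
    bound : ∀ δ k → ι 7 *ℚ δ ≡ ε → rec k ≤ℚ δ → pow ⅞ (suc k) ≤ℚ ε
    bound δ k eδ h = *-cancelʳ-≤-pos (ι (suc k)) {{positive (0<ι k)}} (begin
      pow ⅞ (suc k) *ℚ ι (suc k)          ≤⟨ ≤-slack (pow ⅞ (suc k) *ℚ ι 7) (0≤* (0≤pow (nonNegative⁻¹ ⅞) (suc k)) (0≤ι 7)) (l₁ (pow ⅞ (suc k)) (ι 7) (ι (suc k))) ⟩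
      pow ⅞ (suc k) *ℚ (ι 7 +ℚ ι (suc k)) ≤⟨ ⅞^-bound (suc k) ⟩
      ι 7                                 ≡⟨ sym (*-identityʳ (ι 7)) ⟩
      ι 7 *ℚ 1ℚ                           ≡⟨ cong (ι 7 *ℚ_) (sym (rec-ι k)) ⟩
      ι 7 *ℚ (rec k *ℚ ι (suc k))         ≡⟨ sym (*-assoc (ι 7) (rec k) (ι (suc k))) ⟩
      ι 7 *ℚ rec k *ℚ ι (suc k)           ≤⟨ *-monoʳ (0≤ι (suc k)) (*-monoˡ (0≤ι 7) h) ⟩
      ι 7 *ℚ δ *ℚ ι (suc k)               ≡⟨ cong (_*ℚ ι (suc k)) eδ ⟩
      ε *ℚ ι (suc k)                      ∎)
      where open ≤-Reasoning

open CauchySequences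

-- Normalised coefficients and the first bounds on their ratios.

module Coefficients where

  open import Data.Rational.Properties
  open import Tactic.RingSolver using (solve-∀)
  import Data.Nat.Properties as ℕ

  inv! : ℕ → ℚ
  inv! zero    = 1ℚ
  inv! (suc n) = rec n *ℚ inv! n

  inv!-ι : ∀ n → inv! n *ℚ ι (n !) ≡ 1ℚ
  inv!-ι zero = refl
  inv!-ι (suc n) = trans (cong (rec n *ℚ inv! n *ℚ_) (ι-* (suc n) (n !)))
    (trans (l (rec n) (inv! n) (ι (suc n)) (ι (n !))) (cong₂ _*ℚ_ (rec-ι n) (inv!-ι n)))
    where
    l : ∀ r v x y → r *ℚ v *ℚ (x *ℚ y) ≡ (r *ℚ x) *ℚ (v *ℚ y)
    l = solve-∀ ring

  0<inv! : ∀ n → 0ℚ <ℚ inv! n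
  0<inv! zero    = positive⁻¹ 1ℚ
  0<inv! (suc n) = 0<* (0<rec n) (0<inv! n)

  P>0 : ∀ n a b → 1 ≤ P 0 n (suc a) b
  P>0 zero    a b = s≤s z≤n
  P>0 (suc n) a b = ℕ.≤-trans (P>0 n a (suc b)) (ℕ.≤-trans (ℕ.m≤m+n _ (a * P 0 n (suc a) (suc b))) (ℕ.m≤m+n _ _))

  t>0 : ∀ n → 1 ≤ t n
  t>0 zero    = s≤s z≤n
  t>0 (suc n) = subst (1 ≤_) (t-suc n) (P>0 n 0 0)

  -- f m * g m = 1; rec n is 1/(n+1), hence the pred.
  f g : ℕ → ℚ
  f m = ι (t m) *ℚ inv! m
  g m = ι (m !) *ℚ rec (pred (t m))

  ι-pred : ∀ {n} → 1 ≤ n → ι (suc (pred n)) ≡ ι n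
  ι-pred (s≤s _) = refl

  f*g : ∀ m → f m *ℚ g m ≡ 1ℚ
  f*g m = trans (l (ι (t m)) (inv! m) (ι (m !)) (rec (pred (t m)))) (cong₂ _*ℚ_ (inv!-ι m)
    (trans (cong (rec (pred (t m)) *ℚ_) (sym (ι-pred (t>0 m)))) (rec-ι (pred (t m)))))
    where
    l : ∀ x y z w → x *ℚ y *ℚ (z *ℚ w) ≡ (y *ℚ z) *ℚ (w *ℚ x)
    l = solve-∀ ring

  0<f : ∀ m → 0ℚ <ℚ f m
  0<f m = 0<* (subst (0ℚ <ℚ_) (ι-pred (t>0 m)) (0<ι (pred (t m)))) (0<inv! m)

  0≤g : ∀ m → 0ℚ ≤ℚ g m
  0≤g m = 0≤* (0≤ι (m !)) (0≤rec (pred (t m)))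

  0≤f : ∀ m → 0ℚ ≤ℚ f m
  0≤f m = <⇒≤ (0<f m)

  -- Multiplication by x^r/r!, read on coefficients: division by (r + j)! turns the binomial
  -- coefficient of `P-factorial` into the constant 1/r!.
  P-scaled : ∀ r j a b → ι (P r (r + j) a b) *ℚ inv! (r + j) ≡ inv! r *ℚ (ι (P 0 j a b) *ℚ inv! j)
  P-scaled r j a b = begin
    x *ℚ u
      ≡⟨ sym (trans (cong₂ (λ p q → x *ℚ u *ℚ (p *ℚ q)) (inv!-ι r) (inv!-ι j)) (*-identityʳ (x *ℚ u))) ⟩
    x *ℚ u *ℚ (inv! r *ℚ ι (r !) *ℚ (inv! j *ℚ ι (j !)))
      ≡⟨ l₁ x u (inv! r) (ι (r !)) (inv! j) (ι (j !)) ⟩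
    u *ℚ inv! r *ℚ inv! j *ℚ (x *ℚ (ι (r !) *ℚ ι (j !)))
      ≡⟨ cong (u *ℚ inv! r *ℚ inv! j *ℚ_) counted ⟩
    u *ℚ inv! r *ℚ inv! j *ℚ (ι ((r + j) !) *ℚ y)
      ≡⟨ l₂ u (inv! r) (inv! j) (ι ((r + j) !)) y ⟩
    u *ℚ ι ((r + j) !) *ℚ (inv! r *ℚ (y *ℚ inv! j))
      ≡⟨ trans (cong (_*ℚ (inv! r *ℚ (y *ℚ inv! j))) (inv!-ι (r + j))) (*-identityˡ _) ⟩
    inv! r *ℚ (y *ℚ inv! j) ∎
    where
    open ≡-Reasoning
    x = ι (P r (r + j) a b)
    y = ι (P 0 j a b)
    u = inv! (r + j)
    counted : x *ℚ (ι (r !) *ℚ ι (j !)) ≡ ι ((r + j) !) *ℚ y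
    counted = trans (cong (x *ℚ_) (sym (ι-* (r !) (j !)))) (trans (sym (ι-* (P r (r + j) a b) (r ! * j !)))
      (trans (cong ι (P-factorial r j a b)) (ι-* ((r + j) !) (P 0 j a b))))
    l₁ : ∀ x u a b c d → x *ℚ u *ℚ (a *ℚ b *ℚ (c *ℚ d)) ≡ u *ℚ a *ℚ c *ℚ (x *ℚ (b *ℚ d))
    l₁ = solve-∀ ring
    l₂ : ∀ u a c n y → u *ℚ a *ℚ c *ℚ (n *ℚ y) ≡ u *ℚ n *ℚ (a *ℚ (y *ℚ c))
    l₂ = solve-∀ ring

  -- The unsigned remainder of the truncated cosine (i odd) or sine (i even) series.
  w : ℕ → ℕ → ℚ
  w i m = ι (W i (pred m) 0 0) *ℚ inv! m

  0≤w : ∀ i m → 0ℚ ≤ℚ w i m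
  0≤w i m = 0≤* (0≤ι (W i (pred m) 0 0)) (<⇒≤ (0<inv! m))

  scaled-sum : ∀ x y r j → x + y ≡ P r (r + j) 0 1 →
               ι x *ℚ inv! (r + j) +ℚ ι y *ℚ inv! (r + j) ≡ inv! r *ℚ f j
  scaled-sum x y r j e = trans (sym (*-distribʳ-+ (inv! (r + j)) (ι x) (ι y)))
    (trans (cong (_*ℚ inv! (r + j)) (trans (sym (ι-+ x y)) (cong ι e))) (P-scaled r j 0 1))

  w-pair : ∀ i j → w (2 + i) (3 + i + j) +ℚ w i (3 + i + j) ≡ inv! (3 + i) *ℚ f j
  w-pair i j = scaled-sum (W (2 + i) (2 + i + j) 0 0) (W i (2 + i + j) 0 0) (3 + i) j (W-pair i (2 + i + j) (ℕ.m≤m+n (2 + i) j))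

  w-pair₁ : ∀ j → w 1 (2 + j) +ℚ f (2 + j) ≡ ½ *ℚ f j
  w-pair₁ j = scaled-sum (W 1 (1 + j) 0 0) (t (2 + j)) 2 j (W-pair₁ (1 + j) (s≤s z≤n))

  w-pair₀ : ∀ j → w 0 (1 + j) +ℚ f (1 + j) ≡ f j
  w-pair₀ j = trans (scaled-sum (W 0 j 0 0) (t (1 + j)) 1 j (W-pair₀ j)) (*-identityˡ (f j))

  summand-≤ : ∀ {x y z} → 0ℚ ≤ℚ x → x +ℚ y ≡ z → y ≤ℚ z
  summand-≤ {x} {y} 0≤x e = ≤-slack x 0≤x (trans (+-comm y x) e)

  f-antitone : ∀ j → f (1 + j) ≤ℚ f j
  f-antitone j = summand-≤ (0≤w 0 (1 + j)) (w-pair₀ j)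

  -- The relations for `w 1` and `w 3`, with both remainders nonnegative, give f_{j+4} ≥ f_{j+2}/2 -
  -- f_j/24. By induction f_j ≤ 3 f_{j+2}, so the right side is at least (3/8) f_{j+2}, which
  -- exceeds the required third.
  f-third : ∀ j → f j ≤ℚ ι 3 *ℚ f (2 + j)
  f-third zero = ≤-slack ½ (nonNegative⁻¹ ½) refl
  -- Equality: f_1 = 1 and f_3 = 1/3, so the constant 3 is the least possible.
  f-third (suc zero) = ≤-refl
  f-third (suc (suc j)) = ≤-slack
    (ι 3 *ℚ (inv! 4 *ℚ f j - w 1 (4 + j)) +ℚ inv! 4 *ℚ ι 3 *ℚ (ι 3 *ℚ f (2 + j) - f j) +ℚ inv! 4 *ℚ ι 3 *ℚ f (2 + j))
    (0≤+ (0≤+ (0≤* (0≤ι 3) (0≤-diff (summand-≤ (0≤w 3 (4 + j)) (w-pair 1 j))))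
              (0≤* (0≤* (<⇒≤ (0<inv! 4)) (0≤ι 3)) (0≤-diff (f-third j))))
         (0≤* (0≤* (<⇒≤ (0<inv! 4)) (0≤ι 3)) (0≤f (2 + j))))
    (trans (l (f (2 + j)) (f j) (w 1 (4 + j)))
           (cong (ι 3 *ℚ_) (trans (cong (_- w 1 (4 + j)) (sym (w-pair₁ (2 + j)))) (l′ (w 1 (4 + j)) (f (4 + j))))))
    where
    l : ∀ x y z → x +ℚ (ι 3 *ℚ (inv! 4 *ℚ y - z) +ℚ inv! 4 *ℚ ι 3 *ℚ (ι 3 *ℚ x - y) +ℚ inv! 4 *ℚ ι 3 *ℚ x) ≡ ι 3 *ℚ (½ *ℚ x - z)
    l = solve-∀ ring
    l′ : ∀ x y → (x +ℚ y) - x ≡ y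
    l′ = solve-∀ ring

  f-third₁ : ∀ j → f j ≤ℚ ι 3 *ℚ f (1 + j)
  f-third₁ j = ≤-trans (f-third j) (*-monoˡ (0≤ι 3) (f-antitone (1 + j)))

  -- f (m - k) / f m; for k > m the truncated subtraction makes the numerator f 0.
  F : ℕ → ℕ → ℚ
  F k m = f (m ∸ k) *ℚ g m

  0≤F : ∀ k m → 0ℚ ≤ℚ F k m
  0≤F k m = 0≤* (0≤f (m ∸ k)) (0≤g m)

  S : ℕ → ℚ
  S = F 2

  F-+ : ∀ k l m → F (k + l) m ≡ F k m *ℚ F l (m ∸ k)
  F-+ k l m = sym (trans (r (f (m ∸ k)) (g m) (f (m ∸ k ∸ l)) (g (m ∸ k)))
    (trans (cong (f (m ∸ k ∸ l) *ℚ g m *ℚ_) (f*g (m ∸ k))) (trans (*-identityʳ _) (cong (λ i → f i *ℚ g m) (ℕ.∸-+-assoc m k l)))))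
    where
    r : ∀ a b c d → a *ℚ b *ℚ (c *ℚ d) ≡ c *ℚ b *ℚ (a *ℚ d)
    r = solve-∀ ring

  S≤3 : ∀ m → S m ≤ℚ ι 3
  S≤3 m = ≤-trans (*-monoʳ (0≤g m) (bound m))
    (≤-reflexive (trans (*-assoc (ι 3) (f m) (g m)) (trans (cong (ι 3 *ℚ_) (f*g m)) (*-identityʳ (ι 3)))))
    where
    bound : ∀ m → f (m ∸ 2) ≤ℚ ι 3 *ℚ f m
    bound zero          = nonneg-≤ (0≤f 0)
      where
      nonneg-≤ : ∀ {x} → 0ℚ ≤ℚ x → x ≤ℚ ι 3 *ℚ x
      nonneg-≤ {x} 0≤x = ≤-slack (ι 2 *ℚ x) (0≤* (0≤ι 2) 0≤x) (r x)
        where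
        r : ∀ x → x +ℚ ι 2 *ℚ x ≡ ι 3 *ℚ x
        r = solve-∀ ring
    bound (suc zero)    = f-third₁ 0
    bound (suc (suc m)) = f-third m

open Coefficients

-- Convergence of the ratios through the cosine and sine series.

module Ratios where

  open import Data.Rational.Properties
  open import Tactic.RingSolver using (solve-∀)
  import Data.Nat.Properties as ℕ

  0≤½ : 0ℚ ≤ℚ ½
  0≤½ = nonNegative⁻¹ ½

  0≤inv! : ∀ n → 0ℚ ≤ℚ inv! n
  0≤inv! n = <⇒≤ (0<inv! n)

  dbl : ℕ → ℕ
  dbl zero    = zero
  dbl (suc n) = suc (suc (dbl n))

  dbl-mono : ∀ {m n} → m ≤ n → dbl m ≤ dbl n
  dbl-mono z≤n       = z≤n
  dbl-mono (s≤s m≤n) = s≤s (s≤s (dbl-mono m≤n))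

  module _ (e : ℕ) where

    private
      κ = inv! (3 + e)

    -- b is the remainder and T the term of a cosine (e = 1) or sine (e = 0) series: b 0 = T 0 - T 1 + … ± b i.
    T b : ℕ → ℕ → ℚ
    T i m = inv! (3 + (dbl i + e)) *ℚ F (2 + dbl i) m
    b i m = w (dbl i + e) m *ℚ g (m ∸ suc e)

    c : ℕ → ℚ
    c i = rec (4 + (dbl i + e)) *ℚ rec (3 + (dbl i + e))

    0≤c : ∀ i → 0ℚ ≤ℚ c i
    0≤c i = 0≤* (0≤rec (4 + (dbl i + e))) (0≤rec (3 + (dbl i + e)))

    -- Coarser than the true 1/20, but enough: with S ≤ 3 in both terms of the product estimate of
    -- `T-osc`, (1/12)(3 + 3) = 1/2, so each further term varies half as much.
    c≤ : ∀ i → c i ≤ℚ rec 2 *ℚ rec 3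
    c≤ i = *-mono (0≤rec (4 + (dbl i + e))) (0≤rec 3) (rec-antimono {2} {4 + (dbl i + e)} (s≤s (s≤s z≤n)))
      (rec-antimono {3} {3 + (dbl i + e)} (s≤s (s≤s (s≤s z≤n))))

    T-suc : ∀ i m → T (suc i) m ≡ c i *ℚ (S m *ℚ T i (m ∸ 2))
    T-suc i m = trans (cong (inv! (5 + (dbl i + e)) *ℚ_) (F-+ 2 (2 + dbl i) m))
      (l (rec (4 + (dbl i + e))) (rec (3 + (dbl i + e))) (inv! (3 + (dbl i + e))) (S m) (F (2 + dbl i) (m ∸ 2)))
      where
      l : ∀ x y z s u → x *ℚ (y *ℚ z) *ℚ (s *ℚ u) ≡ x *ℚ y *ℚ (s *ℚ (z *ℚ u))
      l = solve-∀ ring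

    0≤T : ∀ i m → 0ℚ ≤ℚ T i m
    0≤T i m = 0≤* (0≤inv! (3 + (dbl i + e))) (0≤F (2 + dbl i) m)

    T≤ : ∀ i m → T i m ≤ℚ ι 3 *ℚ κ *ℚ pow ½ i
    T≤ zero m = ≤-trans (*-monoˡ (0≤inv! (3 + e)) (S≤3 m)) (≤-reflexive (l κ))
      where
      l : ∀ k → k *ℚ ι 3 ≡ ι 3 *ℚ k *ℚ 1ℚ
      l = solve-∀ ring
    T≤ (suc i) m = ≤-trans (≤-reflexive (T-suc i m))
      (≤-trans (*-mono (0≤c i) (0≤* (0≤ι 3) (0≤* (0≤* (0≤ι 3) (0≤inv! (3 + e))) (0≤pow 0≤½ i))) (c≤ i)
                 (*-mono (0≤F 2 m) (0≤* (0≤* (0≤ι 3) (0≤inv! (3 + e))) (0≤pow 0≤½ i)) (S≤3 m) (T≤ i (m ∸ 2))))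
      (≤-slack (rec 3 *ℚ (ι 3 *ℚ κ *ℚ pow ½ i)) (0≤* (0≤rec 3) (0≤* (0≤* (0≤ι 3) (0≤inv! (3 + e))) (0≤pow 0≤½ i)))
               (l (ι 3 *ℚ κ *ℚ pow ½ i) κ (pow ½ i) refl)))
      where
      l : ∀ x k p → x ≡ ι 3 *ℚ k *ℚ p → rec 2 *ℚ rec 3 *ℚ (ι 3 *ℚ x) +ℚ rec 3 *ℚ x ≡ ι 3 *ℚ k *ℚ (½ *ℚ p)
      l _ k p refl = r k p
        where
        r : ∀ k p → rec 2 *ℚ rec 3 *ℚ (ι 3 *ℚ (ι 3 *ℚ k *ℚ p)) +ℚ rec 3 *ℚ (ι 3 *ℚ k *ℚ p) ≡ ι 3 *ℚ k *ℚ (½ *ℚ p)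
        r = solve-∀ ring

    0≤b : ∀ i m → 0ℚ ≤ℚ b i m
    0≤b i m = 0≤* (0≤w (dbl i + e) m) (0≤g (m ∸ suc e))

    b-suc : ∀ i m → 3 + (dbl i + e) ≤ m → b (suc i) m +ℚ b i m ≡ T i (m ∸ suc e)
    b-suc i m m≥ = begin
      w (2 + k) m *ℚ G +ℚ w k m *ℚ G
        ≡⟨ sym (*-distribʳ-+ G (w (2 + k) m) (w k m)) ⟩
      (w (2 + k) m +ℚ w k m) *ℚ G
        ≡⟨ cong (_*ℚ G) (trans (cong₂ (λ x y → w (2 + k) x +ℚ w k y) (sym split) (sym split)) (w-pair k (m ∸ (3 + k)))) ⟩
      inv! (3 + k) *ℚ f (m ∸ (3 + k)) *ℚ G
        ≡⟨ *-assoc (inv! (3 + k)) (f (m ∸ (3 + k))) G ⟩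
      inv! (3 + k) *ℚ (f (m ∸ (3 + k)) *ℚ G)
        ≡⟨ cong (λ j → inv! (3 + k) *ℚ (f j *ℚ G)) (trans (cong (m ∸_) index) (sym (ℕ.∸-+-assoc m (suc e) (2 + dbl i)))) ⟩
      T i (m ∸ suc e) ∎
      where
      open ≡-Reasoning
      k = dbl i + e
      G = g (m ∸ suc e)
      split : 3 + k + (m ∸ (3 + k)) ≡ m
      split = ℕ.m+[n∸m]≡n m≥
      index : 3 + k ≡ suc e + (2 + dbl i)
      index = trans (cong (3 +_) (ℕ.+-comm (dbl i) e)) (cong suc (trans (cong suc (sym (ℕ.+-suc e (dbl i)))) (sym (ℕ.+-suc e (suc (dbl i))))))

    module _ {D : ℚ} {N : ℕ} (0≤D : 0ℚ ≤ℚ D) (osc : ∀ m n → N ≤ m → N ≤ n → ∣ S m - S n ∣ ≤ℚ D) where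

      T-osc : ∀ i m n → N + dbl i ≤ m → N + dbl i ≤ n → ∣ T i m - T i n ∣ ≤ℚ κ *ℚ D *ℚ pow ½ i
      T-osc zero m n m≥ n≥ = ≤-trans (≤-reflexive (trans (cong ∣_∣ (l κ (S m) (S n))) (∣*∣-nonNeg (S m - S n) (0≤inv! (3 + e)))))
        (≤-trans (*-monoˡ (0≤inv! (3 + e)) (osc m n (ℕ.m+n≤o⇒m≤o N m≥) (ℕ.m+n≤o⇒m≤o N n≥))) (≤-reflexive (sym (*-identityʳ _))))
        where
        l : ∀ k x y → k *ℚ x - k *ℚ y ≡ k *ℚ (x - y)
        l = solve-∀ ring
      T-osc (suc i) m n m≥ n≥ = ≤-trans
        (≤-reflexive (trans (cong ∣_∣ (trans (cong₂ _-_ (T-suc i m) (T-suc i n)) (l₁ (c i) _ _)))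
                            (∣*∣-nonNeg (S m *ℚ T i (m ∸ 2) - S n *ℚ T i (n ∸ 2)) (0≤c i))))
        (≤-trans (*-mono (0≤c i) 0≤bound (c≤ i)
          (≤-trans (∣-∣-* (S m) (T i (m ∸ 2)) (S n) (T i (n ∸ 2)))
            (+-mono-≤ (*-mono (0≤∣p∣ (S m)) 0≤u (subst (_≤ℚ ι 3) (sym (0≤p⇒∣p∣≡p (0≤F 2 m))) (S≤3 m))
                         (T-osc i (m ∸ 2) (n ∸ 2) (shift m≥) (shift n≥)))
                      (*-mono (0≤∣p∣ (T i (n ∸ 2))) 0≤D (subst (_≤ℚ ι 3 *ℚ κ *ℚ pow ½ i) (sym (0≤p⇒∣p∣≡p (0≤T i (n ∸ 2)))) (T≤ i (n ∸ 2)))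
                         (osc m n (ℕ.m+n≤o⇒m≤o N m≥) (ℕ.m+n≤o⇒m≤o N n≥))))))
        (≤-reflexive (l₂ κ D (pow ½ i))))
        where
        0≤u : 0ℚ ≤ℚ κ *ℚ D *ℚ pow ½ i
        0≤u = 0≤* (0≤* (0≤inv! (3 + e)) 0≤D) (0≤pow 0≤½ i)
        0≤bound : 0ℚ ≤ℚ ι 3 *ℚ (κ *ℚ D *ℚ pow ½ i) +ℚ ι 3 *ℚ κ *ℚ pow ½ i *ℚ D
        0≤bound = 0≤+ (0≤* (0≤ι 3) 0≤u) (0≤* (0≤* (0≤* (0≤ι 3) (0≤inv! (3 + e))) (0≤pow 0≤½ i)) 0≤D)
        shift : ∀ {m} → N + dbl (suc i) ≤ m → N + dbl i ≤ m ∸ 2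
        shift {m} h = ℕ.m+n≤o⇒m≤o∸n (N + dbl i) (subst (_≤ m) (trans (cong (N +_) (ℕ.+-comm 2 (dbl i))) (sym (ℕ.+-assoc N (dbl i) 2))) h)
        l₁ : ∀ k x y → k *ℚ x - k *ℚ y ≡ k *ℚ (x - y)
        l₁ = solve-∀ ring
        l₂ : ∀ k d p → rec 2 *ℚ rec 3 *ℚ (ι 3 *ℚ (k *ℚ d *ℚ p) +ℚ ι 3 *ℚ k *ℚ p *ℚ d) ≡ k *ℚ d *ℚ (½ *ℚ p)
        l₂ = solve-∀ ring

      -- Unrolls b i = T i - b (i + 1) from `i` up to `z`, with `d` counting the steps left. The
      -- oscillations κ D 2^(-i) of the terms add up to at most 2 κ D 2^(-i). At `z` the remainder
      -- is not unrolled further: it lies between 0 and T z, hence varies by at most 3 κ 2^(-z).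
      b-osc : ∀ z d i → i + d ≡ z → ∀ m n → N + (3 + (dbl z + e)) ≤ m → N + (3 + (dbl z + e)) ≤ n →
              ∣ b i m - b i n ∣ ≤ℚ ι 2 *ℚ κ *ℚ D *ℚ pow ½ i +ℚ ι 3 *ℚ κ *ℚ pow ½ z
      b-osc z zero i e₀ m n m≥ n≥ = ≤-trans
        (∣-∣-within (0≤b i m) (0≤b i n) (b≤ m m≥) (b≤ n n≥))
        (≤-slack (ι 2 *ℚ κ *ℚ D *ℚ pow ½ i) (0≤* (0≤* (0≤* (0≤ι 2) (0≤inv! (3 + e))) 0≤D) (0≤pow 0≤½ i))
          (+-comm (ι 3 *ℚ κ *ℚ pow ½ z) (ι 2 *ℚ κ *ℚ D *ℚ pow ½ i)))
        where
        b≤ : ∀ m → N + (3 + (dbl z + e)) ≤ m → b i m ≤ℚ ι 3 *ℚ κ *ℚ pow ½ z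
        b≤ m m≥ = ≤-trans (summand-≤ (0≤b (suc i) m) (b-suc i m (subst (λ z → 3 + (dbl z + e) ≤ m) (trans (sym e₀) (ℕ.+-identityʳ i)) (ℕ.m+n≤o⇒n≤o N m≥))))
          (subst (λ z → T i (m ∸ suc e) ≤ℚ ι 3 *ℚ κ *ℚ pow ½ z) (trans (sym (ℕ.+-identityʳ i)) e₀) (T≤ i (m ∸ suc e)))
      b-osc z (suc d) i e₀ m n m≥ n≥ = ≤-trans
        (≤-reflexive (cong ∣_∣ (l₁ (b (suc i) m) (b i m) (b (suc i) n) (b i n))))
        (≤-trans (∣p-q∣≤∣p∣+∣q∣ (b (suc i) m +ℚ b i m - (b (suc i) n +ℚ b i n)) (b (suc i) m - b (suc i) n))
        (≤-trans (+-mono-≤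
          (subst₂ (λ x y → ∣ x - y ∣ ≤ℚ κ *ℚ D *ℚ pow ½ i) (sym (b-suc i m (relation m m≥))) (sym (b-suc i n (relation n n≥)))
            (T-osc i (m ∸ suc e) (n ∸ suc e) (shift m m≥) (shift n n≥)))
          (b-osc z d (suc i) (trans (sym (ℕ.+-suc i d)) e₀) m n m≥ n≥))
        (≤-reflexive (l₂ κ D (pow ½ i) (pow ½ z)))))
        where
        i≤z : i ≤ z
        i≤z = subst (i ≤_) e₀ (ℕ.m≤m+n i (suc d))
        relation : ∀ m → N + (3 + (dbl z + e)) ≤ m → 3 + (dbl i + e) ≤ m
        relation m h = ℕ.≤-trans (ℕ.+-monoʳ-≤ 3 (ℕ.+-monoˡ-≤ e (dbl-mono i≤z))) (ℕ.m+n≤o⇒n≤o N h)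
        shift : ∀ m → N + (3 + (dbl z + e)) ≤ m → N + dbl i ≤ m ∸ suc e
        shift m h = ℕ.m+n≤o⇒m≤o∸n (N + dbl i) (ℕ.≤-trans (ℕ.≤-reflexive (ℕ.+-assoc N (dbl i) (suc e)))
          (ℕ.≤-trans (ℕ.+-monoʳ-≤ N (ℕ.≤-trans (ℕ.≤-reflexive (ℕ.+-suc (dbl i) e)) (ℕ.≤-trans (s≤s (ℕ.+-monoˡ-≤ e (dbl-mono i≤z))) (ℕ.m≤n+m _ 2)))) h))
        l₁ : ∀ x y x′ y′ → y - y′ ≡ (x +ℚ y - (x′ +ℚ y′)) - (x - x′)
        l₁ = solve-∀ ring
        l₂ : ∀ k d p q → k *ℚ d *ℚ p +ℚ (ι 2 *ℚ k *ℚ d *ℚ (½ *ℚ p) +ℚ ι 3 *ℚ k *ℚ q) ≡ ι 2 *ℚ k *ℚ d *ℚ p +ℚ ι 3 *ℚ k *ℚ q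
        l₂ = solve-∀ ring

    head-osc : ∀ {D} → 0ℚ ≤ℚ D → Osc S D → ∀ z → Osc (λ m → w e m *ℚ g (m ∸ suc e)) (ι 2 *ℚ κ *ℚ D +ℚ ι 3 *ℚ κ *ℚ pow ½ z)
    head-osc {D} 0≤D (N , osc) z = N + (3 + (dbl z + e)) , λ m n m≥ n≥ → subst (λ B → ∣ b 0 m - b 0 n ∣ ≤ℚ B +ℚ ι 3 *ℚ κ *ℚ pow ½ z)
      (*-identityʳ (ι 2 *ℚ κ *ℚ D)) (b-osc 0≤D osc z z 0 refl m n m≥ n≥)

  osc-≤ : ∀ {x D E} → D ≤ℚ E → Osc x D → Osc x E
  osc-≤ D≤E (N , h) = N , λ m n m≥ n≥ → ≤-trans (h m n m≥ n≥) D≤E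

  q : ℕ → ℚ
  q m = f m *ℚ g (m ∸ 1)

  -- S m · (f m / f (m-2)) = 1, so differences of S are differences of f m / f (m-2) times S m S n.
  S-diff : ∀ m n → S (2 + m) - S (2 + n) ≡
    S (2 + m) *ℚ S (2 + n) *ℚ (w 1 (2 + m) *ℚ g m - w 1 (2 + n) *ℚ g n)
  S-diff m n = sym (begin
    S (2 + m) *ℚ S (2 + n) *ℚ (w 1 (2 + m) *ℚ g m - w 1 (2 + n) *ℚ g n)
      ≡⟨ cong (λ d → S (2 + m) *ℚ S (2 + n) *ℚ d) (cong₂ _-_ (w₁ m) (w₁ n)) ⟩
    S (2 + m) *ℚ S (2 + n) *ℚ (½ - r m - (½ - r n))
      ≡⟨ l (S (2 + m)) (S (2 + n)) (r m) (r n) ⟩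
    S (2 + m) *ℚ (S (2 + n) *ℚ r n) - S (2 + n) *ℚ (S (2 + m) *ℚ r m)
      ≡⟨ cong₂ (λ x y → S (2 + m) *ℚ x - S (2 + n) *ℚ y) (S*r n) (S*r m) ⟩
    S (2 + m) *ℚ 1ℚ - S (2 + n) *ℚ 1ℚ
      ≡⟨ cong₂ _-_ (*-identityʳ (S (2 + m))) (*-identityʳ (S (2 + n))) ⟩
    S (2 + m) - S (2 + n) ∎)
    where
    open ≡-Reasoning
    r : ℕ → ℚ
    r m = f (2 + m) *ℚ g m
    w₁ : ∀ m → w 1 (2 + m) *ℚ g m ≡ ½ - r m
    w₁ m = trans (l₁ (w 1 (2 + m)) (f (2 + m)) (g m))
      (cong (_- r m) (trans (cong (_*ℚ g m) (w-pair₁ m)) (trans (*-assoc ½ (f m) (g m)) (cong (½ *ℚ_) (f*g m)))))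
      where
      l₁ : ∀ x y z → x *ℚ z ≡ (x +ℚ y) *ℚ z - y *ℚ z
      l₁ = solve-∀ ring
    S*r : ∀ m → S (2 + m) *ℚ r m ≡ 1ℚ
    S*r m = trans (l₂ (f m) (g (2 + m)) (f (2 + m)) (g m)) (cong₂ _*ℚ_ (f*g m) (f*g (2 + m)))
      where
      l₂ : ∀ a b c d → a *ℚ b *ℚ (c *ℚ d) ≡ (a *ℚ d) *ℚ (c *ℚ b)
      l₂ = solve-∀ ring
    l : ∀ s u x y → s *ℚ u *ℚ (½ - x - (½ - y)) ≡ s *ℚ (u *ℚ y) - u *ℚ (s *ℚ x)
    l = solve-∀ ring

  -- Since 9 · 2/4! = 3/4 < 1, this contracts the oscillation up to an error that decays with z.
  S-contract : ∀ {D} → 0ℚ ≤ℚ D → Osc S D → ∀ z → Osc S (ι 9 *ℚ (ι 2 *ℚ inv! 4 *ℚ D +ℚ ι 3 *ℚ inv! 4 *ℚ pow ½ z))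
  S-contract {D} 0≤D osc z = let N , h = head-osc 1 0≤D osc z in 2 + N , go N h
    where
    B = ι 2 *ℚ inv! 4 *ℚ D +ℚ ι 3 *ℚ inv! 4 *ℚ pow ½ z
    0≤B : 0ℚ ≤ℚ B
    0≤B = 0≤+ (0≤* (0≤* (0≤ι 2) (0≤inv! 4)) 0≤D) (0≤* (0≤* (0≤ι 3) (0≤inv! 4)) (0≤pow 0≤½ z))
    go : ∀ N → (∀ m n → N ≤ m → N ≤ n → ∣ w 1 m *ℚ g (m ∸ 2) - w 1 n *ℚ g (n ∸ 2) ∣ ≤ℚ B) →
         ∀ m n → 2 + N ≤ m → 2 + N ≤ n → ∣ S m - S n ∣ ≤ℚ ι 9 *ℚ B
    go N h (suc (suc m)) (suc (suc n)) (s≤s (s≤s m≥)) (s≤s (s≤s n≥)) =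
      ≤-trans (≤-reflexive (trans (cong ∣_∣ (S-diff m n)) (∣*∣-nonNeg _ (0≤* (0≤F 2 (2 + m)) (0≤F 2 (2 + n))))))
        (*-mono (0≤* (0≤F 2 (2 + m)) (0≤F 2 (2 + n))) 0≤B
          (*-mono (0≤F 2 (2 + m)) (0≤ι 3) (S≤3 (2 + m)) (S≤3 (2 + n)))
          (h (2 + m) (2 + n) (ℕ.m≤n⇒m≤o+n 2 m≥) (ℕ.m≤n⇒m≤o+n 2 n≥)))

  0≤⅞ : 0ℚ ≤ℚ ⅞
  0≤⅞ = nonNegative⁻¹ ⅞

  ½≤⅞ : ½ ≤ℚ ⅞
  ½≤⅞ = ≤-slack (inv! 4 *ℚ ι 9) (0≤* (0≤inv! 4) (0≤ι 9)) refl

  -- Level `k + 1` cuts the series off at z = k and uses 2^(-k) ≤ (7/8)^k. The truncation error is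
  -- then at most 9 · 3/4! = 9/8 times (7/8)^k, which is one eighth of 9 (7/8)^k; this is why the
  -- amplitude is 9 although S ≤ 3.
  S-level : ∀ k → Osc S (ι 9 *ℚ pow ⅞ k)
  S-level zero = 0 , λ m n _ _ → ∣-∣-within (0≤F 2 m) (0≤F 2 n) (≤-trans (S≤3 m) 3≤9) (≤-trans (S≤3 n) 3≤9)
    where
    3≤9 : ι 3 ≤ℚ ι 9 *ℚ 1ℚ
    3≤9 = ≤-trans (ι-mono {3} {9} (s≤s (s≤s (s≤s z≤n)))) (≤-reflexive (sym (*-identityʳ (ι 9))))
  S-level (suc k) = osc-≤ (≤-trans
      (*-monoˡ (0≤ι 9) (+-monoʳ-≤ (ι 2 *ℚ inv! 4 *ℚ (ι 9 *ℚ pow ⅞ k)) (*-monoˡ (0≤* (0≤ι 3) (0≤inv! 4)) (pow-mono 0≤½ ½≤⅞ k))))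
      (≤-reflexive (l (pow ⅞ k))))
    (S-contract (0≤* (0≤ι 9) (0≤pow 0≤⅞ k)) (S-level k) k)
    where
    l : ∀ p → ι 9 *ℚ (ι 2 *ℚ inv! 4 *ℚ (ι 9 *ℚ p) +ℚ ι 3 *ℚ inv! 4 *ℚ p) ≡ ι 9 *ℚ (⅞ *ℚ p)
    l = solve-∀ ring

  cauchy-levels : ∀ {x} → (∀ k → Osc x (ι 9 *ℚ pow ⅞ k)) → Cauchy x
  cauchy-levels level .osc ε 0<ε =
    let δ , 0<δ , eδ = divide (ι 9) ε (0<ι 8) 0<ε
        k , h = ⅞^-small δ 0<δ
    in osc-≤ (≤-trans (*-monoˡ (0≤ι 9) h) (≤-reflexive eδ)) (level k)

  cauchy-S : Cauchy S
  cauchy-S = cauchy-levels S-level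

  cauchy-leaf : Cauchy (λ m → w 0 m *ℚ g (m ∸ 1))
  cauchy-leaf = cauchy-levels λ k → osc-≤ (≤-trans
      (+-monoʳ-≤ (ι 2 *ℚ inv! 3 *ℚ (ι 9 *ℚ pow ⅞ k)) (*-monoˡ (0≤* (0≤ι 3) (0≤inv! 3)) (pow-mono 0≤½ ½≤⅞ k)))
      -- With 1/3! in place of 1/4! the bound is 9 · 2/3! + 3/3! = 7/2, which leaves 11/2 up to 9.
      (≤-slack (ι 11 *ℚ ½ *ℚ pow ⅞ k) (0≤* (0≤* (0≤ι 11) 0≤½) (0≤pow 0≤⅞ k)) (l (pow ⅞ k))))
    (head-osc 0 (0≤* (0≤ι 9) (0≤pow 0≤⅞ k)) (S-level k) k)
    where
    l : ∀ p → ι 2 *ℚ inv! 3 *ℚ (ι 9 *ℚ p) +ℚ ι 3 *ℚ inv! 3 *ℚ p +ℚ ι 11 *ℚ ½ *ℚ p ≡ ι 9 *ℚ p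
    l = solve-∀ ring

  cauchy-q : Cauchy q
  cauchy-q = cauchy-cong 1 e (cauchy-minus (cauchy-const 1ℚ) cauchy-leaf)
    where
    e : ∀ m → 1 ≤ m → 1ℚ - w 0 m *ℚ g (m ∸ 1) ≡ q m
    e (suc m) _ = trans (cong (_- w 0 (suc m) *ℚ g m) (sym (trans (cong (_*ℚ g m) (w-pair₀ m)) (f*g m))))
      (l (w 0 (suc m)) (f (suc m)) (g m))
      where
      l : ∀ x y z → (x +ℚ y) *ℚ z - x *ℚ z ≡ y *ℚ z
      l = solve-∀ ring

  -- `F 1 m` is the reciprocal of `q m`; written as a product it is Cauchy without an argument about
  -- reciprocals of Cauchy sequences.
  F₁ : ∀ m → S m *ℚ q (m ∸ 1) ≡ F 1 m
  F₁ m = trans (l (f (m ∸ 2)) (g m) (f (m ∸ 1)) (g (m ∸ 1 ∸ 1)))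
    (trans (cong (F 1 m *ℚ_) (trans (cong (λ i → f i *ℚ g (m ∸ 1 ∸ 1)) (sym (ℕ.∸-+-assoc m 1 1))) (f*g (m ∸ 1 ∸ 1)))) (*-identityʳ (F 1 m)))
    where
    l : ∀ a b c d → a *ℚ b *ℚ (c *ℚ d) ≡ c *ℚ b *ℚ (a *ℚ d)
    l = solve-∀ ring

  cauchy-F : ∀ k → Cauchy (F k)
  cauchy-F zero = cauchy-cong 0 (λ m _ → sym (f*g m)) (cauchy-const 1ℚ)
  cauchy-F (suc k) = cauchy-cong 0 (λ m _ → sym (F-+ 1 k m))
    (cauchy-* (cauchy-cong 0 (λ m _ → F₁ m) (cauchy-* cauchy-S (cauchy-∸ 1 cauchy-q))) (cauchy-∸ 1 (cauchy-F k)))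

  -- Induction in steps of two: the pair relations express each remainder through a ratio `F` and
  -- the remainder two indices lower, starting from the sine for even `i` and the cosine for odd
  -- `i`.
  cauchy-w : ∀ i → Cauchy (λ m → w i m *ℚ g (m ∸ 1))
  cauchy-w zero = cauchy-leaf
  cauchy-w (suc zero) = cauchy-cong 2 e (cauchy-minus (cauchy-* (cauchy-const ½) (cauchy-∸ 1 (cauchy-F 1))) cauchy-q)
    where
    e : ∀ m → 2 ≤ m → ½ *ℚ F 1 (m ∸ 1) - q m ≡ w 1 m *ℚ g (m ∸ 1)
    e (suc zero) (s≤s ())
    e (suc (suc m)) _ = trans (cong (_- q (2 + m)) (trans (sym (*-assoc ½ (f m) (g (1 + m)))) (cong (_*ℚ g (1 + m)) (sym (w-pair₁ m)))))
      (l (w 1 (2 + m)) (f (2 + m)) (g (1 + m)))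
      where
      l : ∀ x y z → (x +ℚ y) *ℚ z - y *ℚ z ≡ x *ℚ z
      l = solve-∀ ring
  cauchy-w (suc (suc i)) = cauchy-cong (3 + i) e
    (cauchy-minus (cauchy-* (cauchy-const (inv! (3 + i))) (cauchy-∸ 1 (cauchy-F (2 + i)))) (cauchy-w i))
    where
    e′ : ∀ m j → 3 + i + j ≡ m → inv! (3 + i) *ℚ (f (m ∸ 1 ∸ (2 + i)) *ℚ g (m ∸ 1)) - w i m *ℚ g (m ∸ 1) ≡ w (2 + i) m *ℚ g (m ∸ 1)
    e′ _ j refl = trans (cong (_- w i m *ℚ G) (trans (cong (λ k → inv! (3 + i) *ℚ (f k *ℚ G)) (ℕ.m+n∸m≡n (2 + i) j))
        (trans (sym (*-assoc (inv! (3 + i)) (f j) G)) (cong (_*ℚ G) (sym (w-pair i j))))))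
      (l (w (2 + i) m) (w i m) G)
      where
      m = 3 + i + j
      G = g (2 + i + j)
      l : ∀ x y z → (x +ℚ y) *ℚ z - y *ℚ z ≡ x *ℚ z
      l = solve-∀ ring
    e : ∀ m → 3 + i ≤ m → inv! (3 + i) *ℚ F (2 + i) (m ∸ 1) - w i m *ℚ g (m ∸ 1) ≡ w (2 + i) m *ℚ g (m ∸ 1)
    e m m≥ = e′ m (m ∸ (3 + i)) (ℕ.m+[n∸m]≡n m≥)

open Ratios

-- The limits of the probabilities and the bound on large subtrees.

module Limits where

  open import Data.List using (length)
  open import Data.Rational.Properties
  open import Tactic.RingSolver using (solve-∀)
  import Data.Nat.Properties as ℕ

  cancel : ∀ {p q c} → 0ℚ <ℚ c → p *ℚ c ≡ q *ℚ c → p ≡ q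
  cancel {c = c} 0<c e = ≤-antisym (*-cancelʳ-≤-pos c {{positive 0<c}} (≤-reflexive e))
                                   (*-cancelʳ-≤-pos c {{positive 0<c}} (≤-reflexive (sym e)))

  0<ι′ : ∀ {n} → 1 ≤ n → 0ℚ <ℚ ι n
  0<ι′ {suc n} _ = 0<ι n

  frac-ι : ∀ a {b} → 1 ≤ b → frac a b *ℚ ι b ≡ ι a
  frac-ι a {suc b} _ = frac-* a b

  V-ι : ∀ n i → V (suc n) (suc i) *ℚ ι (suc n * t (suc n)) ≡ ι (t (suc i) * W i (suc n) 0 0)
  V-ι n i = subst (λ l → frac (countPairs (suc n) (suc i)) (suc n * l) *ℚ ι (suc n * t (suc n)) ≡ ι (t (suc i) * W i (suc n) 0 0))
    (sym (count-trees n)) (trans (frac-ι (countPairs (suc n) (suc i)) (ℕ.*-mono-≤ {1} {suc n} (s≤s z≤n) (t>0 (suc n))))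
                                 (cong ι (count-pairs n i)))

  rec-shift : ∀ n → ι (2 + n) *ℚ rec n ≡ 1ℚ +ℚ rec n
  rec-shift n = trans (l (rec n) (ι (suc n))) (cong (_+ℚ rec n) (rec-ι n))
    where
    l : ∀ r x → (1ℚ +ℚ x) *ℚ r ≡ r *ℚ x +ℚ r
    l = solve-∀ ring

  -- On n vertices `w` carries the divisor (n + 1)!, whereas the number of pairs is n · t_n. The
  -- quotient leaves the factor (n + 1)/n, which for `suc n` vertices is `1ℚ +ℚ rec n`.
  V-formula : ∀ n i → V (suc n) (suc i) ≡ ι (t (suc i)) *ℚ (w i (2 + n) *ℚ g (suc n)) *ℚ (1ℚ +ℚ rec n)
  V-formula n i = cancel (0<ι′ (ℕ.*-mono-≤ {1} {suc n} (s≤s z≤n) (t>0 (suc n)))) (trans (V-ι n i) (sym (begin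
    τ *ℚ (Wn *ℚ (rec (suc n) *ℚ inv! (suc n)) *ℚ (ι (suc n !) *ℚ rec (pred (t (suc n))))) *ℚ (1ℚ +ℚ rec n) *ℚ ι (suc n * t (suc n))
      ≡⟨ cong₂ (λ x y → τ *ℚ (Wn *ℚ (rec (suc n) *ℚ inv! (suc n)) *ℚ (ι (suc n !) *ℚ rec (pred (t (suc n))))) *ℚ x *ℚ y)
           (sym (rec-shift n)) (ι-* (suc n) (t (suc n))) ⟩
    τ *ℚ (Wn *ℚ (rec (suc n) *ℚ inv! (suc n)) *ℚ (ι (suc n !) *ℚ rec (pred (t (suc n))))) *ℚ (ι (2 + n) *ℚ rec n) *ℚ (ι (suc n) *ℚ ι (t (suc n)))
      ≡⟨ l τ Wn (rec (suc n)) (inv! (suc n)) (ι (suc n !)) (rec (pred (t (suc n)))) (ι (2 + n)) (rec n) (ι (suc n)) (ι (t (suc n))) ⟩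
    τ *ℚ Wn *ℚ (rec (suc n) *ℚ ι (2 + n)) *ℚ (inv! (suc n) *ℚ ι (suc n !)) *ℚ (rec (pred (t (suc n))) *ℚ ι (t (suc n))) *ℚ (rec n *ℚ ι (suc n))
      ≡⟨ cong₂ _*ℚ_ (cong₂ _*ℚ_ (cong₂ (λ x y → τ *ℚ Wn *ℚ x *ℚ y) (rec-ι (suc n)) (inv!-ι (suc n)))
           (trans (cong (rec (pred (t (suc n))) *ℚ_) (sym (ι-pred (t>0 (suc n))))) (rec-ι (pred (t (suc n)))))) (rec-ι n) ⟩
    τ *ℚ Wn *ℚ 1ℚ *ℚ 1ℚ *ℚ 1ℚ *ℚ 1ℚ
      ≡⟨ l′ τ Wn ⟩
    τ *ℚ Wn
      ≡⟨ sym (ι-* (t (suc i)) (W i (suc n) 0 0)) ⟩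
    ι (t (suc i) * W i (suc n) 0 0) ∎)))
    where
    open ≡-Reasoning
    τ = ι (t (suc i))
    Wn = ι (W i (suc n) 0 0)
    l : ∀ a b c d e f x y z u → a *ℚ (b *ℚ (c *ℚ d) *ℚ (e *ℚ f)) *ℚ (x *ℚ y) *ℚ (z *ℚ u)
      ≡ a *ℚ b *ℚ (c *ℚ x) *ℚ (d *ℚ e) *ℚ (f *ℚ u) *ℚ (y *ℚ z)
    l = solve-∀ ring
    l′ : ∀ a b → a *ℚ b *ℚ 1ℚ *ℚ 1ℚ *ℚ 1ℚ *ℚ 1ℚ ≡ a *ℚ b
    l′ = solve-∀ ring

  cauchy-V : ∀ i → Cauchy (λ n → V n (suc i))
  cauchy-V i = cauchy-cong 1 formula (cauchy-* (cauchy-* (cauchy-const (ι (t (suc i)))) (cauchy-suc (cauchy-w i)))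
                                               (cauchy-+ (cauchy-const 1ℚ) (cauchy-∸ 1 cauchy-rec)))
    where
    formula : ∀ n → 1 ≤ n → ι (t (suc i)) *ℚ (w i (suc n) *ℚ g n) *ℚ (1ℚ +ℚ rec (n ∸ 1)) ≡ V n (suc i)
    formula (suc n) _ = sym (V-formula n i)

  -- e n = [xⁿ] φ, and e⁻ n is its inverse.
  e e⁻ : ℕ → ℚ
  e n = ι (t (suc n)) *ℚ inv! n
  e⁻ n = g (suc n) *ℚ rec n

  e-f : ∀ n → e n ≡ f (suc n) *ℚ ι (suc n)
  e-f n = sym (trans (l (ι (t (suc n))) (rec n) (inv! n) (ι (suc n))) (trans (cong (e n *ℚ_) (rec-ι n)) (*-identityʳ (e n))))
    where
    l : ∀ x r v y → x *ℚ (r *ℚ v) *ℚ y ≡ x *ℚ v *ℚ (r *ℚ y)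
    l = solve-∀ ring

  e*e⁻ : ∀ n → e n *ℚ e⁻ n ≡ 1ℚ
  e*e⁻ n = trans (cong (_*ℚ e⁻ n) (e-f n)) (trans (l (f (suc n)) (ι (suc n)) (g (suc n)) (rec n)) (cong₂ _*ℚ_ (f*g (suc n)) (rec-ι n)))
    where
    l : ∀ a b c d → a *ℚ b *ℚ (c *ℚ d) ≡ a *ℚ c *ℚ (d *ℚ b)
    l = solve-∀ ring

  0≤e : ∀ n → 0ℚ ≤ℚ e n
  0≤e n = 0≤* (0≤ι (t (suc n))) (0≤inv! n)

  0≤e⁻ : ∀ n → 0ℚ ≤ℚ e⁻ n
  0≤e⁻ n = 0≤* (0≤g (suc n)) (0≤rec n)

  Z : ℕ → ℕ → ℚ
  Z k n = e n *ℚ e⁻ (n ∸ k)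

  Z-+ : ∀ k l n → Z (k + l) n ≡ Z k n *ℚ Z l (n ∸ k)
  Z-+ k l n = sym (trans (r (e n) (e⁻ (n ∸ k)) (e (n ∸ k)) (e⁻ (n ∸ k ∸ l)))
    (trans (cong (e n *ℚ e⁻ (n ∸ k ∸ l) *ℚ_) (e*e⁻ (n ∸ k))) (trans (*-identityʳ _) (cong (λ i → e n *ℚ e⁻ i) (ℕ.∸-+-assoc n k l)))))
    where
    r : ∀ a b c d → a *ℚ b *ℚ (c *ℚ d) ≡ a *ℚ d *ℚ (c *ℚ b)
    r = solve-∀ ring

  Z-e : ∀ k n → Z k n *ℚ e (n ∸ k) ≡ e n
  Z-e k n = trans (*-assoc (e n) (e⁻ (n ∸ k)) (e (n ∸ k)))
    (trans (cong (e n *ℚ_) (trans (*-comm (e⁻ (n ∸ k)) (e (n ∸ k))) (e*e⁻ (n ∸ k)))) (*-identityʳ (e n)))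

  Z₁ : ∀ n → Z 1 (suc n) ≡ q (2 + n) *ℚ (1ℚ +ℚ rec n)
  Z₁ n = trans (cong (_*ℚ e⁻ n) (e-f (suc n))) (trans (l (f (2 + n)) (ι (2 + n)) (g (suc n)) (rec n)) (cong (q (2 + n) *ℚ_) (rec-shift n)))
    where
    l : ∀ a b c d → a *ℚ b *ℚ (c *ℚ d) ≡ a *ℚ c *ℚ (b *ℚ d)
    l = solve-∀ ring

  cauchy-Z : ∀ k → Cauchy (Z k)
  cauchy-Z zero = cauchy-cong 0 (λ n _ → sym (e*e⁻ n)) (cauchy-const 1ℚ)
  cauchy-Z (suc k) = cauchy-cong 0 (λ n _ → sym (Z-+ 1 k n)) (cauchy-* cauchy-Z₁ (cauchy-∸ 1 (cauchy-Z k)))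
    where
    formula : ∀ n → 1 ≤ n → q (suc n) *ℚ (1ℚ +ℚ rec (n ∸ 1)) ≡ Z 1 n
    formula (suc n) _ = sym (Z₁ n)
    cauchy-Z₁ : Cauchy (Z 1)
    cauchy-Z₁ = cauchy-cong 1 formula
      (cauchy-* (cauchy-suc cauchy-q) (cauchy-+ (cauchy-const 1ℚ) (cauchy-∸ 1 cauchy-rec)))

  ⅓≤Z₁ : ∀ n → rec 2 ≤ℚ Z 1 n
  ⅓≤Z₁ zero = ≤-trans (rec-antimono {0} {2} z≤n) (≤-reflexive (sym (e*e⁻ 0)))
  ⅓≤Z₁ (suc n) = ≤-trans (≤-trans lower (≤-slack (q (2 + n) *ℚ rec n) (0≤* (0≤* (0≤f (2 + n)) (0≤g (suc n))) (0≤rec n)) (l (q (2 + n)) (rec n))))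
    (≤-reflexive (sym (Z₁ n)))
    where
    l : ∀ x r → x +ℚ x *ℚ r ≡ x *ℚ (1ℚ +ℚ r)
    l = solve-∀ ring
    l′ : ∀ a c → rec 2 *ℚ (ι 3 *ℚ a *ℚ c) ≡ a *ℚ c
    l′ = solve-∀ ring
    lower : rec 2 ≤ℚ q (2 + n)
    lower = ≤-trans (≤-reflexive (trans (sym (*-identityʳ (rec 2))) (cong (rec 2 *ℚ_) (sym (f*g (suc n))))))
      (≤-trans (*-monoˡ (0≤rec 2) (*-monoʳ (0≤g (suc n)) (f-third₁ (suc n)))) (≤-reflexive (l′ (f (2 + n)) (g (suc n)))))

  Z-lower : ∀ k n → pow (rec 2) k ≤ℚ Z k n
  Z-lower zero n = ≤-reflexive (sym (e*e⁻ n))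
  Z-lower (suc k) n = ≤-trans (*-mono (0≤rec 2) (0≤* (0≤e (n ∸ 1)) (0≤e⁻ (n ∸ 1 ∸ k))) (⅓≤Z₁ n) (Z-lower k (n ∸ 1)))
    (≤-reflexive (sym (Z-+ 1 k n)))

  -- Z_k is Cauchy and at least δ = 3^(-k). Beyond an N after which it varies by at most δ/2, the
  -- choice K = Z_k(N) + δ/2 gives Z_k(n) ≤ K ≤ Z_k(n) + δ ≤ 2 Z_k(n). A rational `K` thus replaces
  -- the irrational limit (2/π)^k.
  regular : ∀ k → ∃[ K ] (0ℚ ≤ℚ K × ∃[ N ] (∀ n → N ≤ n → e n ≤ℚ K *ℚ e (n ∸ k) × K *ℚ e (n ∸ k) ≤ℚ ι 2 *ℚ e n))
  regular k =
    let N , close = osc (cauchy-Z k) (½ *ℚ δ) (0<½* 0<δ)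
    in Z k N +ℚ ½ *ℚ δ , 0≤+ (0≤* (0≤e N) (0≤e⁻ (N ∸ k))) (<⇒≤ (0<½* 0<δ)) , N , λ n N≤n →
       bounds N n (close n N N≤n ℕ.≤-refl) (close N n ℕ.≤-refl N≤n)
    where
    δ = pow (rec 2) k
    0<δ : 0ℚ <ℚ δ
    0<δ = 0<pow (0<rec 2) k
    l₁ : ∀ x y → x ≡ y +ℚ (x - y)
    l₁ = solve-∀ ring
    l₂ : ∀ x d → x +ℚ ½ *ℚ d +ℚ ½ *ℚ d ≡ x +ℚ d
    l₂ = solve-∀ ring
    l₃ : ∀ x → x +ℚ x ≡ ι 2 *ℚ x
    l₃ = solve-∀ ring
    upper : ∀ {x y} → ∣ x - y ∣ ≤ℚ ½ *ℚ δ → x ≤ℚ y +ℚ ½ *ℚ δ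
    upper {x} {y} h = ≤-trans (≤-reflexive (l₁ x y)) (+-monoʳ-≤ y (≤-trans (p≤∣p∣ (x - y)) h))
    bounds : ∀ N n → ∣ Z k n - Z k N ∣ ≤ℚ ½ *ℚ δ → ∣ Z k N - Z k n ∣ ≤ℚ ½ *ℚ δ →
      e n ≤ℚ (Z k N +ℚ ½ *ℚ δ) *ℚ e (n ∸ k) × (Z k N +ℚ ½ *ℚ δ) *ℚ e (n ∸ k) ≤ℚ ι 2 *ℚ e n
    bounds N n h h′ = ≤-trans (≤-reflexive (sym (Z-e k n))) (*-monoʳ (0≤e (n ∸ k)) (upper {Z k n} {Z k N} h)) ,
      ≤-trans (*-monoʳ (0≤e (n ∸ k)) (≤-trans (+-monoˡ-≤ (½ *ℚ δ) (upper {Z k N} {Z k n} h′))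
        (≤-trans (≤-reflexive (l₂ (Z k n) δ)) (≤-trans (+-monoʳ-≤ (Z k n) (Z-lower k n)) (≤-reflexive (l₃ (Z k n)))))))
      (≤-reflexive (trans (*-assoc (ι 2) (Z k n) (e (n ∸ k))) (cong (ι 2 *ℚ_) (Z-e k n))))

  P-e : ∀ k j → ι (P k (k + j) 1 0) *ℚ inv! (k + j) ≡ inv! k *ℚ e j
  P-e k j = trans (P-scaled k j 1 0) (cong (λ m → inv! k *ℚ (ι m *ℚ inv! j)) (t-suc j))

  t-bound : ∀ {K} k i → k ≤ i → e i ≤ℚ K *ℚ e (i ∸ k) → ι (t (suc i)) ≤ℚ K *ℚ ι (k !) *ℚ ι (P k i 1 0)
  t-bound {K} k i k≤i h = *-cancelʳ-≤-pos (inv! i) {{positive (0<inv! i)}} (≤-trans h (≤-reflexive (sym (begin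
    K *ℚ ι (k !) *ℚ ι (P k i 1 0) *ℚ inv! i
      ≡⟨ *-assoc (K *ℚ ι (k !)) (ι (P k i 1 0)) (inv! i) ⟩
    K *ℚ ι (k !) *ℚ (ι (P k i 1 0) *ℚ inv! i)
      ≡⟨ cong (K *ℚ ι (k !) *ℚ_) (trans (cong (λ m → ι (P k m 1 0) *ℚ inv! m) (sym (ℕ.m+[n∸m]≡n k≤i))) (P-e k (i ∸ k))) ⟩
    K *ℚ ι (k !) *ℚ (inv! k *ℚ e (i ∸ k))
      ≡⟨ l K (ι (k !)) (inv! k) (e (i ∸ k)) ⟩
    K *ℚ e (i ∸ k) *ℚ (inv! k *ℚ ι (k !))
      ≡⟨ trans (cong (K *ℚ e (i ∸ k) *ℚ_) (inv!-ι k)) (*-identityʳ _) ⟩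
    K *ℚ e (i ∸ k) ∎))))
    where
    open ≡-Reasoning
    l : ∀ a b c d → a *ℚ b *ℚ (c *ℚ d) ≡ a *ℚ d *ℚ (c *ℚ b)
    l = solve-∀ ring

  ∑-≤ : ∀ n {a b C} → (∀ i → ι (a i) ≤ℚ C *ℚ ι (b i)) → ι (∑ n a) ≤ℚ C *ℚ ι (∑ n b)
  ∑-≤ zero {C = C} h = ≤-reflexive (sym (*-zeroʳ C))
  ∑-≤ (suc n) {a} {b} {C} h = ≤-trans (≤-reflexive (ι-+ (a 0) _))
    (≤-trans (+-mono-≤ (h 0) (∑-≤ n {λ i → a (suc i)} {λ i → b (suc i)} {C} (λ i → h (suc i))))
    (≤-reflexive (trans (sym (*-distribˡ-+ C (ι (b 0)) (ι (∑ n (λ i → b (suc i)))))) (cong (C *ℚ_) (sym (ι-+ (b 0) _))))))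

  -- Each t_{i+1} is replaced by K k! times the weight `P k i 1 0`, and the sum, extended to all
  -- sizes, is evaluated by `W-convolution`. The gain 1/(k + 1) is k!/(k + 1)!, since the weights
  -- have index k and the total has index k + 1. The second bound on `K` removes it again at the
  -- cost of the factor 2.
  tail-bound : ∀ {K} k R l j → k ≤ R → 0ℚ ≤ℚ K → R + l ≡ suc (k + j) →
    (∀ i → R ≤ i → e i ≤ℚ K *ℚ e (i ∸ k)) → K *ℚ e j ≤ℚ ι 2 *ℚ e (k + j) →
    ι (∑ l (λ i → t (suc (R + i)) * W (R + i) (suc (k + j)) 0 0)) ≤ℚ ι 2 *ℚ rec k *ℚ ι (suc (k + j) * t (suc (k + j)))
  tail-bound {K} k R l j k≤R 0≤K n≡ upper lower = *-cancelʳ-≤-pos (inv! n) {{positive (0<inv! n)}} (begin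
    ι (∑ l (λ i → t (suc (R + i)) * W (R + i) n 0 0)) *ℚ inv! n
      ≤⟨ *-monoʳ (0≤inv! n) (∑-≤ l {C = C} term) ⟩
    C *ℚ ι (∑ l (λ i → P k (R + i) 1 0 * W (R + i) n 0 0)) *ℚ inv! n
      ≤⟨ *-monoʳ (0≤inv! n) (*-monoˡ (0≤* 0≤K (0≤ι (k !))) (ι-mono whole)) ⟩
    C *ℚ ι (P (suc k) n 1 0) *ℚ inv! n
      ≡⟨ trans (*-assoc C _ _) (cong (C *ℚ_) (P-e (suc k) j)) ⟩
    K *ℚ ι (k !) *ℚ (rec k *ℚ inv! k *ℚ e j)
      ≡⟨ r₁ K (ι (k !)) (rec k) (inv! k) (e j) ⟩
    rec k *ℚ (K *ℚ e j) *ℚ (inv! k *ℚ ι (k !))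
      ≡⟨ trans (cong (rec k *ℚ (K *ℚ e j) *ℚ_) (inv!-ι k)) (*-identityʳ _) ⟩
    rec k *ℚ (K *ℚ e j)
      ≤⟨ *-monoˡ (0≤rec k) lower ⟩
    rec k *ℚ (ι 2 *ℚ (ι (t n) *ℚ inv! (k + j)))
      ≡⟨ trans (sym (*-identityʳ _)) (cong (rec k *ℚ (ι 2 *ℚ (ι (t n) *ℚ inv! (k + j))) *ℚ_) (sym (rec-ι (k + j)))) ⟩
    rec k *ℚ (ι 2 *ℚ (ι (t n) *ℚ inv! (k + j))) *ℚ (rec (k + j) *ℚ ι n)
      ≡⟨ r₂ (rec k) (ι 2) (ι (t n)) (inv! (k + j)) (rec (k + j)) (ι n) ⟩
    ι 2 *ℚ rec k *ℚ (ι n *ℚ ι (t n)) *ℚ inv! n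
      ≡⟨ cong (λ x → ι 2 *ℚ rec k *ℚ x *ℚ inv! n) (sym (ι-* n (t n))) ⟩
    ι 2 *ℚ rec k *ℚ ι (n * t n) *ℚ inv! n ∎)
    where
    open ≤-Reasoning
    n = suc (k + j)
    C = K *ℚ ι (k !)
    r₁ : ∀ a b c d x → a *ℚ b *ℚ (c *ℚ d *ℚ x) ≡ c *ℚ (a *ℚ x) *ℚ (d *ℚ b)
    r₁ = solve-∀ ring
    r₂ : ∀ a b c d x y → a *ℚ (b *ℚ (c *ℚ d)) *ℚ (x *ℚ y) ≡ b *ℚ a *ℚ (y *ℚ c) *ℚ (x *ℚ d)
    r₂ = solve-∀ ring
    term : ∀ i → ι (t (suc (R + i)) * W (R + i) n 0 0) ≤ℚ C *ℚ ι (P k (R + i) 1 0 * W (R + i) n 0 0)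
    term i = ≤-trans (≤-reflexive (ι-* (t (suc (R + i))) (W (R + i) n 0 0)))
      (≤-trans (*-monoʳ (0≤ι (W (R + i) n 0 0)) (t-bound {K} k (R + i) (ℕ.≤-trans k≤R (ℕ.m≤m+n R i)) (upper (R + i) (ℕ.m≤m+n R i))))
      (≤-reflexive (trans (*-assoc C _ _) (cong (C *ℚ_) (sym (ι-* (P k (R + i) 1 0) (W (R + i) n 0 0)))))))
    whole : ∑ l (λ i → P k (R + i) 1 0 * W (R + i) n 0 0) ≤ P (suc k) n 1 0
    whole = ℕ.≤-trans (ℕ.m≤n+m _ (∑ R (λ i → P k i 1 0 * W i n 0 0))) (ℕ.≤-reflexive
      (trans (sym (∑-split R l (λ i → P k i 1 0 * W i n 0 0))) (W-convolution n (R + l) k 0 0 (ℕ.≤-reflexive (sym n≡)))))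

  partialSum-ι : ∀ n R → partialSum (suc n) R *ℚ ι (suc n * t (suc n)) ≡ ι (∑ R (λ i → t (suc i) * W i (suc n) 0 0))
  partialSum-ι n zero = *-zeroˡ (ι (suc n * t (suc n)))
  partialSum-ι n (suc R) = trans (*-distribʳ-+ (ι (suc n * t (suc n))) (partialSum (suc n) R) (V (suc n) (suc R)))
    (trans (cong₂ _+ℚ_ (partialSum-ι n R) (V-ι n R))
    (trans (sym (ι-+ (∑ R a) (a R))) (cong ι (sym (∑-last R a)))))
    where
    a : ℕ → ℕ
    a i = t (suc i) * W i (suc n) 0 0

  -- By `total-pairs` the sizes 1, ..., n + 1 account for all pairs, so only the `l` sizes above `R`
  -- survive the subtraction.
  partialSum-tail : ∀ n R l → R + l ≡ suc n →
    (1ℚ - partialSum (suc n) R) *ℚ ι (suc n * t (suc n)) ≡ ι (∑ l (λ i → t (suc (R + i)) * W (R + i) (suc n) 0 0))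
  partialSum-tail n R l n≡ = begin
    (1ℚ - partialSum (suc n) R) *ℚ ι N
      ≡⟨ r₁ (partialSum (suc n) R) (ι N) ⟩
    ι N - partialSum (suc n) R *ℚ ι N
      ≡⟨ cong₂ (λ x y → ι x - y) (trans (sym (total-pairs n)) (trans (cong (λ m → ∑ m a) (sym n≡)) (∑-split R l a))) (partialSum-ι n R) ⟩
    ι (∑ R a + ∑ l (λ i → a (R + i))) - ι (∑ R a)
      ≡⟨ trans (cong (_- ι (∑ R a)) (ι-+ (∑ R a) _)) (r₂ (ι (∑ R a)) _) ⟩
    ι (∑ l (λ i → a (R + i))) ∎
    where
    open ≡-Reasoning
    N = suc n * t (suc n)
    a : ℕ → ℕ
    a i = t (suc i) * W i (suc n) 0 0
    r₁ : ∀ p x → (1ℚ - p) *ℚ x ≡ x - p *ℚ x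
    r₁ = solve-∀ ring
    r₂ : ∀ x y → (x +ℚ y) - x ≡ y
    r₂ = solve-∀ ring

  near-one : ∀ {K} k R n → k ≤ R → R ≤ n → 0ℚ ≤ℚ K → (∀ i → R ≤ i → e i ≤ℚ K *ℚ e (i ∸ k) × K *ℚ e (i ∸ k) ≤ℚ ι 2 *ℚ e i) →
    ∣ 1ℚ - partialSum (suc n) R ∣ ≤ℚ ι 2 *ℚ rec k
  near-one {K} k R n k≤R R≤n 0≤K h = subst (_≤ℚ ι 2 *ℚ rec k) (sym (0≤p⇒∣p∣≡p 0≤x))
    (*-cancelʳ-≤-pos (ι N) {{positive 0<N}} (≤-trans (≤-reflexive x≡) bound))
    where
    N = suc n * t (suc n)
    l = suc n ∸ R
    R+l : R + l ≡ suc n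
    R+l = ℕ.m+[n∸m]≡n (ℕ.m≤n⇒m≤1+n R≤n)
    j = n ∸ k
    k+j : k + j ≡ n
    k+j = ℕ.m+[n∸m]≡n (ℕ.≤-trans k≤R R≤n)
    x = 1ℚ - partialSum (suc n) R
    T′ : ℕ → ℚ
    T′ m = ι (∑ l (λ i → t (suc (R + i)) * W (R + i) (suc m) 0 0))
    0<N : 0ℚ <ℚ ι N
    0<N = 0<ι′ (ℕ.*-mono-≤ {1} {suc n} (s≤s z≤n) (t>0 (suc n)))
    x≡ : x *ℚ ι N ≡ T′ n
    x≡ = partialSum-tail n R l R+l
    0≤x : 0ℚ ≤ℚ x
    0≤x = *-cancelʳ-≤-pos (ι N) {{positive 0<N}} (subst₂ _≤ℚ_ (sym (*-zeroˡ (ι N))) (sym x≡)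
      (0≤ι (∑ l (λ i → t (suc (R + i)) * W (R + i) (suc n) 0 0))))
    bound : T′ n ≤ℚ ι 2 *ℚ rec k *ℚ ι N
    bound = subst (λ m → T′ m ≤ℚ ι 2 *ℚ rec k *ℚ ι (suc m * t (suc m))) k+j
      (tail-bound {K} k R l j k≤R 0≤K (trans R+l (cong suc (sym k+j))) (λ i R≤i → proj₁ (h i R≤i))
        (subst (λ m → K *ℚ e j ≤ℚ ι 2 *ℚ e m) (sym k+j) (proj₂ (h n R≤n))))

  converges : (r : ℕ) → 1 ≤ r → (ε : ℚ) → 0ℚ <ℚ ε →
    ∃[ N ] ((m n : ℕ) → N ≤ m → N ≤ n → ∣ V m r - V n r ∣ ≤ℚ ε)
  converges (suc i) _ ε 0<ε = let N , h = osc (cauchy-V i) ε 0<ε in N , h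

  sums-to-one : (ε : ℚ) → 0ℚ <ℚ ε → ∃[ R₀ ] ((R : ℕ) → R₀ ≤ R →
    ∃[ N ] ((n : ℕ) → N ≤ n → ∣ 1ℚ - partialSum n R ∣ ≤ℚ ε))
  sums-to-one ε 0<ε =
    let k , rec≤ = archimedean (½ *ℚ ε) (0<½* 0<ε)
        K , 0≤K , N , h = regular k
    -- `R ≥ k` keeps the subtraction in `e (i ∸ k)` genuine, `R ≥ N` makes the ratio bounds hold for
    -- all sizes above `R`, and more than `R` vertices leave `R` terms to split off. The tail 2/(k +
    -- 1) is at most ε, as `k` was chosen for ε/2.
    in k ⊔ N , λ R R≥ → suc R , λ { (suc n) (s≤s R≤n) → ≤-trans
         (near-one {K} k R n (ℕ.m⊔n≤o⇒m≤o k N R≥) R≤n 0≤K (λ i R≤i → h i (ℕ.≤-trans (ℕ.m⊔n≤o⇒n≤o k N R≥) R≤i)))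
         (≤-trans (*-monoˡ (0≤ι 2) rec≤) (≤-reflexive (two-halves ε))) }
    where
    two-halves : ∀ x → ι 2 *ℚ (½ *ℚ x) ≡ x
    two-halves = solve-∀ ring

open Limits

theorem2p9 : ((r : ℕ) → 1 ≤ r → (ε : ℚ) → 0ℚ <ℚ ε →
    ∃[ N ] ((m n : ℕ) → N ≤ m → N ≤ n → ∣ V m r - V n r ∣ ≤ℚ ε))
    ×
    ((ε : ℚ) → 0ℚ <ℚ ε →
    ∃[ R₀ ] ((R : ℕ) → R₀ ≤ R →
    ∃[ N ] ((n : ℕ) → N ≤ n → ∣ 1ℚ - partialSum n R ∣ ≤ℚ ε)))
theorem2p9 = converges , sums-to-one
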